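{- In the bounded-degree signed graph model, the random-walk algorithm $\mathcal A$ described in the context (for a suitable choice of the parameters hidden in its $O(\cdot)$, $\widetilde{O}(\cdot)$ and $\mathrm{poly}(\cdot)$ notation) is a one-sided tester for clusterability with query complexity \[ \widetilde{O}(\sqrt{N}/\mathrm{poly}(\epsilon)). \]
   Context: A signed graph is $G=(V,E,\sigma)$ with node set $V=[N]$, a simple undirected edge set $E$, and a sign $\sigma:E\to\{+,-\}$ on each edge. It is clusterable if there is a partition of the nodes into some (a priori unknown) number of components such that every positive edge connects two nodes in the same component and every negative edge connects two nodes in different components. A bad cycle is a cycle with exactly one negative edge. $G^+=(V,E^+)$ with $E^+=\{e\in E\mid\sigma(e)=+\}$ is the unsigned subgraph of positive edges. Bounded-degree signed graph model: the algorithm is given $N$ and an upper bound $d$ on the degrees of $G$, and may query $(v,i)\in[N]\times[d]$; the answer is the $i$-th neighbor $w$ of $v$ (in arbitrary order) together with the sign $\sigma(v,w)$, or an error symbol if $v$ has fewer than $i$ neighbors. A signed graph is $\epsilon$-far from a property $\mathcal P$ if at least $\epsilon dN$ edge modifications (addition, removal or sign switch) have to be made to obtain a signed graph on $[N]$ satisfying $\mathcal P$. A tester for $\mathcal P$ is a randomized algorithm that, given query access to $G$ and an error parameter $\epsilon>0$, accepts with probability at least $2/3$ if $G$ has $\mathcal P$, and rejects with probability at least $2/3$ if $G$ is $\epsilon$-far from having $\mathcal P$. It is one-sided if it always accepts graphs having $\mathcal P$. The query complexity is the number of queries made. A random walk step on $G^+$ from a node $v$ of degree $d^+(v)$ in $G^+$: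 with probability $d^+(v)/d$ move to a uniformly random neighbor of $v$ in $G^+$, and otherwise stay at $v$. Algorithm $\mathcal A$: repeat $O(1/\epsilon)$ times: pick a uniformly random node $s$ and run the procedure bad-cycle$(s)$; if it returns a bad cycle, reject the graph. If no iteration rejects, accept. Procedure bad-cycle$(s)$: (1) perform $\widetilde{O}(\sqrt N/\mathrm{poly}(\epsilon))$ independent random walks of length $\widetilde{O}(1/\mathrm{poly}(\epsilon))$ on $G^+$ starting from $s$, and let $K$ be the set of all nodes visited; (2) if there is a negative edge of $G$ between any pair of nodes in $K$ (checked by querying the full neighborhood of every node of $K$), return the corresponding bad cycle. $\mathrm{poly}(\epsilon)$ denotes some fixed polynomial in $\epsilon$. In the bounded-degree model, $\widetilde{O}(\cdot)$ hides factors polylogarithmic in its argument and in $N$, and a polynomial dependence on the degree bound $d$. -}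

module Defs where

open import Algebra.Definitions.RawMonoid using (sum)
open import Algebra.Definitions.RawSemiring using () renaming (_^_ to pow)
open import Data.Bool.Base using (Bool; true; false; if_then_else_; not)
open import Data.Fin.Base using (Fin; toℕ)
open import Data.Fin.Properties using (_≟_; _<?_)
open import Data.Integer.Base using (+_; ∣_∣)
open import Data.List.Base as List
  using (List; []; _∷_; _++_; allFin; cartesianProduct; catMaybes; concat;
         deduplicate; drop; filter; head; length; mapMaybe; reverse)
import Data.List.Membership.DecPropositional as DecMembership
open import Data.List.Relation.Binary.Permutation.Propositional using (_↭_)
open import Data.Maybe.Base as Maybe using (Maybe; just; nothing; maybe)
import Data.Maybe.Properties as Maybe
open import Data.Nat.Base as ℕ using (ℕ; zero; suc; NonZero)
open import Data.Nat.Logarithm using (⌈log₂_⌉)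
open import Data.Product.Base using (Σ-syntax; ∃-syntax; _×_; _,_; proj₁; proj₂)
open import Data.Rational.Base as ℚ using (ℚ; 0ℚ; 1ℚ; Positive; _/_; 1/_; ceiling)
open import Data.Rational.Properties using (pos⇒nonZero)
open import Data.Sign.Base using (Sign)
import Data.Sign.Properties as Sign
import Data.Vec.Functional as Vector
open import Function.Base using (id; _∘_; case_of_)
open import Relation.Binary.PropositionalEquality.Core using (_≡_; _≢_)
open import Relation.Nullary.Decidable.Core using (⌊_⌋; ¬?)

private
  variable
    N d : ℕ
    A B : Set

fromℕ : ℕ → ℚ
fromℕ n = + n / 1

infixr 8 _^_
_^_ : ℚ → ℕ → ℚ
_^_ = pow ℚ.+-*-rawSemiring

record SignedGraph (N : ℕ) : Set where
  field
    edge       : Fin N → Fin N → Maybe Sign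
    symmetric  : ∀ u v → edge u v ≡ edge v u
    loopless   : ∀ v → edge v v ≡ nothing

  incidences : Fin N → List (Fin N × Sign)
  incidences v = mapMaybe (λ w → Maybe.map (w ,_) (edge v w)) (allFin N)

  degree : Fin N → ℕ
  degree v = length (incidences v)

open SignedGraph

Property : Set₁
Property = ∀ {N} → SignedGraph N → Set

-- The components are the nonempty fibres of the labelling.
Clusterable : Property
Clusterable {N} G =
  ∃[ k ] Σ[ component ∈ (Fin N → Fin k) ]
    (∀ u v → edge G u v ≡ just Sign.+ → component u ≡ component v) ×
    (∀ u v → edge G u v ≡ just Sign.- → component u ≢ component v)

nodePairs : ∀ N → List (Fin N × Fin N)
nodePairs N =
  filter (λ (u , v) → u <? v) (cartesianProduct (allFin N) (allFin N))

-- One modification (adding, removing or switching the sign of an edge)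
-- changes the status of one unordered pair of nodes.
modifications : SignedGraph N → SignedGraph N → ℕ
modifications {N} G H =
  length (filter (λ (u , v) → ¬? (Maybe.≡-dec Sign._≟_ (edge G u v) (edge H u v)))
                 (nodePairs N))

Far : ℚ → ℕ → Property → SignedGraph N → Set
Far {N} ε d 𝒫 G =
  ∀ (H : SignedGraph N) → 𝒫 H →
    ε ℚ.* fromℕ (d ℕ.* N) ℚ.≤ fromℕ (modifications G H)

Oracle : ℕ → ℕ → Set
Oracle N d = Fin N → Fin d → Maybe (Fin N × Sign)

-- A graph of degree at most d, with the neighbours of each node listed
-- in an arbitrary order.
record Access (G : SignedGraph N) (d : ℕ) : Set where
  field
    degree≤d   : ∀ v → degree G v ℕ.≤ d
    neighbours : Fin N → List (Fin N × Sign)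
    ordering   : ∀ v → neighbours v ↭ incidences G v

  oracle : Oracle N d
  oracle v i = head (drop (toℕ i) (neighbours v))

open Access

data Program (N d : ℕ) (A : Set) : Set where
  return  : A → Program N d A
  query   : Fin N → Fin d → (Maybe (Fin N × Sign) → Program N d A) → Program N d A
  uniform : ∀ n → .{{NonZero n}} → (Fin n → Program N d A) → Program N d A

infixl 1 _>>=_
_>>=_ : Program N d A → (A → Program N d B) → Program N d B
return x    >>= f = f x
query v i k >>= f = query v i (λ a → k a >>= f)
uniform n k >>= f = uniform n (λ j → k j >>= f)

mapM : (A → Program N d B) → List A → Program N d (List B)
mapM f []       = return []
mapM f (x ∷ xs) = do
  y  ← f x
  ys ← mapM f xs
  return (y ∷ ys)

replicateM : ℕ → Program N d A → Program N d (List A)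
replicateM n p = mapM (λ _ → p) (List.replicate n p)

-- Probability that the output satisfies the event E.
Pr : Oracle N d → (A → Bool) → Program N d A → ℚ
Pr O E (return x)    = if E x then 1ℚ else 0ℚ
Pr O E (query v i k) = Pr O E (k (O v i))
Pr O E (uniform n k) = (+ 1 / n) ℚ.* sum ℚ.+-0-rawMonoid (λ j → Pr O E (k j))

-- The worst case over the random choices.
queries : Oracle N d → Program N d A → ℕ
queries O (return x)    = 0
queries O (query v i k) = suc (queries O (k (O v i)))
queries O (uniform n k) = Vector.foldr ℕ._⊔_ 0 (λ j → queries O (k j))

-- If N = 0 or d = 0, then every graph is ε-far from every property.
record Input : Set where
  field
    #nodes degreeBound : ℕ
    ε : ℚ
    {{#nodes≢0}}      : NonZero #nodes
    {{degreeBound≢0}} : NonZero degreeBound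
    {{ε>0}}           : Positive ε

  1/ε : ℚ
  1/ε = (1/ ε) {{pos⇒nonZero ε}}

open Input using (1/ε)

-- The output true means acceptance.
Algorithm : Set
Algorithm = (I : Input) → Program (Input.#nodes I) (Input.degreeBound I) Bool

IsTester : Property → Algorithm → Set
IsTester 𝒫 𝒜 = ∀ I → let open Input I in
  (G : SignedGraph #nodes) (access : Access G degreeBound) →
    (𝒫 G → + 2 / 3 ℚ.≤ Pr (oracle access) id (𝒜 I)) ×
    (Far ε degreeBound 𝒫 G → + 2 / 3 ℚ.≤ Pr (oracle access) not (𝒜 I))

IsOneSided : Property → Algorithm → Set
IsOneSided 𝒫 𝒜 = ∀ I → let open Input I in
  (G : SignedGraph #nodes) (access : Access G degreeBound) →
    𝒫 G → Pr (oracle access) id (𝒜 I) ≡ 1ℚ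

IsOneSidedTester : Property → Algorithm → Set
IsOneSidedTester 𝒫 𝒜 = IsTester 𝒫 𝒜 × IsOneSided 𝒫 𝒜

QueryComplexity≤ : Algorithm → (Input → ℕ) → Set
QueryComplexity≤ 𝒜 q = ∀ I → let open Input I in
  (G : SignedGraph #nodes) (access : Access G degreeBound) →
    queries (oracle access) (𝒜 I) ℕ.≤ q I

infix 4 _∈O_ _∈Õ_ _∈Õ√_

-- Asymptotic bounds are uniform in the number of nodes N ≥ 1, the degree
-- bound d ≥ 1 and ε > 0.
_∈O_ : (Input → ℕ) → (Input → ℚ) → Set
f ∈O g = ∃[ c ] ∀ I → fromℕ (f I) ℚ.≤ fromℕ c ℚ.* g I

-- The factor hidden by Õ(x): polynomial in d, polylogarithmic in N and x.
-- The summand 1 keeps it from vanishing when N and x are at most 1.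
hidden : (c a b : ℕ) → Input → ℚ → ℕ
hidden c a b I x =
  c ℕ.* degreeBound ℕ.^ a ℕ.*
    (1 ℕ.+ ⌈log₂ #nodes ⌉ ℕ.+ ⌈log₂ ∣ ceiling x ∣ ⌉) ℕ.^ b
  where open Input I

_∈Õ_ : (Input → ℕ) → (Input → ℚ) → Set
f ∈Õ g = ∃[ c ] ∃[ a ] ∃[ b ] ∀ I →
  fromℕ (f I) ℚ.≤ fromℕ (hidden c a b I (g I)) ℚ.* g I

-- f ∈ Õ(√g), for g ≥ 0: the inequality f ≤ hidden · √g is squared, and
-- log √g = (log g) / 2 differs from log g by a constant factor only.
_∈Õ√_ : (Input → ℕ) → (Input → ℚ) → Set
f ∈Õ√ g = ∃[ c ] ∃[ a ] ∃[ b ] ∀ I →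
  fromℕ (f I) ^ 2 ℚ.≤ fromℕ (hidden c a b I (g I)) ^ 2 ℚ.* g I

-- A polynomial that is positive on (0, 1] is at least some constant times
-- εᵏ there, so 1/poly(ε) is taken to be ε⁻ᵏ.
Õ[1/poly[ε]] : (Input → ℕ) → Set
Õ[1/poly[ε]] f = ∃[ k ] f ∈Õ (λ I → 1/ε I ^ k)

-- √N/εᵏ is the square root of N·(ε⁻ᵏ)².
Õ[√N/poly[ε]] : (Input → ℕ) → Set
Õ[√N/poly[ε]] f = ∃[ k ] f ∈Õ√ (λ I → fromℕ (Input.#nodes I) ℚ.* (1/ε I ^ k) ^ 2)

neighbourhood : Fin N → Program N d (List (Fin N × Sign))
neighbourhood {d = d} v = do
  answers ← mapM (λ i → query v i return) (allFin d)
  return (catMaybes answers)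

ofSign : Sign → List (Fin N × Sign) → List (Fin N)
ofSign σ = List.map proj₁ ∘ filter (λ (_ , τ) → τ Sign.≟ σ)

-- true with probability k/n, for k ≤ n
bernoulli : (k n : ℕ) → .{{NonZero n}} → Program N d Bool
bernoulli k n = uniform n (λ j → return (toℕ j ℕ.<ᵇ k))

-- The default is only used for the empty list.
pick : A → List A → Program N d A
pick default []         = return default
pick default xs@(_ ∷ _) = uniform (length xs) (λ j → return (List.lookup xs j))

step : .{{NonZero d}} → Fin N → Program N d (Fin N)
step {d = d} v = do
  incident ← neighbourhood v
  let positive = ofSign Sign.+ incident
  move ← bernoulli (length positive) d
  if move then pick v positive else return v

-- The nodes visited by a walk of the given length, starting node included.
walk : .{{NonZero d}} → ℕ → Fin N → Program N d (List (Fin N))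
walk zero    v = return (v ∷ [])
walk (suc ℓ) v = do
  w  ← step v
  vs ← walk ℓ w
  return (v ∷ vs)

module _ {N : ℕ} where
  open DecMembership (_≟_ {N}) using (_∈?_)

  upTo : Fin N → List (Fin N) → List (Fin N)
  upTo u []       = []
  upTo u (x ∷ xs) = x ∷ (if ⌊ x ≟ u ⌋ then [] else upTo u xs)

  after : Fin N → List (Fin N) → List (Fin N)
  after u []       = []
  after u (x ∷ xs) = if ⌊ x ≟ u ⌋ then xs else after u xs

  eraseLoops : List (Fin N) → List (Fin N)
  eraseLoops []       = []
  eraseLoops (x ∷ xs) =
    let p = eraseLoops xs in x ∷ (if ⌊ x ∈? p ⌋ then after x p else p)

  pathTo : List (List (Fin N)) → Fin N → List (Fin N)
  pathTo walks u = maybe (upTo u) [] (head (filter (u ∈?_) walks))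

  -- For a negative edge {u , w} between visited nodes, the simple positive
  -- path from u to w obtained by going back to the common starting node of
  -- the walks; the edge {u , w} closes it to a bad cycle.
  cycleThrough : List (List (Fin N)) → Fin N × Fin N → List (Fin N)
  cycleThrough walks (u , w) =
    eraseLoops (reverse (pathTo walks u) ++ drop 1 (pathTo walks w))

  badCycle : .{{NonZero d}} → (walks ℓ : ℕ) → Fin N →
             Program N d (Maybe (List (Fin N)))
  badCycle #walks ℓ s = do
    walks ← replicateM #walks (walk ℓ s)
    let K = deduplicate _≟_ (concat walks)
    negative ← mapM (negativeWithin K) K
    return (Maybe.map (cycleThrough walks) (head (concat negative)))
    where
    negativeWithin : List (Fin N) → Fin N → Program N _ (List (Fin N × Fin N))
    negativeWithin K u = do
      incident ← neighbourhood u
      return (List.map (u ,_) (filter (_∈? K) (ofSign Sign.- incident)))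

randomWalkTester : (repetitions walks ℓ : Input → ℕ) → Algorithm
randomWalkTester repetitions #walks ℓ I = loop (repetitions I)
  where
  open Input I
  loop : ℕ → Program #nodes degreeBound Bool
  loop zero    = return true
  loop (suc t) = do
    s      ← uniform #nodes return
    result ← badCycle (#walks I) (ℓ I) s
    case result of λ where
      (just _) → return false
      nothing  → loop t

{-# OPTIONS --safe #-}
module Submission where

-- Let P be the walk on G⁺, let H be a set of nodes, and let Q be the walk
-- watched on H, where an excursion from H of more than ℓ steps kills it. Q is
-- symmetric and dominates P on H. Long excursions are disjoint in time, so they
-- start at a rate of at most 1/ℓ: if H is large, then Q survives T ≪ ℓ steps
-- from an average start s in H. For such s, ‖a‖² for the law a of Q after t
-- steps stays above 1/(4N), so for some t < T = Õ(log N) it decays slowly, and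
-- q = a + Q a has small energy.
--   If the negative edges see much of q, that is ⟨q, A⁻q⟩ ≥ γ‖q‖², then by the
-- second moment method O(√N/γ) walks from s hit both ends of a negative edge.
--   Otherwise some level set of q² is cheap to separate: by Cheeger's argument
-- few positive edges leave it in H, and few negative edges lie in it. Cut it
-- off as a cluster and repeat with the rest of H.
--   So if the tester rarely rejects, then the clusters exhaust almost all nodes,
-- at the cost of fewer than εdN edges. Walks are always taken in G, and H only
-- serves to select nodes of these walks.

open import Defs
open import Algebra.Bundles using (CommutativeRing)
open import Data.Bool.Base using (Bool; true; false; if_then_else_; not; _∧_)
open import Data.Bool.Properties as Bool using (¬-not)
open import Data.Fin.Base as Fin using (Fin; zero; suc)
import Data.Fin.Properties as Fin
open import Data.Integer.Base as ℤ using ()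
import Data.Integer.Properties as ℤ
open import Data.List.Base as List using (List; []; _∷_; _++_; allFin; cartesianProduct; catMaybes; concat; deduplicate; drop; filter; head; length; mapMaybe; replicate; tabulate)
open import Data.List.Membership.DecPropositional using () renaming (_∈?_ to mem?)
open import Data.List.Membership.Propositional using (_∈_)
import Data.List.Membership.Propositional.Properties as Mem
import Data.List.Properties as List
open import Data.List.Relation.Binary.Permutation.Propositional as Perm using (_↭_)
import Data.List.Relation.Binary.Permutation.Propositional.Properties as Perm
open import Data.List.Relation.Unary.All as All using (All; []; _∷_)
import Data.List.Relation.Unary.All.Properties as All
open import Data.List.Relation.Unary.Any using (here; there)
open import Data.Maybe.Base as Maybe using (Maybe; just; nothing)
open import Data.Nat.Base as ℕ using (ℕ; zero; suc; NonZero)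
import Data.Nat.DivMod as ℕ
open import Data.Nat.Logarithm using (⌈log₂_⌉; ⌈log₂⌉-mono-≤; ⌈log₂⌈n/2⌉⌉≡⌈log₂n⌉∸1)
import Data.Nat.Properties as ℕ
open import Data.Nat.Tactic.RingSolver using (solve-∀)
open import Data.Product.Base using (Σ-syntax; ∃-syntax; _×_; _,_; proj₁; proj₂)
open import Data.Rational.Base as ℚ using (ℚ; 0ℚ; 1ℚ; _+_; _*_; _-_; -_; _≤_; _<_; _⊓_; _⊔_)
open import Data.Rational.Properties as ℚ using (+-*-commutativeRing)
open import Data.Rational.Solver using (module +-*-Solver)
open import Data.Rational.Unnormalised.Base as ℚᵘ using (mkℚᵘ)
import Data.Rational.Unnormalised.Properties as ℚᵘ
open import Data.Sign.Base using (Sign)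
import Data.Sign.Properties as Sign
open import Data.Sum.Base using (_⊎_; inj₁; inj₂)
import Data.Vec.Functional
open import Function.Base using (id; _∘_; case_of_)
open import Relation.Binary.PropositionalEquality hiding (J)
open import Relation.Nullary using (¬_; yes; no; contradiction; Dec; does)
open import Relation.Nullary.Decidable using (dec-true; dec-false)
open import Algebra.Properties.Semiring.Sum (CommutativeRing.semiring +-*-commutativeRing) using (sum; sum-cong-≗; ∑-distrib-+; ∑-comm; *-distribˡ-sum; *-distribʳ-sum; sum-replicate-zero)
open +-*-Solver using (Polynomial; solve; _:+_; _:*_; _:-_; :-_; _:=_; con)

-- The obstacle is adaptivity: the clusters are cut off one after another, yet the tester walks in
-- all of G and knows none of them. A walk confined to H would be a different process; watching the
-- real walk on H keeps the tester's own samples, and cutting off excursions at `ℓ` bounds the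
-- number of real steps behind `T` watched ones. Both horns of the dichotomy are read off the same
-- vector q. The form ⟨q, A⁻q⟩ is the expected number of negative edges between the marks of two
-- independent walks, and it also bounds the negative edges in the level sets of q². Only a lower
-- bound on ‖q‖² is needed: concentration of q makes collisions more frequent, and the worst case
-- ‖q‖² of order 1/N is what costs √N walks. Spikes of q do not spoil the variance, because each
-- square q(v)² is a single term of ‖q‖². The argument stays within ℚ, without eigenvalues or real
-- roots: weighted AM-GM replaces Cauchy-Schwarz, a telescoping product replaces exponential decay,
-- and inequalities are reduced to ring identities with a nonnegative remainder.

private
  variable
    n : ℕ

2ℚ : ℚ
2ℚ = (ℤ.+ 2) ℚ./ 1

:0 :1 :2 : Polynomial n
:0 = con 0ℚ
:1 = con 1ℚ
:2 = con 2ℚ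

infix 9 :ℕ_
:ℕ_ : ℕ → Polynomial n
:ℕ k = con (fromℕ k)

-- Ordered-field arithmetic

-- The explicit slack `r` leaves a ring identity for the solver and the sign of a single term; most
-- inequalities below are proved in this form.
≤-by : ∀ {x y} r → 0ℚ ≤ r → y ≡ x + r → x ≤ y
≤-by {x} {y} r 0≤r eq = begin
  x  ≡⟨ ℚ.+-identityʳ x ⟨
  x + 0ℚ  ≤⟨ ℚ.+-monoʳ-≤ x 0≤r ⟩
  x + r  ≡⟨ eq ⟨
  y  ∎
  where open ℚ.≤-Reasoning

p≤q⇒0≤q-p : ∀ {p q} → p ≤ q → 0ℚ ≤ q - p
p≤q⇒0≤q-p {p} {q} p≤q = begin
  0ℚ  ≡⟨ ℚ.+-inverseʳ p ⟨
  p - p  ≤⟨ ℚ.+-monoˡ-≤ (- p) p≤q ⟩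
  q - p  ∎
  where open ℚ.≤-Reasoning

+-nonneg : ∀ {p q} → 0ℚ ≤ p → 0ℚ ≤ q → 0ℚ ≤ p + q
+-nonneg = ℚ.+-mono-≤

*-nonneg : ∀ {p q} → 0ℚ ≤ p → 0ℚ ≤ q → 0ℚ ≤ p * q
*-nonneg {p} {q} 0≤p 0≤q = subst (_≤ p * q) (ℚ.*-zeroʳ p)
  (ℚ.*-monoˡ-≤-nonNeg p {{ℚ.nonNegative 0≤p}} 0≤q)

*-monoˡ-≤ : ∀ {r p q} → 0ℚ ≤ r → p ≤ q → r * p ≤ r * q
*-monoˡ-≤ {r} 0≤r p≤q = ℚ.*-monoˡ-≤-nonNeg r {{ℚ.nonNegative 0≤r}} p≤q

*-monoʳ-≤ : ∀ {r p q} → 0ℚ ≤ r → p ≤ q → p * r ≤ q * r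
*-monoʳ-≤ {r} 0≤r p≤q = ℚ.*-monoʳ-≤-nonNeg r {{ℚ.nonNegative 0≤r}} p≤q

*-mono-≤ : ∀ {p q r s} → 0ℚ ≤ p → 0ℚ ≤ s → p ≤ q → r ≤ s → p * r ≤ q * s
*-mono-≤ 0≤p 0≤s p≤q r≤s = ℚ.≤-trans (*-monoˡ-≤ 0≤p r≤s) (*-monoʳ-≤ 0≤s p≤q)

square-nonneg : ∀ p → 0ℚ ≤ p * p
square-nonneg p with ℚ.≤-total 0ℚ p
... | inj₁ 0≤p = *-nonneg 0≤p 0≤p
... | inj₂ p≤0 = subst (0ℚ ≤_) (solve 1 (λ p → (:- p) :* (:- p) := p :* p) refl p)
  (*-nonneg (ℚ.neg-antimono-≤ p≤0) (ℚ.neg-antimono-≤ p≤0))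

*-cancelˡ-≤ : ∀ r {p q} → 0ℚ < r → r * p ≤ r * q → p ≤ q
*-cancelˡ-≤ r 0<r = ℚ.*-cancelˡ-≤-pos r {{ℚ.positive 0<r}}

*-monoˡ-< : ∀ {r p q} → 0ℚ < r → p < q → r * p < r * q
*-monoˡ-< {r} 0<r p<q = ℚ.*-monoʳ-<-pos r {{ℚ.positive 0<r}} p<q

*-pos : ∀ {p q} → 0ℚ < p → 0ℚ < q → 0ℚ < p * q
*-pos {p} {q} 0<p 0<q = subst (_< p * q) (ℚ.*-zeroʳ p) (*-monoˡ-< 0<p 0<q)

square-cancel-≤ : ∀ {p q} → 0ℚ ≤ q → p * p ≤ q * q → p ≤ q
square-cancel-≤ {p} {q} 0≤q pp≤qq with p ℚ.≤? q
... | yes p≤q = p≤q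
... | no p≰q = contradiction pp≤qq (λ h → ℚ.<-irrefl refl (ℚ.<-≤-trans qq<pp h))
  where
  q<p : q < p
  q<p = ℚ.≰⇒> p≰q
  qq<pp : q * q < p * p
  qq<pp = ℚ.≤-<-trans (*-monoˡ-≤ 0≤q (ℚ.<⇒≤ q<p))
    (subst₂ _<_ (ℚ.*-comm p q) refl (*-monoˡ-< (ℚ.≤-<-trans 0≤q q<p) q<p))

0≤1 : 0ℚ ≤ 1ℚ
0≤1 = ℚ.*≤* (ℤ.+≤+ ℕ.z≤n)

0≤2 : 0ℚ ≤ 2ℚ
0≤2 = ℚ.*≤* (ℤ.+≤+ ℕ.z≤n)

-- Naturals as rationals

fromℕ-+ : ∀ m n → fromℕ (m ℕ.+ n) ≡ fromℕ m + fromℕ n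
fromℕ-+ m n = ℚ.toℚᵘ-injective (begin
  ℚ.toℚᵘ (fromℕ (m ℕ.+ n))  ≈⟨ ℚ.toℚᵘ-fromℚᵘ (mkℚᵘ (ℤ.+ (m ℕ.+ n)) 0) ⟩
  mkℚᵘ (ℤ.+ (m ℕ.+ n)) 0  ≡⟨ cong₂ (λ i j → mkℚᵘ (i ℤ.+ j) 0) (ℤ.*-identityʳ (ℤ.+ m)) (ℤ.*-identityʳ (ℤ.+ n)) ⟨
  mkℚᵘ (ℤ.+ m) 0 ℚᵘ.+ mkℚᵘ (ℤ.+ n) 0  ≈⟨ ℚᵘ.+-cong (ℚ.toℚᵘ-fromℚᵘ (mkℚᵘ (ℤ.+ m) 0)) (ℚ.toℚᵘ-fromℚᵘ (mkℚᵘ (ℤ.+ n) 0)) ⟨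
  ℚ.toℚᵘ (fromℕ m) ℚᵘ.+ ℚ.toℚᵘ (fromℕ n)  ≈⟨ ℚ.toℚᵘ-homo-+ (fromℕ m) (fromℕ n) ⟨
  ℚ.toℚᵘ (fromℕ m + fromℕ n)  ∎)
  where open import Relation.Binary.Reasoning.Setoid ℚᵘ.≃-setoid

fromℕ-nonneg : ∀ n → 0ℚ ≤ fromℕ n
fromℕ-nonneg n = ℚ.nonNegative⁻¹ (fromℕ n) {{ℚ.normalize-nonNeg n 1}}

fromℕ-suc : ∀ n → fromℕ (suc n) ≡ 1ℚ + fromℕ n
fromℕ-suc n = fromℕ-+ 1 n

fromℕ-* : ∀ m n → fromℕ (m ℕ.* n) ≡ fromℕ m * fromℕ n
fromℕ-* zero    n = sym (ℚ.*-zeroˡ (fromℕ n))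
fromℕ-* (suc m) n = begin
  fromℕ (n ℕ.+ m ℕ.* n)  ≡⟨ fromℕ-+ n (m ℕ.* n) ⟩
  fromℕ n + fromℕ (m ℕ.* n)  ≡⟨ cong (fromℕ n +_) (fromℕ-* m n) ⟩
  fromℕ n + fromℕ m * fromℕ n  ≡⟨ solve 2 (λ x y → y :+ x :* y := (:1 :+ x) :* y) refl (fromℕ m) (fromℕ n) ⟩
  (1ℚ + fromℕ m) * fromℕ n  ≡⟨ cong (_* fromℕ n) (fromℕ-suc m) ⟨
  fromℕ (suc m) * fromℕ n  ∎
  where open ≡-Reasoning

fromℕ-mono-≤ : ∀ {m n} → m ℕ.≤ n → fromℕ m ≤ fromℕ n
fromℕ-mono-≤ {m} {n} m≤n = ≤-by (fromℕ (n ℕ.∸ m)) (fromℕ-nonneg (n ℕ.∸ m))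
  (trans (cong fromℕ (sym (ℕ.m+[n∸m]≡n m≤n))) (fromℕ-+ m (n ℕ.∸ m)))

0<1 : 0ℚ < 1ℚ
0<1 = ℚ.*<* (ℤ.+<+ (ℕ.s≤s ℕ.z≤n))

0<2 : 0ℚ < 2ℚ
0<2 = ℚ.*<* (ℤ.+<+ (ℕ.s≤s ℕ.z≤n))

fromℕ-pos : ∀ n .{{_ : NonZero n}} → 0ℚ < fromℕ n
fromℕ-pos (suc n) = ℚ.<-≤-trans 0<1 (fromℕ-mono-≤ {1} {suc n} (ℕ.s≤s ℕ.z≤n))

-- Finite sums

sum-mono-≤ : {f g : Fin n → ℚ} → (∀ i → f i ≤ g i) → sum f ≤ sum g
sum-mono-≤ {zero}  f≤g = ℚ.≤-refl
sum-mono-≤ {suc n} f≤g = ℚ.+-mono-≤ (f≤g zero) (sum-mono-≤ (f≤g ∘ suc))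

sum-nonneg : {f : Fin n → ℚ} → (∀ i → 0ℚ ≤ f i) → 0ℚ ≤ sum f
sum-nonneg {zero}  0≤f = ℚ.≤-refl
sum-nonneg {suc n} 0≤f = +-nonneg (0≤f zero) (sum-nonneg (0≤f ∘ suc))

sum-*ˡ : ∀ c (f : Fin n → ℚ) → sum (λ i → c * f i) ≡ c * sum f
sum-*ˡ c f = sym (*-distribˡ-sum c f)

sum-*ʳ : ∀ c (f : Fin n → ℚ) → sum (λ i → f i * c) ≡ sum f * c
sum-*ʳ c f = sym (*-distribʳ-sum c f)

sum-- : (f g : Fin n → ℚ) → sum (λ i → f i - g i) ≡ sum f - sum g
sum-- {n} f g = begin
  sum (λ i → f i - g i)  ≡⟨ ∑-distrib-+ f (λ i → - g i) ⟩
  sum f + sum (λ i → - g i)  ≡⟨ cong (sum f +_) (sum-cong-≗ {n} (λ i → solve 1 (λ x → :- x := con (- 1ℚ) :* x) refl (g i))) ⟩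
  sum f + sum (λ i → - 1ℚ * g i)  ≡⟨ cong (sum f +_) (sum-*ˡ (- 1ℚ) g) ⟩
  sum f + - 1ℚ * sum g  ≡⟨ solve 2 (λ x y → x :+ con (- 1ℚ) :* y := x :- y) refl (sum f) (sum g) ⟩
  sum f - sum g  ∎
  where open ≡-Reasoning

sum-0 : sum {n} (λ _ → 0ℚ) ≡ 0ℚ
sum-0 {n} = sum-replicate-zero n

sum-const : ∀ n c → sum {n} (λ _ → c) ≡ fromℕ n * c
sum-const zero    c = sym (ℚ.*-zeroˡ c)
sum-const (suc n) c = begin
  c + sum {n} (λ _ → c)  ≡⟨ cong (c +_) (sum-const n c) ⟩
  c + fromℕ n * c  ≡⟨ solve 2 (λ c x → c :+ x :* c := (:1 :+ x) :* c) refl c (fromℕ n) ⟩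
  (1ℚ + fromℕ n) * c  ≡⟨ cong (_* c) (fromℕ-suc n) ⟨
  fromℕ (suc n) * c  ∎
  where open ≡-Reasoning

term≤sum : {f : Fin n → ℚ} → (∀ i → 0ℚ ≤ f i) → ∀ i → f i ≤ sum f
term≤sum {suc n} {f} 0≤f zero    = ≤-by (sum (f ∘ suc)) (sum-nonneg (0≤f ∘ suc)) refl
term≤sum {suc n} {f} 0≤f (suc i) =
  ≤-by (f zero + (sum (f ∘ suc) - f (suc i)))
    (+-nonneg (0≤f zero) (p≤q⇒0≤q-p (term≤sum (0≤f ∘ suc) i)))
    (solve 3 (λ x y z → x :+ z := y :+ (x :+ (z :- y))) refl (f zero) (f (suc i)) (sum (f ∘ suc)))

sum₂ : (Fin n → Fin n → ℚ) → ℚ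
sum₂ w = sum (λ u → sum (w u))

sum₂-cong : {w w′ : Fin n → Fin n → ℚ} → (∀ u v → w u v ≡ w′ u v) → sum₂ w ≡ sum₂ w′
sum₂-cong {n} w≗w′ = sum-cong-≗ {n} (λ u → sum-cong-≗ {n} (w≗w′ u))

sum₂-mono-≤ : {w w′ : Fin n → Fin n → ℚ} → (∀ u v → w u v ≤ w′ u v) → sum₂ w ≤ sum₂ w′
sum₂-mono-≤ w≤w′ = sum-mono-≤ (λ u → sum-mono-≤ (w≤w′ u))

sum₂-nonneg : {w : Fin n → Fin n → ℚ} → (∀ u v → 0ℚ ≤ w u v) → 0ℚ ≤ sum₂ w
sum₂-nonneg 0≤w = sum-nonneg (λ u → sum-nonneg (0≤w u))

sum₂-+ : (w w′ : Fin n → Fin n → ℚ) → sum₂ (λ u v → w u v + w′ u v) ≡ sum₂ w + sum₂ w′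
sum₂-+ {n} w w′ = trans (sum-cong-≗ {n} (λ u → ∑-distrib-+ (w u) (w′ u))) (∑-distrib-+ (λ u → sum (w u)) (λ u → sum (w′ u)))

sum₂-*ˡ : ∀ c (w : Fin n → Fin n → ℚ) → sum₂ (λ u v → c * w u v) ≡ c * sum₂ w
sum₂-*ˡ {n} c w = trans (sum-cong-≗ {n} (λ u → sum-*ˡ c (w u))) (sum-*ˡ c (λ u → sum (w u)))

sum₂-0 : sum₂ {n} (λ _ _ → 0ℚ) ≡ 0ℚ
sum₂-0 {n} = trans (sum-cong-≗ {n} (λ _ → sum-0 {n})) (sum-0 {n})

sum-<⇒∃< : (f g : Fin n → ℚ) → sum f < sum g → ∃[ i ] f i < g i
sum-<⇒∃< {n} f g Σf<Σg with Fin.any? (λ i → f i ℚ.<? g i)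
... | yes i,f<g = i,f<g
... | no ∄ = contradiction Σf<Σg
  (λ h → ℚ.<-irrefl refl (ℚ.<-≤-trans h (sum-mono-≤ (λ i → ℚ.≮⇒≥ (λ f<g → ∄ (i , f<g))))))

-- Indicators, inner products and kernels

𝟙 : Bool → ℚ
𝟙 b = if b then 1ℚ else 0ℚ

𝟙-nonneg : ∀ b → 0ℚ ≤ 𝟙 b
𝟙-nonneg true  = 0≤1
𝟙-nonneg false = ℚ.≤-refl

𝟙≤1 : ∀ b → 𝟙 b ≤ 1ℚ
𝟙≤1 true  = ℚ.≤-refl
𝟙≤1 false = 0≤1

𝟙-idem : ∀ b → 𝟙 b * 𝟙 b ≡ 𝟙 b
𝟙-idem true  = refl
𝟙-idem false = refl

𝟙-not : ∀ b → 𝟙 b + 𝟙 (not b) ≡ 1ℚ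
𝟙-not true  = refl
𝟙-not false = refl

infix 7 _·_
_·_ : (Fin n → ℚ) → (Fin n → ℚ) → ℚ
f · g = sum (λ i → f i * g i)

infixr 8 _⋆_
_⋆_ : (Fin n → Fin n → ℚ) → (Fin n → ℚ) → Fin n → ℚ
(K ⋆ f) u = K u · f

·-comm : (f g : Fin n → ℚ) → f · g ≡ g · f
·-comm {n} f g = sum-cong-≗ {n} (λ i → ℚ.*-comm (f i) (g i))

·-congˡ : (f : Fin n → ℚ) {g h : Fin n → ℚ} → (∀ i → g i ≡ h i) → f · g ≡ f · h
·-congˡ {n} f g≗h = sum-cong-≗ {n} (λ i → cong (f i *_) (g≗h i))

·-congʳ : (f : Fin n → ℚ) {g h : Fin n → ℚ} → (∀ i → g i ≡ h i) → g · f ≡ h · f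
·-congʳ {n} f g≗h = sum-cong-≗ {n} (λ i → cong (_* f i) (g≗h i))

·-+ˡ : (f g h : Fin n → ℚ) → (λ i → f i + g i) · h ≡ f · h + g · h
·-+ˡ {n} f g h = trans (sum-cong-≗ {n} (λ i → ℚ.*-distribʳ-+ (h i) (f i) (g i))) (∑-distrib-+ (λ i → f i * h i) (λ i → g i * h i))

·-+ʳ : (f g h : Fin n → ℚ) → f · (λ i → g i + h i) ≡ f · g + f · h
·-+ʳ {n} f g h = trans (sum-cong-≗ {n} (λ i → ℚ.*-distribˡ-+ (f i) (g i) (h i))) (∑-distrib-+ (λ i → f i * g i) (λ i → f i * h i))

·--ʳ : (f g h : Fin n → ℚ) → f · (λ i → g i - h i) ≡ f · g - f · h
·--ʳ {n} f g h = trans (sum-cong-≗ {n} (λ i → solve 3 (λ x y z → x :* (y :- z) := x :* y :- x :* z) refl (f i) (g i) (h i))) (sum-- (λ i → f i * g i) (λ i → f i * h i))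

·--ˡ : (f g h : Fin n → ℚ) → (λ i → f i - g i) · h ≡ f · h - g · h
·--ˡ f g h = trans (·-comm _ h) (trans (·--ʳ h f g) (cong₂ _-_ (·-comm h f) (·-comm h g)))

·-*ʳ : ∀ c (f g : Fin n → ℚ) → f · (λ i → c * g i) ≡ c * (f · g)
·-*ʳ {n} c f g = trans (sum-cong-≗ {n} (λ i → solve 3 (λ c x y → x :* (c :* y) := c :* (x :* y)) refl c (f i) (g i))) (sum-*ˡ c (λ i → f i * g i))

·-0ʳ : (f : Fin n → ℚ) → f · (λ _ → 0ℚ) ≡ 0ℚ
·-0ʳ {n} f = trans (sum-cong-≗ {n} (λ i → ℚ.*-zeroʳ (f i))) (sum-0 {n})

·-monoʳ : {f g h : Fin n → ℚ} → (∀ i → 0ℚ ≤ f i) → (∀ i → g i ≤ h i) → f · g ≤ f · h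
·-monoʳ 0≤f g≤h = sum-mono-≤ (λ i → *-monoˡ-≤ (0≤f i) (g≤h i))

·-nonneg : {f g : Fin n → ℚ} → (∀ i → 0ℚ ≤ f i) → (∀ i → 0ℚ ≤ g i) → 0ℚ ≤ f · g
·-nonneg 0≤f 0≤g = sum-nonneg (λ i → *-nonneg (0≤f i) (0≤g i))

·-⋆ : (f : Fin n → ℚ) (K : Fin n → Fin n → ℚ) (g : Fin n → ℚ) →
      f · (K ⋆ g) ≡ sum (λ v → sum (λ u → f u * K u v) * g v)
·-⋆ {n} f K g = begin
  sum (λ u → f u * sum (λ v → K u v * g v))  ≡⟨ sum-cong-≗ {n} (λ u → *-distribˡ-sum (f u) (λ v → K u v * g v)) ⟩
  sum (λ u → sum (λ v → f u * (K u v * g v)))  ≡⟨ ∑-comm (λ u v → f u * (K u v * g v)) ⟩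
  sum (λ v → sum (λ u → f u * (K u v * g v)))  ≡⟨ sum-cong-≗ {n} (λ v → sum-cong-≗ {n} (λ u → ℚ.*-assoc (f u) (K u v) (g v))) ⟨
  sum (λ v → sum (λ u → f u * K u v * g v))  ≡⟨ sum-cong-≗ {n} (λ v → sum-*ʳ (g v) (λ u → f u * K u v)) ⟩
  sum (λ v → sum (λ u → f u * K u v) * g v)  ∎
  where open ≡-Reasoning

⋆-adjoint : {K : Fin n → Fin n → ℚ} → (∀ u v → K u v ≡ K v u) →
            (f g : Fin n → ℚ) → f · (K ⋆ g) ≡ (K ⋆ f) · g
⋆-adjoint {n} {K} K-sym f g = trans (·-⋆ f K g)
  (sum-cong-≗ {n} (λ v → cong (_* g v) (sum-cong-≗ {n} (λ u → trans (ℚ.*-comm (f u) (K u v)) (cong (_* f u) (K-sym u v))))))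

-- The Kronecker delta, by recursion on both indices, so that its lemmas need no decided equality.
pointMass : Fin n → Fin n → ℚ
pointMass zero    zero    = 1ℚ
pointMass zero    (suc _) = 0ℚ
pointMass (suc _) zero    = 0ℚ
pointMass (suc i) (suc j) = pointMass i j

pointMass-nonneg : ∀ (i j : Fin n) → 0ℚ ≤ pointMass i j
pointMass-nonneg zero    zero    = 0≤1
pointMass-nonneg zero    (suc _) = ℚ.≤-refl
pointMass-nonneg (suc _) zero    = ℚ.≤-refl
pointMass-nonneg (suc i) (suc j) = pointMass-nonneg i j

pointMass-· : ∀ (i : Fin n) f → pointMass i · f ≡ f i
pointMass-· {suc n} zero f = begin
  1ℚ * f zero + sum (λ j → 0ℚ * f (suc j))  ≡⟨ cong₂ _+_ (ℚ.*-identityˡ (f zero)) (sum-cong-≗ {n} (λ j → ℚ.*-zeroˡ (f (suc j)))) ⟩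
  f zero + sum {n} (λ _ → 0ℚ)  ≡⟨ cong (f zero +_) (sum-0 {n}) ⟩
  f zero + 0ℚ  ≡⟨ ℚ.+-identityʳ (f zero) ⟩
  f zero  ∎
  where open ≡-Reasoning
pointMass-· {suc n} (suc i) f = begin
  0ℚ * f zero + pointMass i · (f ∘ suc)  ≡⟨ cong₂ _+_ (ℚ.*-zeroˡ (f zero)) (pointMass-· i (f ∘ suc)) ⟩
  0ℚ + f (suc i)  ≡⟨ ℚ.+-identityˡ (f (suc i)) ⟩
  f (suc i)  ∎
  where open ≡-Reasoning

pointMass-refl : ∀ (i : Fin n) → pointMass i i ≡ 1ℚ
pointMass-refl zero    = refl
pointMass-refl (suc i) = pointMass-refl i

-- Off the diagonal both sides vanish. This makes the holding part of the walk symmetric and keeps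
-- the mass of a start in H inside H.
pointMass-* : ∀ (i j : Fin n) (f : Fin n → ℚ) → f i * pointMass i j ≡ f j * pointMass i j
pointMass-* zero    zero    f = refl
pointMass-* zero    (suc j) f = trans (ℚ.*-zeroʳ (f zero)) (sym (ℚ.*-zeroʳ (f (suc j))))
pointMass-* (suc i) zero    f = trans (ℚ.*-zeroʳ (f (suc i))) (sym (ℚ.*-zeroʳ (f zero)))
pointMass-* (suc i) (suc j) f = pointMass-* i j (f ∘ suc)


-- Chains watched on a set of states

iterate : (Fin n → Fin n → ℚ) → ℕ → (Fin n → ℚ) → Fin n → ℚ
iterate K zero    f = f
iterate K (suc t) f = K ⋆ iterate K t f

-- Matrix associativity with `o` as a diagonal matrix; it regroups a first step followed by a path.
·-⋆-assoc : (f o : Fin n → ℚ) (K : Fin n → Fin n → ℚ) (g : Fin n → ℚ) →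
            f · (λ w → o w * (K ⋆ g) w) ≡ (λ x → f · (λ w → o w * K w x)) · g
·-⋆-assoc {n} f o K g = begin
  f · (λ w → o w * (K ⋆ g) w)  ≡⟨ sum-cong-≗ {n} (λ w → ℚ.*-assoc (f w) (o w) ((K ⋆ g) w)) ⟨
  (λ w → f w * o w) · (K ⋆ g)  ≡⟨ ·-⋆ (λ w → f w * o w) K g ⟩
  (λ x → sum (λ w → f w * o w * K w x)) · g  ≡⟨ ·-congʳ g (λ x → sum-cong-≗ {n} (λ w → ℚ.*-assoc (f w) (o w) (K w x))) ⟩
  (λ x → f · (λ w → o w * K w x)) · g  ∎
  where open ≡-Reasoning

module WatchedChain {N : ℕ} (P : Fin N → Fin N → ℚ)
  (P-sym : ∀ u v → P u v ≡ P v u) (P-nonneg : ∀ u v → 0ℚ ≤ P u v)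
  (P-row : ∀ u → sum (P u) ≡ 1ℚ) (H : Fin N → Bool) where

  inside outside : Fin N → ℚ
  inside u  = 𝟙 (H u)
  outside u = 𝟙 (not (H u))

  inside-nonneg : ∀ u → 0ℚ ≤ inside u
  inside-nonneg u = 𝟙-nonneg (H u)

  outside-nonneg : ∀ u → 0ℚ ≤ outside u
  outside-nonneg u = 𝟙-nonneg (not (H u))

  split : ∀ u x → inside u * x + outside u * x ≡ x
  split u x = begin
    inside u * x + outside u * x  ≡⟨ ℚ.*-distribʳ-+ x (inside u) (outside u) ⟨
    (inside u + outside u) * x  ≡⟨ cong (_* x) (𝟙-not (H u)) ⟩
    1ℚ * x  ≡⟨ ℚ.*-identityˡ x ⟩
    x  ∎
    where open ≡-Reasoning

  -- paths with at most j intermediate states, all of them outside H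
  G : ℕ → Fin N → Fin N → ℚ
  G zero    u v = P u v
  G (suc j) u v = P u v + P u · (λ w → outside w * G j w v)

  -- `G` is built by its first step. Symmetry also needs the last step split off, since reversing a
  -- path exchanges the two.
  G-unfoldʳ : ∀ j u v → P u · (λ w → outside w * G j w v) ≡ G j u · (λ w → outside w * P w v)
  G-unfoldʳ zero    u v = refl
  G-unfoldʳ (suc j) u v = begin
    P u · (λ w → outside w * (P w v + P w · (λ x → outside x * G j x v)))
      ≡⟨ ·-congˡ (P u) (λ w → trans (cong (λ z → outside w * (P w v + z)) (G-unfoldʳ j w v)) (ℚ.*-distribˡ-+ (outside w) (P w v) (G j w · g))) ⟩
    P u · (λ w → outside w * P w v + outside w * (G j ⋆ g) w)
      ≡⟨ ·-+ʳ (P u) g (λ w → outside w * (G j ⋆ g) w) ⟩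
    P u · g + P u · (λ w → outside w * (G j ⋆ g) w)
      ≡⟨ cong (P u · g +_) (·-⋆-assoc (P u) outside (G j) g) ⟩
    P u · g + (λ x → P u · (λ w → outside w * G j w x)) · g
      ≡⟨ ·-+ˡ (P u) (λ x → P u · (λ w → outside w * G j w x)) g ⟨
    G (suc j) u · g
      ∎
    where
    open ≡-Reasoning
    g : Fin N → ℚ
    g x = outside x * P x v

  -- Reversing a path keeps its probability, as `P` is symmetric, and its set of intermediate
  -- states.
  G-sym : ∀ j u v → G j u v ≡ G j v u
  G-sym zero    u v = P-sym u v
  G-sym (suc j) u v = cong₂ _+_ (P-sym u v) (begin
    P u · (λ w → outside w * G j w v)
      ≡⟨ sum-cong-≗ {N} (λ w → trans (cong₂ (λ x y → x * (outside w * y)) (P-sym u w) (G-sym j w v)) (solve 3 (λ x y z → x :* (y :* z) := z :* (y :* x)) refl (P w u) (outside w) (G j v w))) ⟩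
    G j v · (λ w → outside w * P w u)
      ≡⟨ G-unfoldʳ j v u ⟨
    P v · (λ w → outside w * G j w u)
      ∎)
    where open ≡-Reasoning

  G-nonneg : ∀ j u v → 0ℚ ≤ G j u v
  G-nonneg zero    u v = P-nonneg u v
  G-nonneg (suc j) u v = +-nonneg (P-nonneg u v) (·-nonneg (P-nonneg u) (λ w → *-nonneg (outside-nonneg w) (G-nonneg j w v)))

  P≤G : ∀ j u v → P u v ≤ G j u v
  P≤G zero    u v = ℚ.≤-refl
  P≤G (suc j) u v = ≤-by _ (·-nonneg (P-nonneg u) (λ w → *-nonneg (outside-nonneg w) (G-nonneg j w v))) refl

  -- the probability of avoiding H in steps 1, …, j
  avoid : ℕ → Fin N → ℚ
  avoid zero    u = 1ℚ
  avoid (suc j) u = P u · (λ w → outside w * avoid j w)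

  avoid-nonneg : ∀ j u → 0ℚ ≤ avoid j u
  avoid-nonneg zero    u = 0≤1
  avoid-nonneg (suc j) u = ·-nonneg (P-nonneg u) (λ w → *-nonneg (outside-nonneg w) (avoid-nonneg j w))

  avoid-antitone : ∀ j u → avoid (suc j) u ≤ avoid j u
  avoid-antitone zero u = begin
    P u · (λ w → outside w * 1ℚ)  ≤⟨ ·-monoʳ (P-nonneg u) (λ w → subst (_≤ 1ℚ) (sym (ℚ.*-identityʳ (outside w))) (𝟙≤1 (not (H w)))) ⟩
    P u · (λ _ → 1ℚ)  ≡⟨ sum-cong-≗ {N} (λ w → ℚ.*-identityʳ (P u w)) ⟩
    sum (P u)  ≡⟨ P-row u ⟩
    1ℚ  ∎
    where open ℚ.≤-Reasoning
  avoid-antitone (suc j) u = ·-monoʳ (P-nonneg u) (λ w → *-monoˡ-≤ (outside-nonneg w) (avoid-antitone j w))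

  P-row-· : ∀ u → P u · (λ _ → 1ℚ) ≡ 1ℚ
  P-row-· u = trans (sum-cong-≗ {N} (λ w → ℚ.*-identityʳ (P u w))) (P-row u)

  -- Total probability over the first entrance into H: it comes within `suc j` steps or later.
  G-row : ∀ j u → G j u · inside + avoid (suc j) u ≡ 1ℚ
  G-row zero u = begin
    P u · inside + P u · (λ w → outside w * 1ℚ)  ≡⟨ ·-+ʳ (P u) inside (λ w → outside w * 1ℚ) ⟨
    P u · (λ w → inside w + outside w * 1ℚ)  ≡⟨ ·-congˡ (P u) (λ w → trans (cong (inside w +_) (ℚ.*-identityʳ (outside w))) (𝟙-not (H w))) ⟩
    P u · (λ _ → 1ℚ)  ≡⟨ P-row-· u ⟩
    1ℚ  ∎
    where open ≡-Reasoning
  G-row (suc j) u = begin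
    G (suc j) u · inside + P u · (λ w → outside w * a w)
      ≡⟨ cong (_+ P u · (λ w → outside w * a w)) (·-+ˡ (P u) (λ x → P u · (λ w → outside w * G j w x)) inside) ⟩
    P u · inside + (λ x → P u · (λ w → outside w * G j w x)) · inside + P u · (λ w → outside w * a w)
      ≡⟨ cong (λ z → P u · inside + z + P u · (λ w → outside w * a w)) (·-⋆-assoc (P u) outside (G j) inside) ⟨
    P u · inside + P u · (λ w → outside w * (G j ⋆ inside) w) + P u · (λ w → outside w * a w)
      ≡⟨ ℚ.+-assoc (P u · inside) _ _ ⟩
    P u · inside + (P u · (λ w → outside w * (G j ⋆ inside) w) + P u · (λ w → outside w * a w))
      ≡⟨ cong (P u · inside +_) (·-+ʳ (P u) (λ w → outside w * (G j ⋆ inside) w) (λ w → outside w * a w)) ⟨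
    P u · inside + P u · (λ w → outside w * (G j ⋆ inside) w + outside w * a w)
      ≡⟨ ·-+ʳ (P u) inside (λ w → outside w * (G j ⋆ inside) w + outside w * a w) ⟨
    P u · (λ w → inside w + (outside w * (G j ⋆ inside) w + outside w * a w))
      ≡⟨ ·-congˡ (P u) (λ w → trans (cong (inside w +_) (trans (sym (ℚ.*-distribˡ-+ (outside w) ((G j ⋆ inside) w) (a w))) (trans (cong (outside w *_) (G-row j w)) (ℚ.*-identityʳ (outside w))))) (𝟙-not (H w))) ⟩
    P u · (λ _ → 1ℚ)
      ≡⟨ P-row-· u ⟩
    1ℚ
      ∎
    where
    open ≡-Reasoning
    a : Fin N → ℚ
    a = avoid (suc j)

  -- The columns of `P` sum to 1, so the uniform distribution is stationary: after one step from a
  -- uniform start the node is again uniform, and it must lie outside H.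
  outside-avoid : ∀ j → outside · avoid j ≡ sum (avoid (suc j))
  outside-avoid j = begin
    outside · avoid j  ≡⟨ sum-cong-≗ {N} (λ w → trans (cong (_* (outside w * avoid j w)) (trans (sum-cong-≗ {N} (λ u → P-sym u w)) (P-row w))) (ℚ.*-identityˡ (outside w * avoid j w))) ⟨
    sum (λ w → sum (λ u → P u w) * (outside w * avoid j w))  ≡⟨ sum-cong-≗ {N} (λ w → sum-*ʳ (outside w * avoid j w) (λ u → P u w)) ⟨
    sum (λ w → sum (λ u → P u w * (outside w * avoid j w)))  ≡⟨ ∑-comm (λ w u → P u w * (outside w * avoid j w)) ⟩
    sum (avoid (suc j))  ∎
    where open ≡-Reasoning

  -- A uniform start lies in H or outside it, and the latter part amounts to a longer avoidance.
  -- These are the increments that telescope.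
  inside-avoid : ∀ j → inside · avoid j + sum (avoid (suc j)) ≡ sum (avoid j)
  inside-avoid j = begin
    inside · avoid j + sum (avoid (suc j))  ≡⟨ cong (inside · avoid j +_) (outside-avoid j) ⟨
    inside · avoid j + outside · avoid j  ≡⟨ ∑-distrib-+ (λ u → inside u * avoid j u) (λ u → outside u * avoid j u) ⟨
    sum (λ u → inside u * avoid j u + outside u * avoid j u)  ≡⟨ sum-cong-≗ {N} (λ u → split u (avoid j u)) ⟩
    sum (avoid j)  ∎
    where open ≡-Reasoning

  -- Excursions from H of length more than j are disjoint in time, so in the
  -- stationary chain they start at a rate of at most 1/j: telescope Σ avoid.
  long-excursions : ∀ j → fromℕ (suc j) * (inside · avoid j) + sum (avoid (suc j)) ≤ fromℕ N
  long-excursions zero = ℚ.≤-reflexive (begin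
    1ℚ * (inside · avoid 0) + sum (avoid 1)  ≡⟨ cong (_+ sum (avoid 1)) (ℚ.*-identityˡ (inside · avoid 0)) ⟩
    inside · avoid 0 + sum (avoid 1)  ≡⟨ inside-avoid 0 ⟩
    sum (avoid 0)  ≡⟨ sum-const N 1ℚ ⟩
    fromℕ N * 1ℚ  ≡⟨ ℚ.*-identityʳ (fromℕ N) ⟩
    fromℕ N  ∎)
    where open ≡-Reasoning
  long-excursions (suc j) = begin
    fromℕ (suc (suc j)) * x + sum (avoid (suc (suc j)))  ≡⟨ cong (λ z → z * x + sum (avoid (suc (suc j)))) (fromℕ-suc (suc j)) ⟩
    (1ℚ + fromℕ (suc j)) * x + sum (avoid (suc (suc j)))  ≡⟨ solve 3 (λ m x y → (:1 :+ m) :* x :+ y := m :* x :+ (x :+ y)) refl (fromℕ (suc j)) x (sum (avoid (suc (suc j)))) ⟩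
    fromℕ (suc j) * x + (x + sum (avoid (suc (suc j))))  ≡⟨ cong (fromℕ (suc j) * x +_) (inside-avoid (suc j)) ⟩
    fromℕ (suc j) * x + sum (avoid (suc j))  ≤⟨ ℚ.+-monoˡ-≤ (sum (avoid (suc j))) (*-monoˡ-≤ (fromℕ-nonneg (suc j)) (·-monoʳ inside-nonneg (avoid-antitone j))) ⟩
    fromℕ (suc j) * (inside · avoid j) + sum (avoid (suc j))  ≤⟨ long-excursions j ⟩
    fromℕ N  ∎
    where
    open ℚ.≤-Reasoning
    x : ℚ
    x = inside · avoid (suc j)

  -- first j F v is the expectation of F at the first visit to H (at time 0
  -- included) of the chain started at v, within j steps.
  first : ℕ → (Fin N → ℚ) → Fin N → ℚ
  first zero    F v = inside v * F v
  first (suc j) F v = inside v * F v + outside v * (P ⋆ first j F) v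

  first-inside : ∀ j F v → H v ≡ true → first j F v ≡ F v
  first-inside zero    F v v∈H rewrite v∈H = ℚ.*-identityˡ (F v)
  first-inside (suc j) F v v∈H rewrite v∈H = solve 2 (λ x y → :1 :* x :+ :0 :* y := x) refl (F v) ((P ⋆ first j F) v)

  -- `first` follows the walk one step at a time, while `G` collects whole paths up to the entrance
  -- into H. This carries expectations over real walks to the kernel `Q`.
  ⋆-first : ∀ j F u → (P ⋆ first j F) u ≡ G j u · (λ w → inside w * F w)
  ⋆-first zero    F u = refl
  ⋆-first (suc j) F u = begin
    P u · first (suc j) F  ≡⟨ ·-+ʳ (P u) g (λ w → outside w * (P ⋆ first j F) w) ⟩
    P u · g + P u · (λ w → outside w * (P ⋆ first j F) w)  ≡⟨ cong (P u · g +_) (·-congˡ (P u) (λ w → cong (outside w *_) (⋆-first j F w))) ⟩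
    P u · g + P u · (λ w → outside w * (G j ⋆ g) w)  ≡⟨ cong (P u · g +_) (·-⋆-assoc (P u) outside (G j) g) ⟩
    P u · g + (λ x → P u · (λ w → outside w * G j w x)) · g  ≡⟨ ·-+ˡ (P u) (λ x → P u · (λ w → outside w * G j w x)) g ⟨
    G (suc j) u · g  ∎
    where
    open ≡-Reasoning
    g : Fin N → ℚ
    g w = inside w * F w

  module _ (ℓ : ℕ) where

    Q : Fin N → Fin N → ℚ
    Q u v = inside u * (G ℓ u v * inside v)

    Q-sym : ∀ u v → Q u v ≡ Q v u
    Q-sym u v = trans (cong (λ z → inside u * (z * inside v)) (G-sym ℓ u v))
      (solve 3 (λ x y z → x :* (y :* z) := z :* (y :* x)) refl (inside u) (G ℓ v u) (inside v))

    Q-nonneg : ∀ u v → 0ℚ ≤ Q u v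
    Q-nonneg u v = *-nonneg (inside-nonneg u) (*-nonneg (G-nonneg ℓ u v) (inside-nonneg v))

    P≤Q : ∀ u v → inside u * (P u v * inside v) ≤ Q u v
    P≤Q u v = *-monoˡ-≤ (inside-nonneg u) (*-monoʳ-≤ (inside-nonneg v) (P≤G ℓ u v))

    Q-⋆ : ∀ f u → (Q ⋆ f) u ≡ inside u * (G ℓ u · (λ w → inside w * f w))
    Q-⋆ f u = trans (sum-cong-≗ {N} (λ w → solve 4 (λ x y z f → x :* (y :* z) :* f := x :* (y :* (z :* f))) refl (inside u) (G ℓ u w) (inside w) (f w)))
      (sum-*ˡ (inside u) (λ w → G ℓ u w * (inside w * f w)))

    -- The defect of the row sum of `Q`: the chance that an excursion is cut off.
    escape : Fin N → ℚ
    escape u = inside u * avoid (suc ℓ) u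

    Q-inside : ∀ u → (Q ⋆ inside) u + escape u ≡ inside u
    Q-inside u = begin
      (Q ⋆ inside) u + escape u  ≡⟨ cong (_+ escape u) (Q-⋆ inside u) ⟩
      inside u * (G ℓ u · (λ w → inside w * inside w)) + inside u * avoid (suc ℓ) u  ≡⟨ cong (λ z → inside u * z + escape u) (·-congˡ (G ℓ u) (λ w → 𝟙-idem (H w))) ⟩
      inside u * (G ℓ u · inside) + inside u * avoid (suc ℓ) u  ≡⟨ ℚ.*-distribˡ-+ (inside u) (G ℓ u · inside) (avoid (suc ℓ) u) ⟨
      inside u * (G ℓ u · inside + avoid (suc ℓ) u)  ≡⟨ cong (inside u *_) (G-row ℓ u) ⟩
      inside u * 1ℚ  ≡⟨ ℚ.*-identityʳ (inside u) ⟩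
      inside u  ∎
      where open ≡-Reasoning

    Q-inside-≤ : ∀ u → (Q ⋆ inside) u ≤ inside u
    Q-inside-≤ u = ≤-by (escape u) (*-nonneg (inside-nonneg u) (avoid-nonneg (suc ℓ) u)) (sym (Q-inside u))

    Q-row-inside : ∀ u → sum (Q u) ≡ (Q ⋆ inside) u
    Q-row-inside u = sum-cong-≗ {N} (λ v → trans (cong (λ z → inside u * (G ℓ u v * z)) (sym (𝟙-idem (H v))))
      (solve 3 (λ x y z → x :* (y :* (z :* z)) := x :* (y :* z) :* z) refl (inside u) (G ℓ u v) (inside v)))

    Q-row : ∀ u → sum (Q u) ≤ 1ℚ
    Q-row u = subst (_≤ 1ℚ) (sym (Q-row-inside u)) (ℚ.≤-trans (Q-inside-≤ u) (𝟙≤1 (H u)))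

    sum-escape : fromℕ ℓ * sum escape ≤ fromℕ N
    sum-escape = begin
      fromℕ ℓ * sum escape  ≤⟨ *-monoʳ-≤ (sum-nonneg escape-nonneg) (fromℕ-mono-≤ {ℓ} {suc (suc ℓ)} (ℕ.m≤n+m ℓ 2)) ⟩
      -- `sum escape` is `inside · avoid (suc ℓ)` by definition; only a nonnegative tail is added.
      fromℕ (suc (suc ℓ)) * sum escape  ≤⟨ ≤-by (sum (avoid (suc (suc ℓ)))) (sum-nonneg (avoid-nonneg (suc (suc ℓ)))) refl ⟩
      fromℕ (suc (suc ℓ)) * (inside · avoid (suc ℓ)) + sum (avoid (suc (suc ℓ)))  ≤⟨ long-excursions (suc ℓ) ⟩
      fromℕ N  ∎
      where
      open ℚ.≤-Reasoning
      escape-nonneg : ∀ u → 0ℚ ≤ escape u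
      escape-nonneg u = *-nonneg (inside-nonneg u) (avoid-nonneg (suc ℓ) u)

    -- returns t f v: the expectation of f at the visit number t to H after the
    -- first one, if no excursion takes more than ℓ steps outside H
    returns : ℕ → (Fin N → ℚ) → Fin N → ℚ
    returns zero    f = f
    returns (suc t) f = P ⋆ first ℓ (returns t f)

    -- `returns` is meaningful at every node, whereas powers of `Q` vanish outside H; hence the
    -- comparison only where `inside` is 1.
    returns≡iterate : ∀ t f v → inside v * returns t f v ≡ inside v * iterate Q t f v
    returns≡iterate zero    f v = refl
    returns≡iterate (suc t) f v = begin
      inside v * (P ⋆ first ℓ (returns t f)) v  ≡⟨ cong (inside v *_) (⋆-first ℓ (returns t f) v) ⟩
      inside v * (G ℓ v · (λ w → inside w * returns t f w))  ≡⟨ cong (inside v *_) (·-congˡ (G ℓ v) (returns≡iterate t f)) ⟩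
      inside v * (G ℓ v · (λ w → inside w * iterate Q t f w))  ≡⟨ cong (_* (G ℓ v · (λ w → inside w * iterate Q t f w))) (𝟙-idem (H v)) ⟨
      inside v * inside v * (G ℓ v · (λ w → inside w * iterate Q t f w))  ≡⟨ ℚ.*-assoc (inside v) (inside v) _ ⟩
      inside v * (inside v * (G ℓ v · (λ w → inside w * iterate Q t f w)))  ≡⟨ cong (inside v *_) (Q-⋆ (iterate Q t f) v) ⟨
      inside v * (Q ⋆ iterate Q t f) v  ∎
      where open ≡-Reasoning

    first-returns : ∀ t f v → H v ≡ true → first ℓ (returns t f) v ≡ iterate Q t f v
    first-returns t f v v∈H = begin
      first ℓ (returns t f) v  ≡⟨ first-inside ℓ (returns t f) v v∈H ⟩
      returns t f v  ≡⟨ ℚ.*-identityˡ (returns t f v) ⟨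
      1ℚ * returns t f v  ≡⟨ subst (λ b → 𝟙 b * returns t f v ≡ 𝟙 b * iterate Q t f v) v∈H (returns≡iterate t f v) ⟩
      1ℚ * iterate Q t f v  ≡⟨ ℚ.*-identityˡ (iterate Q t f v) ⟩
      iterate Q t f v  ∎
      where open ≡-Reasoning

    -- By symmetry one application of `Q` moves to the left factor, where it falls short of `inside`
    -- by `escape`. The right factor is at most 1, so each step loses at most `sum escape`.
    survival : ∀ t → inside · inside ≤ inside · iterate Q t inside + fromℕ t * sum escape
    survival zero = ≤-by 0ℚ ℚ.≤-refl (solve 2 (λ x y → x :+ :0 :* y := x :+ :0) refl (inside · inside) (sum escape))
    survival (suc t) = begin
      inside · inside  ≤⟨ survival t ⟩
      inside · p + fromℕ t * sum escape  ≡⟨ cong (_+ fromℕ t * sum escape) (·-congʳ p Q-inside) ⟨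
      (λ u → (Q ⋆ inside) u + escape u) · p + fromℕ t * sum escape  ≡⟨ cong (_+ fromℕ t * sum escape) (·-+ˡ (Q ⋆ inside) escape p) ⟩
      (Q ⋆ inside) · p + escape · p + fromℕ t * sum escape  ≡⟨ cong (λ z → z + escape · p + fromℕ t * sum escape) (⋆-adjoint Q-sym inside p) ⟨
      inside · (Q ⋆ p) + escape · p + fromℕ t * sum escape  ≤⟨ ℚ.+-monoˡ-≤ (fromℕ t * sum escape) (ℚ.+-monoʳ-≤ (inside · (Q ⋆ p)) escape·p≤) ⟩
      inside · (Q ⋆ p) + sum escape + fromℕ t * sum escape  ≡⟨ solve 3 (λ x y z → x :+ y :+ z :* y := x :+ (:1 :+ z) :* y) refl (inside · (Q ⋆ p)) (sum escape) (fromℕ t) ⟩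
      inside · (Q ⋆ p) + (1ℚ + fromℕ t) * sum escape  ≡⟨ cong (λ z → inside · (Q ⋆ p) + z * sum escape) (fromℕ-suc t) ⟨
      inside · (Q ⋆ p) + fromℕ (suc t) * sum escape  ∎
      where
      open ℚ.≤-Reasoning
      p : Fin N → ℚ
      p = iterate Q t inside
      iterate≤1 : ∀ t u → iterate Q t inside u ≤ 1ℚ
      iterate≤1 zero    u = 𝟙≤1 (H u)
      iterate≤1 (suc t) u = begin
        Q u · iterate Q t inside  ≤⟨ ·-monoʳ (Q-nonneg u) (iterate≤1 t) ⟩
        Q u · (λ _ → 1ℚ)  ≡⟨ sum-cong-≗ {N} (λ w → ℚ.*-identityʳ (Q u w)) ⟩
        sum (Q u)  ≤⟨ Q-row u ⟩
        1ℚ  ∎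
      escape·p≤ : escape · p ≤ sum escape
      escape·p≤ = begin
        escape · p  ≤⟨ ·-monoʳ (λ u → *-nonneg (inside-nonneg u) (avoid-nonneg (suc ℓ) u)) (iterate≤1 t) ⟩
        escape · (λ _ → 1ℚ)  ≡⟨ sum-cong-≗ {N} (λ w → ℚ.*-identityʳ (escape w)) ⟩
        sum escape  ∎

    iterate-inside-antitone : ∀ t u → iterate Q (suc t) inside u ≤ iterate Q t inside u
    iterate-inside-antitone zero    u = Q-inside-≤ u
    iterate-inside-antitone (suc t) u = ·-monoʳ (Q-nonneg u) (iterate-inside-antitone t)


-- Slow decay and the discrete Cheeger inequality

module SlowDecay (y : ℕ → ℚ) (0≤y : ∀ t → 0ℚ ≤ y t) (k : ℕ) .{{k≢0 : NonZero k}} where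

  κ : ℚ
  κ = fromℕ k

  Slow : ℕ → Set
  Slow t = κ * (y t - y (suc t)) ≤ y t

  module _ (T : ℕ) (fast : ∀ t → t ℕ.< T → ¬ Slow t) where

    -- Without slow times each step multiplies `y` by at most 1 - 1/κ, hence by at most (κ + j)/(κ +
    -- j + 1). The product of these telescopes, which avoids powers, and reaches 1/2 at j = k.
    decay : ∀ j t → j ℕ.+ t ℕ.≤ T → y (j ℕ.+ t) * (κ + fromℕ j) ≤ κ * y t
    decay zero    t _ = ℚ.≤-reflexive (solve 2 (λ x y → y :* (x :+ :0) := x :* y) refl κ (y t))
    decay (suc j) t j+t<T = *-cancelˡ-≤ κ (fromℕ-pos k) (begin
      κ * (y″ * (κ + fromℕ (suc j)))  ≡⟨ cong (λ z → κ * (y″ * (κ + z))) (fromℕ-suc j) ⟩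
      κ * (y″ * (κ + (1ℚ + J)))  ≡⟨ solve 3 (λ κ j y → κ :* (y :* (κ :+ (:1 :+ j))) := (κ :* y) :* (κ :+ (:1 :+ j))) refl κ J y″ ⟩
      κ * y″ * (κ + (1ℚ + J))  ≤⟨ *-monoʳ-≤ (+-nonneg 0≤κ (+-nonneg 0≤1 0≤J)) κy″≤ ⟩
      (κ * y′ - y′) * (κ + (1ℚ + J))  ≤⟨ ≤-by (y′ * (1ℚ + J)) (*-nonneg (0≤y (j ℕ.+ t)) (+-nonneg 0≤1 0≤J)) (solve 3 (λ κ j y → κ :* (y :* (κ :+ j)) := (κ :* y :- y) :* (κ :+ (:1 :+ j)) :+ y :* (:1 :+ j)) refl κ J y′) ⟩
      κ * (y′ * (κ + J))  ≤⟨ *-monoˡ-≤ 0≤κ (decay j t (ℕ.<⇒≤ j+t<T)) ⟩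
      κ * (κ * y t)  ∎)
      where
      open ℚ.≤-Reasoning
      J y′ y″ : ℚ
      J  = fromℕ j
      y′ = y (j ℕ.+ t)
      y″ = y (suc (j ℕ.+ t))
      0≤κ : 0ℚ ≤ κ
      0≤κ = fromℕ-nonneg k
      0≤J : 0ℚ ≤ J
      0≤J = fromℕ-nonneg j
      κy″≤ : κ * y″ ≤ κ * y′ - y′
      κy″≤ = ≤-by (κ * (y′ - y″) - y′) (p≤q⇒0≤q-p (ℚ.<⇒≤ (ℚ.≰⇒> (fast (j ℕ.+ t) j+t<T))))
        (solve 3 (λ κ x z → κ :* x :- x := κ :* z :+ (κ :* (x :- z) :- x)) refl κ y′ y″)

    halving : ∀ t → k ℕ.+ t ℕ.≤ T → y (k ℕ.+ t) * 2ℚ ≤ y t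
    halving t k+t≤T = *-cancelˡ-≤ κ (fromℕ-pos k) (ℚ.≤-trans (ℚ.≤-reflexive
      (solve 2 (λ κ y → κ :* (y :* :2) := y :* (κ :+ κ)) refl κ (y (k ℕ.+ t)))) (decay k t k+t≤T))

    exponential : ∀ i → i ℕ.* k ℕ.≤ T → y (i ℕ.* k) * fromℕ (2 ℕ.^ i) ≤ y 0
    exponential zero    _ = ℚ.≤-reflexive (ℚ.*-identityʳ (y 0))
    exponential (suc i) h = begin
      y (k ℕ.+ i ℕ.* k) * fromℕ (2 ℕ.* 2 ℕ.^ i)  ≡⟨ cong (y (k ℕ.+ i ℕ.* k) *_) (fromℕ-* 2 (2 ℕ.^ i)) ⟩
      y (k ℕ.+ i ℕ.* k) * (2ℚ * fromℕ (2 ℕ.^ i))  ≡⟨ ℚ.*-assoc (y (k ℕ.+ i ℕ.* k)) 2ℚ (fromℕ (2 ℕ.^ i)) ⟨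
      y (k ℕ.+ i ℕ.* k) * 2ℚ * fromℕ (2 ℕ.^ i)  ≤⟨ *-monoʳ-≤ (fromℕ-nonneg (2 ℕ.^ i)) (halving (i ℕ.* k) h) ⟩
      y (i ℕ.* k) * fromℕ (2 ℕ.^ i)  ≤⟨ exponential i (ℕ.≤-trans (ℕ.m≤n+m (i ℕ.* k) k) h) ⟩
      y 0  ∎
      where open ℚ.≤-Reasoning

  -- Otherwise each block of `k` steps would halve `y`, and `i` blocks would contradict the
  -- hypothesis.
  slow-time : ∀ i → y 0 < y (i ℕ.* k) * fromℕ (2 ℕ.^ i) → ∃[ t ] t ℕ.< i ℕ.* k × Slow t
  slow-time i large with ℕ.anyUpTo? (λ t → κ * (y t - y (suc t)) ℚ.≤? y t) (i ℕ.* k)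
  ... | yes slow = slow
  ... | no ∄slow = contradiction large
    (λ h → ℚ.<-irrefl refl (ℚ.<-≤-trans h (exponential (i ℕ.* k) (λ t t<T s → ∄slow (t , t<T , s)) i ℕ.≤-refl)))

-- On an indicator it marks the ordered pairs that leave the set, so that its weighted sum is a
-- directed cut.
posDiff : ℚ → ℚ → ℚ
posDiff x y = 0ℚ ⊔ (x - y)

module SymmetricKernel {N : ℕ} (Q : Fin N → Fin N → ℚ)
  (Q-sym : ∀ u v → Q u v ≡ Q v u) (Q-nonneg : ∀ u v → 0ℚ ≤ Q u v)
  (Q-row : ∀ u → sum (Q u) ≤ 1ℚ) where

  ⋆-nonneg : ∀ {f} → (∀ u → 0ℚ ≤ f u) → ∀ u → 0ℚ ≤ (Q ⋆ f) u
  ⋆-nonneg 0≤f u = ·-nonneg (Q-nonneg u) 0≤f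

  iterate-nonneg : ∀ t {f} → (∀ u → 0ℚ ≤ f u) → ∀ u → 0ℚ ≤ iterate Q t f u
  iterate-nonneg zero    0≤f = 0≤f
  iterate-nonneg (suc t) 0≤f = ⋆-nonneg (iterate-nonneg t 0≤f)

  iterate-shift : ∀ t f u → iterate Q (suc t) f u ≡ iterate Q t (Q ⋆ f) u
  iterate-shift zero    f u = refl
  iterate-shift (suc t) f u = ·-congˡ (Q u) (iterate-shift t f)

  iterate-adjoint : ∀ t f g → f · iterate Q t g ≡ iterate Q t f · g
  iterate-adjoint zero    f g = refl
  iterate-adjoint (suc t) f g = begin
    f · (Q ⋆ iterate Q t g)  ≡⟨ ⋆-adjoint Q-sym f (iterate Q t g) ⟩
    (Q ⋆ f) · iterate Q t g  ≡⟨ iterate-adjoint t (Q ⋆ f) g ⟩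
    iterate Q t (Q ⋆ f) · g  ≡⟨ ·-congʳ g (iterate-shift t f) ⟨
    iterate Q (suc t) f · g  ∎
    where open ≡-Reasoning

  -- Expanding the square leaves row sums of `Q`, which are at most 1. The sign `s` treats I - Q and
  -- I + Q at once: the former is the Dirichlet form, and both turn out positive semidefinite.
  energy : ∀ s f → s * s ≡ 1ℚ →
    sum₂ (λ u v → Q u v * ((f u + s * f v) * (f u + s * f v))) ≤ 2ℚ * (f · f + s * (f · (Q ⋆ f)))
  energy s f ss≡1 = begin
    sum₂ (λ u v → Q u v * ((f u + s * f v) * (f u + s * f v)))
      ≡⟨ sum-cong-≗ {N} inner ⟩
    sum (λ u → (r u * f² u + s2 * (f u * (Q ⋆ f) u)) + (Q ⋆ f²) u)
      ≡⟨ trans (∑-distrib-+ (λ u → r u * f² u + s2 * (f u * (Q ⋆ f) u)) (Q ⋆ f²)) (cong (_+ sum (Q ⋆ f²)) (trans (∑-distrib-+ (λ u → r u * f² u) (λ u → s2 * (f u * (Q ⋆ f) u))) (cong (r · f² +_) (sum-*ˡ s2 (λ u → f u * (Q ⋆ f) u))))) ⟩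
    (r · f² + s2 * (f · (Q ⋆ f))) + sum (Q ⋆ f²)
      ≡⟨ cong (r · f² + s2 * (f · (Q ⋆ f)) +_) outer ⟩
    (r · f² + s2 * (f · (Q ⋆ f))) + r · f²
      ≤⟨ ℚ.+-mono-≤ (ℚ.+-monoˡ-≤ (s2 * (f · (Q ⋆ f))) rf²≤) rf²≤ ⟩
    (f · f + s2 * (f · (Q ⋆ f))) + f · f
      ≡⟨ solve 3 (λ s x y → (x :+ s :* :2 :* y) :+ x := :2 :* (x :+ s :* y)) refl s (f · f) (f · (Q ⋆ f)) ⟩
    2ℚ * (f · f + s * (f · (Q ⋆ f)))
      ∎
    where
    open ℚ.≤-Reasoning
    f² r : Fin N → ℚ
    f² u = f u * f u
    r u = sum (Q u)
    s2 : ℚ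
    s2 = s * 2ℚ
    inner : ∀ u → sum (λ v → Q u v * ((f u + s * f v) * (f u + s * f v))) ≡ (r u * f² u + s2 * (f u * (Q ⋆ f) u)) + (Q ⋆ f²) u
    inner u = begin-equality
      sum (λ v → Q u v * ((f u + s * f v) * (f u + s * f v)))
        ≡⟨ sum-cong-≗ {N} (λ v → trans
             (solve 4 (λ q a s b → q :* ((a :+ s :* b) :* (a :+ s :* b)) := (q :* (a :* a) :+ s :* :2 :* a :* (q :* b)) :+ (s :* s) :* (q :* (b :* b))) refl (Q u v) (f u) s (f v))
             (cong (λ z → (Q u v * f² u + s2 * f u * (Q u v * f v)) + z) (trans (cong (_* (Q u v * f² v)) ss≡1) (ℚ.*-identityˡ (Q u v * f² v))))) ⟩
      sum (λ v → (Q u v * f² u + s2 * f u * (Q u v * f v)) + Q u v * f² v)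
        ≡⟨ trans (∑-distrib-+ (λ v → Q u v * f² u + s2 * f u * (Q u v * f v)) (λ v → Q u v * f² v)) (cong (_+ (Q ⋆ f²) u) (∑-distrib-+ (λ v → Q u v * f² u) (λ v → s2 * f u * (Q u v * f v)))) ⟩
      (sum (λ v → Q u v * f² u) + sum (λ v → s2 * f u * (Q u v * f v))) + (Q ⋆ f²) u
        ≡⟨ cong (_+ (Q ⋆ f²) u) (cong₂ _+_ (sum-*ʳ (f² u) (Q u)) (trans (sum-*ˡ (s2 * f u) (λ v → Q u v * f v)) (ℚ.*-assoc s2 (f u) ((Q ⋆ f) u)))) ⟩
      (r u * f² u + s2 * (f u * (Q ⋆ f) u)) + (Q ⋆ f²) u
        ∎
    outer : sum (Q ⋆ f²) ≡ r · f²
    outer = begin-equality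
      sum (Q ⋆ f²)  ≡⟨ sum-cong-≗ {N} (λ u → ℚ.*-identityˡ ((Q ⋆ f²) u)) ⟨
      (λ _ → 1ℚ) · (Q ⋆ f²)  ≡⟨ ⋆-adjoint Q-sym (λ _ → 1ℚ) f² ⟩
      (Q ⋆ (λ _ → 1ℚ)) · f²  ≡⟨ ·-congʳ f² (λ u → sum-cong-≗ {N} (λ v → ℚ.*-identityʳ (Q u v))) ⟩
      r · f²  ∎
    rf²≤ : r · f² ≤ f · f
    rf²≤ = sum-mono-≤ (λ u → subst (r u * f² u ≤_) (ℚ.*-identityˡ (f² u)) (*-monoʳ-≤ (square-nonneg (f u)) (Q-row u)))

  energy-nonneg : ∀ s f → s * s ≡ 1ℚ → 0ℚ ≤ f · f + s * (f · (Q ⋆ f))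
  energy-nonneg s f ss≡1 = *-cancelˡ-≤ 2ℚ 0<2
    (ℚ.≤-trans (ℚ.≤-reflexive (ℚ.*-zeroʳ 2ℚ))
      (ℚ.≤-trans (sum₂-nonneg (λ u v → *-nonneg (Q-nonneg u v) (square-nonneg (f u + s * f v)))) (energy s f ss≡1)))

  -- Since Q may have eigenvalues near −1, a slowly decaying a need not have
  -- small energy, but a + Q a does.
  smooth : (Fin N → ℚ) → Fin N → ℚ
  smooth a u = a u + (Q ⋆ a) u

  -- The identity 2(1 - x²) = (1 + x)²(1 - x) + (1 - x)²(1 + x), evaluated at `Q`. The last term is
  -- the form of I + Q at a - Q a, hence nonnegative.
  smooth-energy : ∀ a → let q = smooth a in
    q · q + - 1ℚ * (q · (Q ⋆ q)) ≤ 2ℚ * (a · a - (Q ⋆ a) · (Q ⋆ a))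
  smooth-energy a = ≤-by ((a-b · a-b) + 1ℚ * (a-b · (Q ⋆ a-b))) (energy-nonneg 1ℚ a-b refl) (begin
    2ℚ * (a · a - b · b)
      ≡⟨ solve 4 (λ aa ab bb bc → :2 :* (aa :- bb) := (((aa :+ ab) :+ (ab :+ bb)) :+ con (- 1ℚ) :* ((ab :+ bb) :+ (bb :+ bc))) :+ (((aa :- ab) :- (ab :- bb)) :+ :1 :* ((ab :- bb) :- (bb :- bc)))) refl (a · a) (a · b) (b · b) (b · c) ⟩
    (((a · a + a · b) + (a · b + b · b)) + - 1ℚ * ((a · b + b · b) + (b · b + b · c))) + (((a · a - a · b) - (a · b - b · b)) + 1ℚ * ((a · b - b · b) - (b · b - b · c)))
      ≡⟨ cong₂ _+_ (cong₂ (λ x y → x + - 1ℚ * y) qq qQq) (cong₂ (λ x y → x + 1ℚ * y) dd dQd) ⟨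
    (q · q + - 1ℚ * (q · (Q ⋆ q))) + ((a-b · a-b) + 1ℚ * (a-b · (Q ⋆ a-b)))
      ∎)
    where
    open ≡-Reasoning
    b c q a-b : Fin N → ℚ
    b = Q ⋆ a
    c = Q ⋆ b
    q = smooth a
    a-b u = a u - b u
    ac : a · c ≡ b · b
    ac = ⋆-adjoint Q-sym a b
    qq : q · q ≡ (a · a + a · b) + (a · b + b · b)
    qq = trans (·-+ˡ a b q) (cong₂ _+_ (·-+ʳ a a b) (trans (·-+ʳ b a b) (cong (_+ b · b) (·-comm b a))))
    qQq : q · (Q ⋆ q) ≡ (a · b + b · b) + (b · b + b · c)
    qQq = trans (·-congˡ q (λ u → ·-+ʳ (Q u) a b)) (trans (·-+ˡ a b (λ u → b u + c u))
      (cong₂ _+_ (trans (·-+ʳ a b c) (cong (a · b +_) ac)) (·-+ʳ b b c)))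
    dd : a-b · a-b ≡ (a · a - a · b) - (a · b - b · b)
    dd = trans (·--ˡ a b a-b) (cong₂ _-_ (·--ʳ a a b) (trans (·--ʳ b a b) (cong (_- b · b) (·-comm b a))))
    dQd : a-b · (Q ⋆ a-b) ≡ (a · b - b · b) - (b · b - b · c)
    dQd = trans (·-congˡ a-b (λ u → ·--ʳ (Q u) a b)) (trans (·--ˡ a b (λ u → b u - c u))
      (cong₂ _-_ (trans (·--ʳ a b c) (cong (λ z → a · b - z) ac)) (·--ʳ b b c)))

  smooth-norm : ∀ {a} → (∀ u → 0ℚ ≤ a u) → a · a ≤ smooth a · smooth a
  smooth-norm {a} 0≤a = sum-mono-≤ (λ u → *-mono-≤ (0≤a u) (+-nonneg (0≤a u) (⋆-nonneg 0≤a u)) (a≤ u) (a≤ u))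
    where
    a≤ : ∀ u → a u ≤ smooth a u
    a≤ u = ≤-by ((Q ⋆ a) u) (⋆-nonneg 0≤a u) refl

  -- Cheeger's proof applies Cauchy-Schwarz to (q u - q v)(q u + q v). AM-GM with weight `b` avoids
  -- the square root: it multiplies the small energy by b², and slowness at rate b² makes the result
  -- comparable to ‖q‖².
  cheeger : ∀ (b : ℚ) a → 0ℚ < b → (∀ u → 0ℚ ≤ a u) → b * b * (a · a - (Q ⋆ a) · (Q ⋆ a)) ≤ a · a → let q = smooth a in
    b * sum₂ (λ u v → Q u v * posDiff (q u * q u) (q v * q v)) ≤ 2ℚ * 2ℚ * (q · q)
  cheeger b a 0<b 0≤a slow = *-cancelˡ-≤ 2ℚ 0<2 (begin
    2ℚ * (b * sum₂ cut)
      ≡⟨ trans (sym (ℚ.*-assoc 2ℚ b (sum₂ cut))) (sym (sum₂-*ˡ (2ℚ * b) cut)) ⟩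
    sum₂ (λ u v → 2ℚ * b * cut u v)
      ≤⟨ sum₂-mono-≤ am-gm ⟩
    sum₂ (λ u v → b * b * diff u v + add u v)
      ≡⟨ trans (sum₂-+ (λ u v → b * b * diff u v) add) (cong (_+ sum₂ add) (sum₂-*ˡ (b * b) diff)) ⟩
    b * b * sum₂ diff + sum₂ add
      ≤⟨ ℚ.+-mono-≤ (*-monoˡ-≤ (square-nonneg b) (ℚ.≤-trans (energy (- 1ℚ) q refl) (*-monoˡ-≤ 0≤2 (smooth-energy a)))) (ℚ.≤-trans (energy 1ℚ q refl) (*-monoˡ-≤ 0≤2 q·q+1*≤)) ⟩
    b * b * (2ℚ * (2ℚ * decay)) + 2ℚ * (2ℚ * (q · q))
      ≡⟨ solve 3 (λ b x y → b :* b :* (:2 :* (:2 :* x)) :+ :2 :* (:2 :* y) := :2 :* (:2 :* (b :* b :* x :+ y))) refl b decay (q · q) ⟩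
    2ℚ * (2ℚ * (b * b * decay + q · q))
      ≤⟨ *-monoˡ-≤ 0≤2 (*-monoˡ-≤ 0≤2 (ℚ.+-monoˡ-≤ (q · q) (ℚ.≤-trans slow (smooth-norm 0≤a)))) ⟩
    2ℚ * (2ℚ * (q · q + q · q))
      ≡⟨ solve 1 (λ y → :2 :* (:2 :* (y :+ y)) := :2 :* (:2 :* :2 :* y)) refl (q · q) ⟩
    2ℚ * (2ℚ * 2ℚ * (q · q))
      ∎)
    where
    open ℚ.≤-Reasoning
    q : Fin N → ℚ
    q = smooth a
    decay : ℚ
    decay = a · a - (Q ⋆ a) · (Q ⋆ a)
    cut diff add : Fin N → Fin N → ℚ
    cut u v = Q u v * posDiff (q u * q u) (q v * q v)
    diff u v = Q u v * ((q u + - 1ℚ * q v) * (q u + - 1ℚ * q v))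
    add u v = Q u v * ((q u + 1ℚ * q v) * (q u + 1ℚ * q v))
    -- 2bxy ≤ b²x² + y² for x = q u - q v and y = q u + q v
    posDiff≤ : ∀ x y → 2ℚ * b * posDiff (x * x) (y * y) ≤ b * b * ((x + - 1ℚ * y) * (x + - 1ℚ * y)) + (x + 1ℚ * y) * (x + 1ℚ * y)
    posDiff≤ x y with ℚ.⊔-sel 0ℚ (x * x - y * y)
    ... | inj₁ eq rewrite eq = ℚ.≤-trans (ℚ.≤-reflexive (ℚ.*-zeroʳ (2ℚ * b)))
      (+-nonneg (*-nonneg (square-nonneg b) (square-nonneg (x + - 1ℚ * y))) (square-nonneg (x + 1ℚ * y)))
    ... | inj₂ eq rewrite eq = ≤-by ((b * (x - y) - (x + y)) * (b * (x - y) - (x + y))) (square-nonneg (b * (x - y) - (x + y)))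
      (solve 3 (λ b x y → b :* b :* ((x :+ con (- 1ℚ) :* y) :* (x :+ con (- 1ℚ) :* y)) :+ (x :+ :1 :* y) :* (x :+ :1 :* y) := :2 :* b :* (x :* x :- y :* y) :+ (b :* (x :- y) :- (x :+ y)) :* (b :* (x :- y) :- (x :+ y))) refl b x y)
    am-gm : ∀ u v → 2ℚ * b * cut u v ≤ b * b * diff u v + add u v
    am-gm u v = begin
      2ℚ * b * cut u v  ≡⟨ solve 3 (λ b x y → :2 :* b :* (x :* y) := x :* (:2 :* b :* y)) refl b (Q u v) (posDiff (q u * q u) (q v * q v)) ⟩
      Q u v * (2ℚ * b * posDiff (q u * q u) (q v * q v))  ≤⟨ *-monoˡ-≤ (Q-nonneg u v) (posDiff≤ (q u) (q v)) ⟩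
      Q u v * (b * b * ((q u + - 1ℚ * q v) * (q u + - 1ℚ * q v)) + (q u + 1ℚ * q v) * (q u + 1ℚ * q v))
        ≡⟨ solve 4 (λ b x y z → x :* (b :* b :* y :+ z) := b :* b :* (x :* y) :+ x :* z) refl b (Q u v) ((q u + - 1ℚ * q v) * (q u + - 1ℚ * q v)) ((q u + 1ℚ * q v) * (q u + 1ℚ * q v)) ⟩
      b * b * diff u v + add u v  ∎
    q·q+1*≤ : q · q + 1ℚ * (q · (Q ⋆ q)) ≤ 2ℚ * (q · q)
    q·q+1*≤ = ≤-by (q · q + - 1ℚ * (q · (Q ⋆ q))) (energy-nonneg (- 1ℚ) q refl)
      (solve 2 (λ x y → :2 :* x := (x :+ :1 :* y) :+ (x :+ con (- 1ℚ) :* y)) refl (q · q) (q · (Q ⋆ q)))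

-- Level sets

does-true : ∀ {P : Set} (P? : Dec P) → does P? ≡ true → P
does-true (yes p) _ = p

does-false : ∀ {P : Set} (P? : Dec P) → does P? ≡ false → ¬ P
does-false (no ¬p) _ = ¬p

count : (Fin n → Bool) → ℕ
count {zero}  b = 0
count {suc n} b = (if b zero then 1 else 0) ℕ.+ count (b ∘ suc)

step-mono-≤ : ∀ x y → (x ≡ true → y ≡ true) → (if x then 1 else 0) ℕ.≤ (if y then 1 else 0)
step-mono-≤ false y _ = ℕ.z≤n
step-mono-≤ true  y h rewrite h refl = ℕ.≤-refl

count-mono-≤ : {b c : Fin n → Bool} → (∀ i → b i ≡ true → c i ≡ true) → count b ℕ.≤ count c
count-mono-≤ {zero} b⊆c = ℕ.z≤n
count-mono-≤ {suc n} {b} {c} b⊆c = ℕ.+-mono-≤ (step-mono-≤ (b zero) (c zero) (b⊆c zero)) (count-mono-≤ (b⊆c ∘ suc))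

count-mono-< : {b c : Fin n → Bool} → (∀ i → b i ≡ true → c i ≡ true) →
               ∀ i → b i ≡ false → c i ≡ true → count b ℕ.< count c
count-mono-< {suc n} b⊆c zero b₀ c₀ rewrite b₀ | c₀ = ℕ.s≤s (count-mono-≤ (b⊆c ∘ suc))
count-mono-< {suc n} {b} {c} b⊆c (suc i) bᵢ cᵢ = ℕ.+-mono-≤-< (step-mono-≤ (b zero) (c zero) (b⊆c zero)) (count-mono-< (b⊆c ∘ suc) i bᵢ cᵢ)

argmin : (f : Fin n → ℚ) (S : Fin n → Bool) → (∃[ i ] S i ≡ true) →
         ∃[ i ] S i ≡ true × (∀ j → S j ≡ true → f i ≤ f j)
argmin {suc n} f S (k , k∈S) with Fin.any? (λ i → S (suc i) Data.Bool.Properties.≟ true)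
  where import Data.Bool.Properties
argmin {suc n} f S (zero , k∈S) | no ∄ = zero , k∈S , λ where
  zero    _ → ℚ.≤-refl
  (suc j) h → contradiction (j , h) ∄
argmin {suc n} f S (suc k , k∈S) | no ∄ = contradiction (k , k∈S) ∄
argmin {suc n} f S (k , k∈S) | yes ∃i with argmin (f ∘ suc) (S ∘ suc) ∃i | S zero in eq
... | i , i∈S , min | false = suc i , i∈S , λ where
  zero    h → contradiction (trans (sym eq) h) λ ()
  (suc j) h → min j h
... | i , i∈S , min | true with ℚ.≤-total (f zero) (f (suc i))
...   | inj₁ f₀≤ = zero , eq , λ where
  zero    _ → ℚ.≤-refl
  (suc j) h → ℚ.≤-trans f₀≤ (min j h)
...   | inj₂ ≤f₀ = suc i , i∈S , λ where
  zero    _ → ≤f₀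
  (suc j) h → min j h

module LevelSets {N : ℕ} (A B : Fin N → Fin N → ℚ) (c : ℚ) where

  -- Layer-cake form: for f ≥ 0 the positive part measures the levels whose set contains `u` but not
  -- `v`, the minimum those whose set contains both. So `cost f` is an integral of the costs of
  -- level sets.
  pair : (Fin N → ℚ) → Fin N → Fin N → ℚ
  pair f u v = A u v * posDiff (f u) (f v) + B u v * (f u ⊓ f v)

  cost : (Fin N → ℚ) → ℚ
  cost f = sum₂ (pair f) - c * sum f

  -- The cost is additive here because f is comonotone with the indicator of S.
  module _ (S : Fin N → Bool) (m : ℚ) (f : Fin N → ℚ) (0≤m : 0ℚ ≤ m) (0≤f : ∀ u → 0ℚ ≤ f u)
           (f-outside : ∀ u → S u ≡ false → f u ≡ 0ℚ) where

    private
      g : Fin N → ℚ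
      g u = m * 𝟙 (S u) + f u

    posDiff-+ : ∀ u v → posDiff (g u) (g v) ≡ m * posDiff (𝟙 (S u)) (𝟙 (S v)) + posDiff (f u) (f v)
    posDiff-+ u v with S u in eqᵤ | S v in eqᵥ
    ... | true  | true  = trans (cong (0ℚ ⊔_) (solve 3 (λ m x y → (m :* :1 :+ x) :- (m :* :1 :+ y) := x :- y) refl m (f u) (f v)))
      (solve 2 (λ m z → z := m :* :0 :+ z) refl m (posDiff (f u) (f v)))
    ... | true  | false rewrite f-outside v eqᵥ = begin
      0ℚ ⊔ (m * 1ℚ + f u - (m * 0ℚ + 0ℚ))  ≡⟨ cong (0ℚ ⊔_) (solve 2 (λ m x → m :* :1 :+ x :- (m :* :0 :+ :0) := m :+ x) refl m (f u)) ⟩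
      0ℚ ⊔ (m + f u)  ≡⟨ ℚ.p≤q⇒p⊔q≡q (+-nonneg 0≤m (0≤f u)) ⟩
      m + f u  ≡⟨ solve 2 (λ m x → m :+ x := m :* :1 :+ (x :- :0)) refl m (f u) ⟩
      m * 1ℚ + (f u - 0ℚ)  ≡⟨ cong (m * 1ℚ +_) (ℚ.p≤q⇒p⊔q≡q (p≤q⇒0≤q-p (0≤f u))) ⟨
      m * 1ℚ + (0ℚ ⊔ (f u - 0ℚ))  ∎
      where open ≡-Reasoning
    ... | false | true  rewrite f-outside u eqᵤ = begin
      0ℚ ⊔ (m * 0ℚ + 0ℚ - (m * 1ℚ + f v))  ≡⟨ cong (0ℚ ⊔_) (solve 2 (λ m x → m :* :0 :+ :0 :- (m :* :1 :+ x) := :- (m :+ x)) refl m (f v)) ⟩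
      0ℚ ⊔ - (m + f v)  ≡⟨ ℚ.p≥q⇒p⊔q≡p (ℚ.neg-antimono-≤ (+-nonneg 0≤m (0≤f v))) ⟩
      0ℚ  ≡⟨ solve 1 (λ m → :0 := m :* :0 :+ :0) refl m ⟩
      m * 0ℚ + 0ℚ  ≡⟨ cong (m * 0ℚ +_) (trans (cong (0ℚ ⊔_) (ℚ.+-identityˡ (- f v))) (ℚ.p≥q⇒p⊔q≡p (ℚ.neg-antimono-≤ (0≤f v)))) ⟨
      m * 0ℚ + (0ℚ ⊔ (0ℚ - f v))  ∎
      where open ≡-Reasoning
    ... | false | false rewrite f-outside u eqᵤ | f-outside v eqᵥ =
      trans (cong (0ℚ ⊔_) (ℚ.+-inverseʳ (m * 0ℚ + 0ℚ))) (solve 1 (λ m → :0 := m :* :0 :+ :0) refl m)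

    ⊓-+ : ∀ u v → g u ⊓ g v ≡ m * (𝟙 (S u) ⊓ 𝟙 (S v)) + f u ⊓ f v
    ⊓-+ u v with S u in eqᵤ | S v in eqᵥ
    ... | true  | true  = sym (ℚ.mono-≤-distrib-⊓ (ℚ.+-monoʳ-≤ (m * 1ℚ)) (f u) (f v))
    ... | true  | false rewrite f-outside v eqᵥ = begin
      (m * 1ℚ + f u) ⊓ (m * 0ℚ + 0ℚ)  ≡⟨ cong ((m * 1ℚ + f u) ⊓_) (solve 1 (λ m → m :* :0 :+ :0 := :0) refl m) ⟩
      (m * 1ℚ + f u) ⊓ 0ℚ  ≡⟨ ℚ.p≥q⇒p⊓q≡q (+-nonneg (*-nonneg 0≤m 0≤1) (0≤f u)) ⟩
      0ℚ  ≡⟨ solve 1 (λ m → :0 := m :* :0 :+ :0) refl m ⟩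
      m * 0ℚ + 0ℚ  ≡⟨ cong (m * 0ℚ +_) (ℚ.p≥q⇒p⊓q≡q (0≤f u)) ⟨
      m * 0ℚ + f u ⊓ 0ℚ  ∎
      where open ≡-Reasoning
    ... | false | true  rewrite f-outside u eqᵤ = begin
      (m * 0ℚ + 0ℚ) ⊓ (m * 1ℚ + f v)  ≡⟨ cong (_⊓ (m * 1ℚ + f v)) (solve 1 (λ m → m :* :0 :+ :0 := :0) refl m) ⟩
      0ℚ ⊓ (m * 1ℚ + f v)  ≡⟨ ℚ.p≤q⇒p⊓q≡p (+-nonneg (*-nonneg 0≤m 0≤1) (0≤f v)) ⟩
      0ℚ  ≡⟨ solve 1 (λ m → :0 := m :* :0 :+ :0) refl m ⟩
      m * 0ℚ + 0ℚ  ≡⟨ cong (m * 0ℚ +_) (ℚ.p≤q⇒p⊓q≡p (0≤f v)) ⟨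
      m * 0ℚ + 0ℚ ⊓ f v  ∎
      where open ≡-Reasoning
    ... | false | false rewrite f-outside u eqᵤ | f-outside v eqᵥ =
      trans (ℚ.⊓-idem (m * 0ℚ + 0ℚ)) refl

    cost-+ : cost g ≡ m * cost (λ u → 𝟙 (S u)) + cost f
    cost-+ = begin
      sum₂ (pair g) - c * sum g
        ≡⟨ cong₂ (λ x y → x - c * y)
             (trans (sum₂-cong pair-+) (trans (sum₂-+ (λ u v → m * pair 1S u v) (pair f)) (cong (_+ sum₂ (pair f)) (sum₂-*ˡ m (pair 1S)))))
             (trans (∑-distrib-+ (λ u → m * 1S u) f) (cong (_+ sum f) (sum-*ˡ m 1S))) ⟩
      (m * sum₂ (pair 1S) + sum₂ (pair f)) - c * (m * sum 1S + sum f)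
        ≡⟨ solve 6 (λ m x y c z w → (m :* x :+ y) :- c :* (m :* z :+ w) := m :* (x :- c :* z) :+ (y :- c :* w)) refl m (sum₂ (pair 1S)) (sum₂ (pair f)) c (sum 1S) (sum f) ⟩
      m * cost 1S + cost f
        ∎
      where
      open ≡-Reasoning
      1S : Fin N → ℚ
      1S u = 𝟙 (S u)
      pair-+ : ∀ u v → pair g u v ≡ m * pair 1S u v + pair f u v
      pair-+ u v = trans (cong₂ (λ x y → A u v * x + B u v * y) (posDiff-+ u v) (⊓-+ u v))
        (solve 7 (λ a b m x y z w → a :* (m :* x :+ y) :+ b :* (m :* z :+ w) := m :* (a :* x :+ b :* z) :+ (a :* y :+ b :* w)) refl (A u v) (B u v) m (posDiff (1S u) (1S v)) (posDiff (f u) (f v)) (1S u ⊓ 1S v) (f u ⊓ f v))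

  cost-cong : ∀ {f g} → (∀ u → f u ≡ g u) → cost f ≡ cost g
  cost-cong f≗g = cong₂ (λ x y → x - c * y)
    (sum₂-cong (λ u v → cong₂ _+_ (cong (A u v *_) (cong₂ posDiff (f≗g u) (f≗g v))) (cong (B u v *_) (cong₂ _⊓_ (f≗g u) (f≗g v)))))
    (sum-cong-≗ {N} f≗g)

  cost-0 : cost (λ _ → 0ℚ) ≡ 0ℚ
  cost-0 = begin
    sum₂ (λ u v → A u v * 0ℚ + B u v * 0ℚ) - c * sum {N} (λ _ → 0ℚ)
      ≡⟨ cong₂ (λ x y → x - c * y) (trans (sum₂-cong (λ u v → solve 2 (λ a b → a :* :0 :+ b :* :0 := :0) refl (A u v) (B u v))) (sum₂-0 {N})) (sum-0 {N}) ⟩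
    0ℚ - c * 0ℚ
      ≡⟨ solve 1 (λ c → :0 :- c :* :0 := :0) refl c ⟩
    0ℚ
      ∎
    where open ≡-Reasoning

  opaque
    -- Opaque, so that comparisons of rationals are not unfolded in later types; the facts below are
    -- its interface.
    support : (Fin N → ℚ) → Fin N → Bool
    support f u = does (0ℚ ℚ.<? f u)

    support-true : ∀ f u → support f u ≡ true → 0ℚ < f u
    support-true f u = does-true (0ℚ ℚ.<? f u)

    support-false : ∀ f u → support f u ≡ false → f u ≤ 0ℚ
    support-false f u h = ℚ.≮⇒≥ (does-false (0ℚ ℚ.<? f u) h)

    support-intro : ∀ f u → 0ℚ < f u → support f u ≡ true
    support-intro f u = dec-true (0ℚ ℚ.<? f u)

    support-≤0 : ∀ f u → f u ≤ 0ℚ → support f u ≡ false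
    support-≤0 f u fu≤0 = dec-false (0ℚ ℚ.<? f u) (λ 0<fu → ℚ.<-irrefl refl (ℚ.<-≤-trans 0<fu fu≤0))

  CheapLevelSet : (Fin N → ℚ) → Set
  CheapLevelSet f = Σ[ S ∈ (Fin N → Bool) ] (∀ u → S u ≡ true → 0ℚ < f u) × cost (λ u → 𝟙 (S u)) < 0ℚ

  module _ (f : Fin N → ℚ) (0≤f : ∀ u → 0ℚ ≤ f u) (w : Fin N) (0<fw : 0ℚ < f w) where

    private
      S : Fin N → Bool
      S = support f
      min : ∃[ i ] S i ≡ true × (∀ j → S j ≡ true → f i ≤ f j)
      min = argmin f S (w , support-intro f w 0<fw)
      i : Fin N
      i = proj₁ min
      m : ℚ
      m = f i
      0≤m : 0ℚ ≤ m
      0≤m = 0≤f i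

    peel : Fin N → ℚ
    peel u = f u - m * 𝟙 (S u)

    peel-≤ : ∀ u → peel u ≤ f u
    peel-≤ u = ≤-by (m * 𝟙 (S u)) (*-nonneg 0≤m (𝟙-nonneg (S u))) (solve 2 (λ x y → x := (x :- y) :+ y) refl (f u) (m * 𝟙 (S u)))

    peel-outside : ∀ u → S u ≡ false → peel u ≡ 0ℚ
    peel-outside u eq = trans (cong₂ (λ b x → x - m * 𝟙 b) eq (ℚ.≤-antisym (support-false f u eq) (0≤f u))) (solve 1 (λ m → :0 :- m :* :0 := :0) refl m)

    peel-inside : ∀ u → S u ≡ true → peel u ≡ f u - m
    peel-inside u eq = trans (cong (λ b → f u - m * 𝟙 b) eq) (cong (λ x → f u - x) (ℚ.*-identityʳ m))

    peel-nonneg : ∀ u → 0ℚ ≤ peel u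
    peel-nonneg u with S u in eq
    ... | true  = subst (λ z → 0ℚ ≤ f u - z) (sym (ℚ.*-identityʳ m)) (p≤q⇒0≤q-p (proj₂ (proj₂ min) u eq))
    ... | false = subst (λ z → 0ℚ ≤ f u - z) (sym (ℚ.*-zeroʳ m)) (p≤q⇒0≤q-p (0≤f u))

    -- Additivity splits `cost f` into the lowest layer and the rest; if the layer is not cheap, the
    -- rest must be negative.
    cost-peel : 0ℚ ≤ cost (λ u → 𝟙 (S u)) → cost f < 0ℚ → cost peel < 0ℚ
    cost-peel 0≤cost = ℚ.≤-<-trans (≤-by (m * cost (λ u → 𝟙 (S u))) (*-nonneg 0≤m 0≤cost)
      (trans (cost-cong {f} (λ u → solve 2 (λ x y → x := y :+ (x :- y)) refl (f u) (m * 𝟙 (S u))))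
        (trans (cost-+ S m peel 0≤m peel-nonneg peel-outside) (ℚ.+-comm (m * cost (λ u → 𝟙 (S u))) (cost peel)))))

    peel-smaller : count (support peel) ℕ.< count S
    peel-smaller = count-mono-< (λ u h → support-intro f u (ℚ.<-≤-trans (support-true peel u h) (peel-≤ u))) i
      (support-≤0 peel i (ℚ.≤-reflexive (trans (peel-inside i (proj₁ (proj₂ min))) (ℚ.+-inverseʳ m)))) (proj₁ (proj₂ min))

  -- A negative integral has a negative integrand somewhere. Layers are peeled off from below; each
  -- peel drops the minimiser from the support, whose size is bounded by `k`.
  cheap-level-set : ∀ k f → count (support f) ℕ.≤ k → (∀ u → 0ℚ ≤ f u) → cost f < 0ℚ → CheapLevelSet f
  cheap-level-set k f size 0≤f cost<0 = byDec (Fin.any? (λ u → 0ℚ ℚ.<? f u)) nonzero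
    (λ ∄ → contradiction (subst (_< 0ℚ) (trans (cost-cong (λ u → ℚ.≤-antisym (ℚ.≮⇒≥ (λ h → ∄ (u , h))) (0≤f u))) cost-0) cost<0) (ℚ.<-irrefl refl))
    where
    byDec : ∀ {P : Set} → Dec P → (P → CheapLevelSet f) → (¬ P → CheapLevelSet f) → CheapLevelSet f
    byDec (yes p) y n = y p
    byDec (no ¬p) y n = n ¬p
    descend : ∀ k → count (support f) ℕ.≤ k → ∃[ w ] 0ℚ < f w → 0ℚ ≤ cost (λ u → 𝟙 (support f u)) → CheapLevelSet f
    descend zero    size (w , 0<fw) 0≤cost = contradiction (ℕ.<-≤-trans (peel-smaller f 0≤f w 0<fw) size) λ ()
    descend (suc k) size (w , 0<fw) 0≤cost =
      let T , T⊆ , cheap = cheap-level-set k (peel f 0≤f w 0<fw) (ℕ.s≤s⁻¹ (ℕ.≤-trans (peel-smaller f 0≤f w 0<fw) size))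
                             (peel-nonneg f 0≤f w 0<fw) (cost-peel f 0≤f w 0<fw 0≤cost cost<0)
      in T , (λ u u∈T → ℚ.<-≤-trans (T⊆ u u∈T) (peel-≤ f 0≤f w 0<fw u)) , cheap
    nonzero : ∃[ w ] 0ℚ < f w → CheapLevelSet f
    nonzero w = byDec (cost (λ u → 𝟙 (support f u)) ℚ.<? 0ℚ) (λ cheap → support f , support-true f , cheap)
      (λ ¬cheap → descend k size w (ℚ.≮⇒≥ ¬cheap))


-- Finding a cluster

-- Links the level sets of q², which see minima of squares, to the bilinear form in q that
-- collisions of walks estimate.
⊓-square-≤ : ∀ {x y} → 0ℚ ≤ x → 0ℚ ≤ y → (x * x) ⊓ (y * y) ≤ x * y
⊓-square-≤ {x} {y} 0≤x 0≤y with ℚ.≤-total x y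
... | inj₁ x≤y = ℚ.≤-trans (ℚ.p⊓q≤p (x * x) (y * y)) (*-monoˡ-≤ 0≤x x≤y)
... | inj₂ y≤x = ℚ.≤-trans (ℚ.p⊓q≤q (x * x) (y * y)) (*-monoʳ-≤ 0≤y y≤x)

byDec : ∀ {P B : Set} → Dec P → (P → B) → (¬ P → B) → B
byDec (yes p) y n = y p
byDec (no ¬p) y n = n ¬p

module Clustering {N : ℕ} .{{N≢0 : NonZero N}} (P : Fin N → Fin N → ℚ)
  (P-sym : ∀ u v → P u v ≡ P v u) (P-nonneg : ∀ u v → 0ℚ ≤ P u v)
  (P-row : ∀ u → sum (P u) ≡ 1ℚ)
  (pos neg : Fin N → Fin N → Bool) (pos-sym : ∀ u v → pos u v ≡ pos v u)
  (d : ℕ) (degree≤d : ∀ u → sum (λ v → 𝟙 (pos u v) + 𝟙 (neg u v)) ≤ fromℕ d)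
  (pos≤P : ∀ u v → 𝟙 (pos u v) ≤ fromℕ d * P u v)
  (m : ℕ) .{{m≢0 : NonZero m}} (i : ℕ) (8N≤2^i : 8 ℕ.* N ℕ.≤ 2 ℕ.^ i) where

  -- With 1/m ≤ ε, every cluster loses fewer than 10/32 · d/m edges per node of
  -- it (8/32 by Cheeger's inequality, 2/32 negative ones) and the unclustered
  -- rest fewer than 16/32 · dN/m edges, in total less than εdN. All costs are
  -- multiplied by β = 32 m to avoid divisions.
  b T ℓ : ℕ
  b = 32 ℕ.* m
  T = i ℕ.* (b ℕ.* b)
  ℓ = 8 ℕ.* m ℕ.* T

  instance
    b≢0 : NonZero b
    b≢0 = ℕ.m*n≢0 32 m
    b²≢0 : NonZero (b ℕ.* b)
    b²≢0 = ℕ.m*n≢0 b b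

  Δ ν β 𝑁 : ℚ
  Δ = fromℕ d
  ν = fromℕ m
  β = fromℕ b
  𝑁 = fromℕ N

  0≤Δ : 0ℚ ≤ Δ
  0≤Δ = fromℕ-nonneg d

  0≤β : 0ℚ ≤ β
  0≤β = fromℕ-nonneg b

  0≤ν : 0ℚ ≤ ν
  0≤ν = fromℕ-nonneg m

  β≡32ν : β ≡ fromℕ 32 * ν
  β≡32ν = fromℕ-* 32 m

  N⁻ : Fin N → Fin N → ℚ
  N⁻ u v = 𝟙 (neg u v)

  size : (Fin N → Bool) → ℚ
  size H = sum (λ u → 𝟙 (H u))

  module _ (H : Fin N → Bool) where

    open WatchedChain P P-sym P-nonneg P-row H

    open SymmetricKernel (Q ℓ) (Q-sym ℓ) (Q-nonneg ℓ) (Q-row ℓ)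

    -- By symmetry, rows of powers of `Q` are columns as well, so `iterate`, which acts on
    -- functions, also transports distributions.
    law : Fin N → ℕ → Fin N → ℚ
    law s t = iterate (Q ℓ) t (pointMass s)

    law-nonneg : ∀ s t u → 0ℚ ≤ law s t u
    law-nonneg s t = iterate-nonneg t (pointMass-nonneg s)

    mass : Fin N → ℕ → ℚ
    mass s t = iterate (Q ℓ) t inside s

    law-· : ∀ s t f → law s t · f ≡ iterate (Q ℓ) t f s
    law-· s t f = trans (sym (iterate-adjoint t (pointMass s) f)) (pointMass-· s (iterate (Q ℓ) t f))

    blend : Fin N → ℕ → Fin N → ℚ
    blend s t = smooth (law s t)

    blend-nonneg : ∀ s t u → 0ℚ ≤ blend s t u
    blend-nonneg s t u = +-nonneg (law-nonneg s t u) (law-nonneg s (suc t) u)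

    ⋆-outside : ∀ f u → H u ≡ false → (Q ℓ ⋆ f) u ≡ 0ℚ
    ⋆-outside f u u∉H = trans (Q-⋆ ℓ f u) (trans (cong (λ x → 𝟙 x * (G ℓ u · (λ w → inside w * f w))) u∉H) (ℚ.*-zeroˡ (G ℓ u · (λ w → inside w * f w))))

    law-outside : ∀ s t u → H s ≡ true → H u ≡ false → law s t u ≡ 0ℚ
    law-outside s zero u s∈H u∉H = begin
      pointMass s u  ≡⟨ ℚ.*-identityˡ (pointMass s u) ⟨
      1ℚ * pointMass s u  ≡⟨ cong (λ x → 𝟙 x * pointMass s u) s∈H ⟨
      inside s * pointMass s u  ≡⟨ pointMass-* s u inside ⟩
      inside u * pointMass s u  ≡⟨ cong (λ x → 𝟙 x * pointMass s u) u∉H ⟩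
      0ℚ * pointMass s u  ≡⟨ ℚ.*-zeroˡ (pointMass s u) ⟩
      0ℚ  ∎
      where open ≡-Reasoning
    law-outside s (suc t) u _ u∉H = ⋆-outside (law s t) u u∉H

    -- Ensures that the level sets found for the squared blend are subsets of H and can be cut off
    -- from it.
    blend-inside : ∀ s t u → H s ≡ true → 0ℚ < blend s t u * blend s t u → H u ≡ true
    blend-inside s t u s∈H 0<q = ¬-not (λ u∉H → ℚ.<-irrefl (sym (cong (λ x → x * x) (q≡0 u∉H))) 0<q)
      where
      q≡0 : H u ≡ false → blend s t u ≡ 0ℚ
      q≡0 u∉H = cong₂ _+_ (law-outside s t u s∈H u∉H) (law-outside s (suc t) u s∈H u∉H)

    norm : Fin N → ℕ → ℚ
    norm s t = law s t · law s t

    mass-antitone : ∀ s {t t′} → t ℕ.≤ t′ → mass s t′ ≤ mass s t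
    mass-antitone s {t} {t′} t≤t′ = subst (λ x → mass s x ≤ mass s t) (ℕ.m∸n+n≡m t≤t′) (go (t′ ℕ.∸ t))
      where
      go : ∀ j → mass s (j ℕ.+ t) ≤ mass s t
      go zero    = ℚ.≤-refl
      go (suc j) = ℚ.≤-trans (iterate-inside-antitone ℓ (j ℕ.+ t) s) (go j)

    -- from 0 ≤ Σ (2N·law − inside)²
    norm-lower : ∀ s t → 1ℚ ≤ 2ℚ * mass s t → 1ℚ ≤ fromℕ 4 * 𝑁 * norm s t
    norm-lower s t half = *-cancelˡ-≤ 𝑁 (fromℕ-pos N) (begin
      𝑁 * 1ℚ
        ≤⟨ ≤-by (2ℚ * 𝑁 * (2ℚ * mass s t - 1ℚ) + (𝑁 - inside · inside)) (+-nonneg (*-nonneg (*-nonneg 0≤2 (fromℕ-nonneg N)) (p≤q⇒0≤q-p half)) (p≤q⇒0≤q-p in·in≤N))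
             (solve 3 (λ n m i → :2 :* :2 :* n :* m :- i := n :* :1 :+ (:2 :* n :* (:2 :* m :- :1) :+ (n :- i))) refl 𝑁 (mass s t) (inside · inside)) ⟩
      2ℚ * 2ℚ * 𝑁 * mass s t - inside · inside
        ≤⟨ ≤-by (sq · sq) (sum-nonneg (λ u → square-nonneg (sq u))) (trans (solve 4 (λ n y m i → n :* (:ℕ 4 :* n :* y) := (:2 :* :2 :* n :* m :- i) :+ ((:ℕ 4 :* n :* n :* y :- :ℕ 4 :* n :* m) :+ i)) refl 𝑁 (norm s t) (mass s t) (inside · inside)) (cong (2ℚ * 2ℚ * 𝑁 * mass s t - inside · inside +_) (sym sq·sq))) ⟩
      𝑁 * (fromℕ 4 * 𝑁 * norm s t)
        ∎)
      where
      open ℚ.≤-Reasoning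
      a sq : Fin N → ℚ
      a = law s t
      sq u = 2ℚ * 𝑁 * a u - inside u
      in·in≤N : inside · inside ≤ 𝑁
      in·in≤N = ℚ.≤-trans (sum-mono-≤ (λ u → subst (_≤ 1ℚ) (sym (𝟙-idem (H u))) (𝟙≤1 (H u)))) (ℚ.≤-reflexive (trans (sum-const N 1ℚ) (ℚ.*-identityʳ 𝑁)))
      sq·sq : sq · sq ≡ (fromℕ 4 * 𝑁 * 𝑁 * norm s t - fromℕ 4 * 𝑁 * mass s t) + inside · inside
      sq·sq = begin-equality
        sq · sq
          ≡⟨ sum-cong-≗ {N} (λ u → solve 3 (λ n a i → (:2 :* n :* a :- i) :* (:2 :* n :* a :- i) := (:ℕ 4 :* n :* n :* (a :* a) :- :ℕ 4 :* n :* (a :* i)) :+ i :* i) refl 𝑁 (a u) (inside u)) ⟩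
        sum (λ u → (fromℕ 4 * 𝑁 * 𝑁 * (a u * a u) - fromℕ 4 * 𝑁 * (a u * inside u)) + inside u * inside u)
          ≡⟨ trans (∑-distrib-+ (λ u → fromℕ 4 * 𝑁 * 𝑁 * (a u * a u) - fromℕ 4 * 𝑁 * (a u * inside u)) (λ u → inside u * inside u))
               (cong (_+ inside · inside) (trans (sum-- (λ u → fromℕ 4 * 𝑁 * 𝑁 * (a u * a u)) (λ u → fromℕ 4 * 𝑁 * (a u * inside u))) (cong₂ _-_ (sum-*ˡ (fromℕ 4 * 𝑁 * 𝑁) (λ u → a u * a u)) (trans (sum-*ˡ (fromℕ 4 * 𝑁) (λ u → a u * inside u)) (cong (fromℕ 4 * 𝑁 *_) (law-· s t inside)))))) ⟩
        (fromℕ 4 * 𝑁 * 𝑁 * norm s t - fromℕ 4 * 𝑁 * mass s t) + inside · inside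
          ∎

    conflict : Fin N → ℕ → ℚ
    conflict s t = blend s t · (N⁻ ⋆ blend s t)

    -- The squared norm starts at 1 and is still at least 1/(4N) at time `T`, which leaves no room
    -- for `i` halvings. Survival until the earlier time `t` is inherited, as mass only decreases.
    slow : ∀ s → 1ℚ ≤ 2ℚ * mass s T →
      ∃[ t ] t ℕ.< T × 1ℚ ≤ fromℕ 4 * 𝑁 * (blend s t · blend s t) ×
             fromℕ (b ℕ.* b) * (norm s t - norm s (suc t)) ≤ norm s t
    slow s half =
      let t , t<T , slow-t = SlowDecay.slow-time (norm s) (λ t → ·-nonneg (law-nonneg s t) (law-nonneg s t)) (b ℕ.* b) i large
      in t , t<T , (ℚ.≤-trans (norm-lower s t (ℚ.≤-trans half (*-monoˡ-≤ 0≤2 (mass-antitone s (ℕ.<⇒≤ t<T)))))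
                     (*-monoˡ-≤ (*-nonneg (fromℕ-nonneg 4) (fromℕ-nonneg N)) (smooth-norm (law-nonneg s t)))) , slow-t
      where
      open ℚ.≤-Reasoning
      large : norm s 0 < norm s T * fromℕ (2 ℕ.^ i)
      large = begin-strict
        norm s 0  ≡⟨ trans (pointMass-· s (pointMass s)) (pointMass-refl s) ⟩
        -- The required strictness is the factor 2 between 8N and the 4N of `norm-lower`.
        1ℚ  <⟨ ℚ.*<* (ℤ.+<+ (ℕ.s≤s (ℕ.s≤s ℕ.z≤n))) ⟩
        2ℚ * 1ℚ  ≤⟨ *-monoˡ-≤ 0≤2 (norm-lower s T half) ⟩
        2ℚ * (fromℕ 4 * 𝑁 * norm s T)  ≡⟨ solve 2 (λ n y → :2 :* (:ℕ 4 :* n :* y) := y :* (:ℕ 8 :* n)) refl 𝑁 (norm s T) ⟩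
        norm s T * (fromℕ 8 * 𝑁)  ≡⟨ cong (norm s T *_) (fromℕ-* 8 N) ⟨
        norm s T * fromℕ (8 ℕ.* N)  ≤⟨ *-monoˡ-≤ (·-nonneg (law-nonneg s T) (law-nonneg s T)) (fromℕ-mono-≤ 8N≤2^i) ⟩
        norm s T * fromℕ (2 ℕ.^ i)  ∎

    remaining : (Fin N → Bool) → Fin N → Bool
    remaining S v = H v ∧ not (S v)

    -- Errors are summed over ordered pairs. A cut positive edge occurs in both orders but leaves
    -- `S` in only one, hence the factor 2; pairs within `S` are met in both orders anyway.
    removal : (Fin N → Bool) → Fin N → Fin N → ℚ
    removal S u v = 2ℚ * (𝟙 (S u) * (𝟙 (pos u v) * 𝟙 (remaining S v))) + 𝟙 (S u) * (N⁻ u v * 𝟙 (S v))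

    Cluster : Set
    Cluster = Σ[ S ∈ (Fin N → Bool) ] (∀ u → S u ≡ true → H u ≡ true) ×
      β * sum₂ (removal S) < fromℕ 10 * Δ * size S

    -- Within H a positive edge weighs at most Δ P ≤ Δ Q, so the first weight dominates the doubled,
    -- scaled edges of `removal`; the last argument is the budget per node.
    open LevelSets (λ u v → 2ℚ * β * Δ * Q ℓ u v) (λ u v → β * N⁻ u v) (fromℕ 10 * Δ)

    -- Cheeger's inequality costs 8 Δ‖q‖². With β = 32 ν, few conflicts cost less than 2 Δ‖q‖². The
    -- sum stays strictly below the subtracted 10 Δ‖q‖².
    cost-blend : ∀ s t → fromℕ (b ℕ.* b) * (norm s t - norm s (suc t)) ≤ norm s t →
      fromℕ 16 * ν * conflict s t < Δ * (blend s t · blend s t) →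
      cost (λ u → blend s t u * blend s t u) < 0ℚ
    cost-blend s t slow few = begin-strict
      cost (λ u → q u * q u)
        ≡⟨ cong (λ x → x - c * (q · q)) (sum₂-+ (λ u v → 2ℚ * β * Δ * Q ℓ u v * posDiff (q u * q u) (q v * q v)) (λ u v → β * N⁻ u v * ((q u * q u) ⊓ (q v * q v)))) ⟩
      (sum₂ (λ u v → 2ℚ * β * Δ * Q ℓ u v * posDiff (q u * q u) (q v * q v)) + sum₂ (λ u v → β * N⁻ u v * ((q u * q u) ⊓ (q v * q v)))) - c * (q · q)
        ≤⟨ ℚ.+-monoˡ-≤ (- (c * (q · q))) (ℚ.+-mono-≤ cut≤ conflict≤) ⟩
      (2ℚ * Δ * (2ℚ * 2ℚ * (q · q)) + β * conflict s t) - c * (q · q)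
        ≡⟨ cong (λ x → (2ℚ * Δ * (2ℚ * 2ℚ * (q · q)) + x * conflict s t) - c * (q · q)) β≡32ν ⟩
      (2ℚ * Δ * (2ℚ * 2ℚ * (q · q)) + fromℕ 32 * ν * conflict s t) - c * (q · q)
        ≡⟨ solve 4 (λ D n x y → (:2 :* D :* (:2 :* :2 :* x) :+ :ℕ 32 :* n :* y) :- :ℕ 10 :* D :* x := :2 :* (:ℕ 16 :* n :* y) :- :2 :* (D :* x)) refl Δ ν (q · q) (conflict s t) ⟩
      2ℚ * (fromℕ 16 * ν * conflict s t) - 2ℚ * (Δ * (q · q))
        <⟨ ℚ.+-monoˡ-< (- (2ℚ * (Δ * (q · q)))) (*-monoˡ-< {2ℚ} 0<2 few) ⟩
      2ℚ * (Δ * (q · q)) - 2ℚ * (Δ * (q · q))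
        ≡⟨ ℚ.+-inverseʳ (2ℚ * (Δ * (q · q))) ⟩
      0ℚ
        ∎
      where
      open ℚ.≤-Reasoning
      q : Fin N → ℚ
      q = blend s t
      c : ℚ
      c = fromℕ 10 * Δ
      cut : Fin N → Fin N → ℚ
      cut u v = Q ℓ u v * posDiff (q u * q u) (q v * q v)
      cut≤ : sum₂ (λ u v → 2ℚ * β * Δ * Q ℓ u v * posDiff (q u * q u) (q v * q v)) ≤ 2ℚ * Δ * (2ℚ * 2ℚ * (q · q))
      cut≤ = begin
        sum₂ (λ u v → 2ℚ * β * Δ * Q ℓ u v * posDiff (q u * q u) (q v * q v))
          ≡⟨ trans (sum₂-cong (λ u v → ℚ.*-assoc (2ℚ * β * Δ) (Q ℓ u v) (posDiff (q u * q u) (q v * q v)))) (sum₂-*ˡ (2ℚ * β * Δ) cut) ⟩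
        2ℚ * β * Δ * sum₂ cut
          ≡⟨ solve 3 (λ b D x → :2 :* b :* D :* x := :2 :* D :* (b :* x)) refl β Δ (sum₂ cut) ⟩
        2ℚ * Δ * (β * sum₂ cut)
          ≤⟨ *-monoˡ-≤ (*-nonneg 0≤2 0≤Δ) (cheeger β (law s t) (fromℕ-pos b) (law-nonneg s t) (subst (λ x → x * (norm s t - norm s (suc t)) ≤ norm s t) (fromℕ-* b b) slow)) ⟩
        2ℚ * Δ * (2ℚ * 2ℚ * (q · q))
          ∎
      conflict≤ : sum₂ (λ u v → β * N⁻ u v * ((q u * q u) ⊓ (q v * q v))) ≤ β * conflict s t
      conflict≤ = begin
        sum₂ (λ u v → β * N⁻ u v * ((q u * q u) ⊓ (q v * q v)))
          ≤⟨ sum₂-mono-≤ (λ u v → *-monoˡ-≤ (*-nonneg 0≤β (𝟙-nonneg (neg u v))) (⊓-square-≤ (blend-nonneg s t u) (blend-nonneg s t v))) ⟩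
        sum₂ (λ u v → β * N⁻ u v * (q u * q v))
          ≡⟨ trans (sum₂-cong (λ u v → solve 4 (λ b e x y → b :* e :* (x :* y) := b :* (x :* (e :* y))) refl β (N⁻ u v) (q u) (q v))) (sum₂-*ˡ β (λ u v → q u * (N⁻ u v * q v))) ⟩
        β * sum₂ (λ u v → q u * (N⁻ u v * q v))
          ≡⟨ cong (β *_) (sum-cong-≗ {N} (λ u → sum-*ˡ (q u) (λ v → N⁻ u v * q v))) ⟩
        β * conflict s t
          ∎

    cluster : ∀ s t → H s ≡ true → fromℕ (b ℕ.* b) * (norm s t - norm s (suc t)) ≤ norm s t →
      fromℕ 16 * ν * conflict s t < Δ * (blend s t · blend s t) → Cluster
    cluster s t s∈H slow few =
      let q² = λ u → blend s t u * blend s t u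
          S , S⊆ , cheap = cheap-level-set (count (support q²)) q² ℕ.≤-refl (λ u → square-nonneg (blend s t u)) (cost-blend s t slow few)
          S⊆H = λ u u∈S → blend-inside s t u s∈H (S⊆ u u∈S)
      in S , S⊆H , ℚ.≤-<-trans (bound S S⊆H) (shift cheap)
      where
      open ℚ.≤-Reasoning
      shift : ∀ {x y} → x - y < 0ℚ → x < y
      shift {x} {y} h = subst₂ _<_ (solve 2 (λ x y → (x :- y) :+ y := x) refl x y) (ℚ.+-identityˡ y) (ℚ.+-monoˡ-< y h)
      posDiff-𝟙 : ∀ x y → posDiff (𝟙 x) (𝟙 y) ≡ 𝟙 x * 𝟙 (not y)
      posDiff-𝟙 true  true  = refl
      posDiff-𝟙 true  false = refl
      posDiff-𝟙 false true  = refl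
      posDiff-𝟙 false false = refl
      ⊓-𝟙 : ∀ x y → 𝟙 x ⊓ 𝟙 y ≡ 𝟙 x * 𝟙 y
      ⊓-𝟙 true  true  = refl
      ⊓-𝟙 true  false = refl
      ⊓-𝟙 false true  = refl
      ⊓-𝟙 false false = refl
      bound : ∀ S → (∀ u → S u ≡ true → H u ≡ true) →
        β * sum₂ (removal S) ≤ sum₂ (pair (λ u → 𝟙 (S u)))
      bound S S⊆H = ℚ.≤-trans (ℚ.≤-reflexive (sym (sum₂-*ˡ β (removal S)))) (sum₂-mono-≤ removal≤)
        where
        -- `Q` dominates `P` only between nodes of H, which is enough: S ⊆ H places `u` there, and
        -- the indicator of the remaining nodes places `v` there.
        edge≤ : ∀ x hᵤ hᵥ y {e p q} → (x ≡ true → hᵤ ≡ true) → e ≤ Δ * p → 0ℚ ≤ q → 𝟙 hᵤ * (p * 𝟙 hᵥ) ≤ q →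
          𝟙 x * (e * 𝟙 (hᵥ ∧ not y)) ≤ Δ * q * (𝟙 x * 𝟙 (not y))
        edge≤ false hᵤ hᵥ y {e} {p} {q} _ _ _ _ = ℚ.≤-reflexive (solve 3 (λ x y z → :0 :* x := y :* (:0 :* z)) refl (e * 𝟙 (hᵥ ∧ not y)) (Δ * q) (𝟙 (not y)))
        edge≤ true hᵤ false y {e} {p} {q} _ _ 0≤q _ = ℚ.≤-trans (ℚ.≤-reflexive (trans (ℚ.*-identityˡ (e * 0ℚ)) (ℚ.*-zeroʳ e))) (*-nonneg (*-nonneg 0≤Δ 0≤q) (*-nonneg 0≤1 (𝟙-nonneg (not y))))
        edge≤ true false true y u∈H _ _ _ = contradiction (u∈H refl) λ ()
        edge≤ true true true y {e} {p} {q} _ e≤ 0≤q p≤q = begin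
          1ℚ * (e * 𝟙 (not y))  ≤⟨ *-monoˡ-≤ 0≤1 (*-monoʳ-≤ (𝟙-nonneg (not y)) e≤) ⟩
          1ℚ * (Δ * p * 𝟙 (not y))  ≡⟨ solve 3 (λ D p x → :1 :* (D :* p :* x) := D :* (:1 :* (p :* :1)) :* (:1 :* x)) refl Δ p (𝟙 (not y)) ⟩
          Δ * (1ℚ * (p * 1ℚ)) * (1ℚ * 𝟙 (not y))  ≤⟨ *-monoʳ-≤ (*-nonneg 0≤1 (𝟙-nonneg (not y))) (*-monoˡ-≤ 0≤Δ p≤q) ⟩
          Δ * q * (1ℚ * 𝟙 (not y))  ∎
        removal≤ : ∀ u v → β * removal S u v ≤ pair (λ u → 𝟙 (S u)) u v
        removal≤ u v = begin
          β * removal S u v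
            ≤⟨ *-monoˡ-≤ 0≤β (ℚ.+-monoˡ-≤ (𝟙 (S u) * (N⁻ u v * 𝟙 (S v))) (*-monoˡ-≤ 0≤2 (edge≤ (S u) (H u) (H v) (S v) (S⊆H u) (pos≤P u v) (Q-nonneg ℓ u v) (P≤Q ℓ u v)))) ⟩
          β * (2ℚ * (Δ * Q ℓ u v * (𝟙 (S u) * 𝟙 (not (S v)))) + 𝟙 (S u) * (N⁻ u v * 𝟙 (S v)))
            ≡⟨ solve 7 (λ b D q x y e z → b :* (:2 :* (D :* q :* (x :* y)) :+ x :* (e :* z)) := :2 :* b :* D :* q :* (x :* y) :+ b :* e :* (x :* z)) refl β Δ (Q ℓ u v) (𝟙 (S u)) (𝟙 (not (S v))) (N⁻ u v) (𝟙 (S v)) ⟩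
          2ℚ * β * Δ * Q ℓ u v * (𝟙 (S u) * 𝟙 (not (S v))) + β * N⁻ u v * (𝟙 (S u) * 𝟙 (S v))
            ≡⟨ cong₂ (λ x y → 2ℚ * β * Δ * Q ℓ u v * x + β * N⁻ u v * y) (posDiff-𝟙 (S u) (S v)) (⊓-𝟙 (S u) (S v)) ⟨
          2ℚ * β * Δ * Q ℓ u v * posDiff (𝟙 (S u)) (𝟙 (S v)) + β * N⁻ u v * (𝟙 (S u) ⊓ 𝟙 (S v))
            ∎

  -- Assembling a labelling from successive clusters

  mixed : ℚ → ℚ → Bool → ℚ
  mixed p n e = p * 𝟙 (not e) + n * 𝟙 e

  bad : ∀ {k} → (Fin N → Fin k) → Fin N → Fin N → ℚ
  bad c u v = mixed (𝟙 (pos u v)) (N⁻ u v) (does (c u Fin.≟ c v))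

  badWithin : ∀ {k} → (Fin N → Bool) → (Fin N → Fin k) → ℚ
  badWithin H c = sum₂ (λ u v → 𝟙 (H u) * (𝟙 (H v) * bad c u v))

  -- The invariant of the recursion: clusters are charged to their nodes at 10 Δ each, the final
  -- remainder once at 16 Δ N.
  Labelling : (Fin N → Bool) → Set
  Labelling H = ∃[ k ] Σ[ c ∈ (Fin N → Fin k) ] β * badWithin H c ≤ fromℕ 10 * Δ * size H + fromℕ 16 * Δ * 𝑁

  -- With at most N/(2m) nodes left, even all their edges cost no more than the final charge; 16 is
  -- half of the 32 in β.
  singletons : ∀ H → 2ℚ * ν * size H ≤ 𝑁 → Labelling H
  singletons H small = N , id , (begin
    β * badWithin H id
      ≤⟨ *-monoˡ-≤ 0≤β (sum-mono-≤ row) ⟩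
    β * sum (λ u → 𝟙 (H u) * Δ)
      ≡⟨ cong (β *_) (sum-*ʳ Δ (λ u → 𝟙 (H u))) ⟩
    β * (size H * Δ)
      ≡⟨ cong (_* (size H * Δ)) β≡32ν ⟩
    fromℕ 32 * ν * (size H * Δ)
      ≡⟨ solve 3 (λ n h D → :ℕ 32 :* n :* (h :* D) := :ℕ 16 :* D :* (:2 :* n :* h)) refl ν (size H) Δ ⟩
    fromℕ 16 * Δ * (2ℚ * ν * size H)
      ≤⟨ *-monoˡ-≤ (*-nonneg (fromℕ-nonneg 16) 0≤Δ) small ⟩
    fromℕ 16 * Δ * 𝑁
      ≤⟨ ≤-by (fromℕ 10 * Δ * size H) (*-nonneg (*-nonneg (fromℕ-nonneg 10) 0≤Δ) (sum-nonneg (λ u → 𝟙-nonneg (H u)))) (ℚ.+-comm (fromℕ 10 * Δ * size H) (fromℕ 16 * Δ * 𝑁)) ⟩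
    fromℕ 10 * Δ * size H + fromℕ 16 * Δ * 𝑁
      ∎)
    where
    open ℚ.≤-Reasoning
    bad≤ : ∀ x y h e → 𝟙 h * (𝟙 x * 𝟙 (not e) + 𝟙 y * 𝟙 e) ≤ 𝟙 x + 𝟙 y
    bad≤ x y true true = ≤-by (𝟙 x) (𝟙-nonneg x) (solve 2 (λ x y → x :+ y := :1 :* (x :* :0 :+ y :* :1) :+ x) refl (𝟙 x) (𝟙 y))
    bad≤ x y true false = ≤-by (𝟙 y) (𝟙-nonneg y) (solve 2 (λ x y → x :+ y := :1 :* (x :* :1 :+ y :* :0) :+ y) refl (𝟙 x) (𝟙 y))
    bad≤ x y false e = ≤-by (𝟙 x + 𝟙 y) (+-nonneg (𝟙-nonneg x) (𝟙-nonneg y)) (solve 3 (λ x y z → x :+ y := :0 :* z :+ (x :+ y)) refl (𝟙 x) (𝟙 y) (𝟙 x * 𝟙 (not e) + 𝟙 y * 𝟙 e))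
    row : ∀ u → sum (λ v → 𝟙 (H u) * (𝟙 (H v) * bad id u v)) ≤ 𝟙 (H u) * Δ
    row u = begin
      sum (λ v → 𝟙 (H u) * (𝟙 (H v) * bad id u v))  ≤⟨ sum-mono-≤ (λ v → *-monoˡ-≤ (𝟙-nonneg (H u)) (bad≤ (pos u v) (neg u v) (H v) (does (u Fin.≟ v)))) ⟩
      sum (λ v → 𝟙 (H u) * (𝟙 (pos u v) + N⁻ u v))  ≡⟨ sum-*ˡ (𝟙 (H u)) (λ v → 𝟙 (pos u v) + N⁻ u v) ⟩
      𝟙 (H u) * sum (λ v → 𝟙 (pos u v) + N⁻ u v)  ≤⟨ *-monoˡ-≤ (𝟙-nonneg (H u)) (degree≤d u) ⟩
      𝟙 (H u) * Δ  ∎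

  glue : ∀ {k} → Bool → Fin k → Fin (suc k)
  glue x i = if x then zero else suc i

  -- A pair in H leaves S, lies within S, enters S or lies within the rest, and the four summands
  -- are these cases. The fresh label `zero` makes cut positive edges and inner negative edges the
  -- only new errors.
  bad-glue : ∀ {k} x y hᵤ hᵥ (p n : ℚ) (i j : Fin k) → (x ≡ true → hᵤ ≡ true) → (y ≡ true → hᵥ ≡ true) →
    𝟙 hᵤ * (𝟙 hᵥ * mixed p n (does (glue x i Fin.≟ glue y j))) ≡
    ((𝟙 x * (p * 𝟙 (hᵥ ∧ not y)) + 𝟙 x * (n * 𝟙 y)) + 𝟙 y * (p * 𝟙 (hᵤ ∧ not x))) +
    𝟙 (hᵤ ∧ not x) * (𝟙 (hᵥ ∧ not y) * mixed p n (does (i Fin.≟ j)))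
  bad-glue true  y     false hᵥ    p n i j hx hy = contradiction (hx refl) λ ()
  bad-glue x     true  hᵤ    false p n i j hx hy = contradiction (hy refl) λ ()
  bad-glue true  true  true  true  p n i j hx hy = solve 3 (λ p n z → :1 :* (:1 :* (p :* :0 :+ n :* :1)) := ((:1 :* (p :* :0) :+ :1 :* (n :* :1)) :+ :1 :* (p :* :0)) :+ :0 :* (:0 :* z)) refl p n (mixed p n (does (i Fin.≟ j)))
  bad-glue true  false true  true  p n i j hx hy = solve 3 (λ p n z → :1 :* (:1 :* (p :* :1 :+ n :* :0)) := ((:1 :* (p :* :1) :+ :1 :* (n :* :0)) :+ :0 :* (p :* :0)) :+ :0 :* (:1 :* z)) refl p n (mixed p n (does (i Fin.≟ j)))
  bad-glue true  false true  false p n i j hx hy = solve 3 (λ p n z → :1 :* (:0 :* (p :* :1 :+ n :* :0)) := ((:1 :* (p :* :0) :+ :1 :* (n :* :0)) :+ :0 :* (p :* :0)) :+ :0 :* (:0 :* z)) refl p n (mixed p n (does (i Fin.≟ j)))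
  bad-glue false true  true  true  p n i j hx hy = solve 3 (λ p n z → :1 :* (:1 :* (p :* :1 :+ n :* :0)) := ((:0 :* (p :* :0) :+ :0 :* (n :* :1)) :+ :1 :* (p :* :1)) :+ :1 :* (:0 :* z)) refl p n (mixed p n (does (i Fin.≟ j)))
  bad-glue false true  false true  p n i j hx hy = solve 3 (λ p n z → :0 :* (:1 :* (p :* :1 :+ n :* :0)) := ((:0 :* (p :* :0) :+ :0 :* (n :* :1)) :+ :1 :* (p :* :0)) :+ :0 :* (:0 :* z)) refl p n (mixed p n (does (i Fin.≟ j)))
  bad-glue false false true  true  p n i j hx hy = solve 3 (λ p n z → :1 :* (:1 :* z) := ((:0 :* (p :* :1) :+ :0 :* (n :* :0)) :+ :0 :* (p :* :1)) :+ :1 :* (:1 :* z)) refl p n (mixed p n (does (i Fin.≟ j)))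
  bad-glue false false true  false p n i j hx hy = solve 3 (λ p n z → :1 :* (:0 :* z) := ((:0 :* (p :* :0) :+ :0 :* (n :* :0)) :+ :0 :* (p :* :1)) :+ :1 :* (:0 :* z)) refl p n (mixed p n (does (i Fin.≟ j)))
  bad-glue false false false true  p n i j hx hy = solve 3 (λ p n z → :0 :* (:1 :* z) := ((:0 :* (p :* :1) :+ :0 :* (n :* :0)) :+ :0 :* (p :* :0)) :+ :0 :* (:1 :* z)) refl p n (mixed p n (does (i Fin.≟ j)))
  bad-glue false false false false p n i j hx hy = solve 3 (λ p n z → :0 :* (:0 :* z) := ((:0 :* (p :* :0) :+ :0 :* (n :* :0)) :+ :0 :* (p :* :0)) :+ :0 :* (:0 :* z)) refl p n (mixed p n (does (i Fin.≟ j)))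

  extend : ∀ H (C : Cluster H) → Labelling (remaining H (proj₁ C)) → Labelling H
  extend H (S , S⊆H , cheap) (k , c , few) = suc k , c′ , (begin
    β * badWithin H c′
      ≡⟨ cong (β *_) split-bad ⟩
    β * (sum₂ (removal H S) + badWithin R c)
      ≡⟨ ℚ.*-distribˡ-+ β (sum₂ (removal H S)) (badWithin R c) ⟩
    β * sum₂ (removal H S) + β * badWithin R c
      ≤⟨ ℚ.+-mono-≤ (ℚ.<⇒≤ cheap) few ⟩
    fromℕ 10 * Δ * size S + (fromℕ 10 * Δ * size R + fromℕ 16 * Δ * 𝑁)
      ≡⟨ solve 4 (λ c s r e → c :* s :+ (c :* r :+ e) := c :* (s :+ r) :+ e) refl (fromℕ 10 * Δ) (size S) (size R) (fromℕ 16 * Δ * 𝑁) ⟩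
    fromℕ 10 * Δ * (size S + size R) + fromℕ 16 * Δ * 𝑁
      ≡⟨ cong (λ x → fromℕ 10 * Δ * x + fromℕ 16 * Δ * 𝑁) (trans (sum-cong-≗ {N} (λ u → partition (S u) (H u) (S⊆H u))) (∑-distrib-+ (λ u → 𝟙 (S u)) (λ u → 𝟙 (R u)))) ⟨
    fromℕ 10 * Δ * size H + fromℕ 16 * Δ * 𝑁
      ∎)
    where
    open ℚ.≤-Reasoning
    R : Fin N → Bool
    R = remaining H S
    c′ : Fin N → Fin (suc k)
    c′ u = glue (S u) (c u)
    cut within cut′ : Fin N → Fin N → ℚ
    cut u v = 𝟙 (S u) * (𝟙 (pos u v) * 𝟙 (R v))
    within u v = 𝟙 (S u) * (N⁻ u v * 𝟙 (S v))
    cut′ u v = 𝟙 (S v) * (𝟙 (pos u v) * 𝟙 (R u))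
    partition : ∀ x h → (x ≡ true → h ≡ true) → 𝟙 h ≡ 𝟙 x + 𝟙 (h ∧ not x)
    partition true  true  _ = refl
    partition true  false p = contradiction (p refl) λ ()
    partition false true  _ = refl
    partition false false _ = refl
    badR : Fin N → Fin N → ℚ
    badR u v = 𝟙 (R u) * (𝟙 (R v) * bad c u v)
    cut′≡cut : sum₂ cut′ ≡ sum₂ cut
    cut′≡cut = trans (∑-comm cut′) (sum₂-cong (λ u v → cong (λ x → 𝟙 (S u) * (𝟙 x * 𝟙 (R v))) (pos-sym v u)))
    split-bad : badWithin H c′ ≡ sum₂ (removal H S) + badWithin R c
    split-bad = begin-equality
      badWithin H c′
        ≡⟨ sum₂-cong (λ u v → bad-glue (S u) (S v) (H u) (H v) (𝟙 (pos u v)) (N⁻ u v) (c u) (c v) (S⊆H u) (S⊆H v)) ⟩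
      sum₂ (λ u v → ((cut u v + within u v) + cut′ u v) + badR u v)
        ≡⟨ sum₂-+ (λ u v → (cut u v + within u v) + cut′ u v) badR ⟩
      sum₂ (λ u v → (cut u v + within u v) + cut′ u v) + badWithin R c
        ≡⟨ cong (_+ badWithin R c) (trans (sum₂-+ (λ u v → cut u v + within u v) cut′) (cong (sum₂ (λ u v → cut u v + within u v) +_) cut′≡cut)) ⟩
      (sum₂ (λ u v → cut u v + within u v) + sum₂ cut) + badWithin R c
        ≡⟨ cong (_+ badWithin R c) (sum₂-+ (λ u v → cut u v + within u v) cut) ⟨
      sum₂ (λ u v → (cut u v + within u v) + cut u v) + badWithin R c
        ≡⟨ cong (_+ badWithin R c) (sum₂-cong (λ u v → solve 2 (λ x y → (x :+ y) :+ x := :2 :* x :+ y) refl (cut u v) (within u v))) ⟩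
      sum₂ (removal H S) + badWithin R c
        ∎

  -- The inequality in `Cluster` is strict and its right side vanishes for empty `S`. Termination of
  -- the clustering rests on this.
  cluster-nonempty : ∀ H (C : Cluster H) → ∃[ u ] proj₁ C u ≡ true
  cluster-nonempty H (S , _ , cheap) = byDec (Fin.any? (λ u → S u Bool.≟ true)) id
    (λ ∄ → contradiction cheap (λ h → ℚ.<-irrefl refl (ℚ.≤-<-trans 0≤lhs (subst (λ x → β * sum₂ (removal H S) < x) (empty (λ u → ¬-not (λ u∈S → ∄ (u , u∈S)))) h))))
    where
    empty : (∀ u → S u ≡ false) → fromℕ 10 * Δ * size S ≡ 0ℚ
    empty S≡∅ = trans (cong (fromℕ 10 * Δ *_) (trans (sum-cong-≗ {N} (λ u → cong 𝟙 (S≡∅ u))) (sum-0 {N}))) (ℚ.*-zeroʳ (fromℕ 10 * Δ))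
    0≤lhs : 0ℚ ≤ β * sum₂ (removal H S)
    0≤lhs = *-nonneg 0≤β (sum₂-nonneg (λ u v → +-nonneg
      (*-nonneg 0≤2 (*-nonneg (𝟙-nonneg (S u)) (*-nonneg (𝟙-nonneg (pos u v)) (𝟙-nonneg (remaining H S v)))))
      (*-nonneg (𝟙-nonneg (S u)) (*-nonneg (𝟙-nonneg (neg u v)) (𝟙-nonneg (S v))))))

  remaining-smaller : ∀ H (C : Cluster H) → count (remaining H (proj₁ C)) ℕ.< count H
  remaining-smaller H C@(S , S⊆H , _) =
    let u , u∈S = cluster-nonempty H C
    in count-mono-< (λ v → ∧-true (H v) (not (S v))) u (trans (cong (λ x → H u ∧ not x) u∈S) (∧-false (H u))) (S⊆H u u∈S)
    where
    ∧-true : ∀ x y → x ∧ y ≡ true → x ≡ true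
    ∧-true true _ _ = refl
    ∧-false : ∀ x → x ∧ false ≡ false
    ∧-false true  = refl
    ∧-false false = refl

  module _ (Det : Fin N → ℚ) (0≤Det : ∀ s → 0ℚ ≤ Det s)
    (detects : ∀ H s t → H s ≡ true → t ℕ.< T →
               1ℚ ≤ fromℕ 4 * 𝑁 * (blend H s t · blend H s t) →
               Δ * (blend H s t · blend H s t) ≤ fromℕ 16 * ν * conflict H s t →
               1ℚ ≤ 2ℚ * Det s)
    (rare : fromℕ 8 * ν * sum Det < 𝑁) where

    -- A single average meets both demands. Over H the detection probabilities sum to less than
    -- N/(8m), and the mass lost until `T` to at most N/(8m) because ℓ = 8 m T. Twice their total is
    -- below N/(2m), hence below the size of H.
    good-start : ∀ H → 𝑁 < 2ℚ * ν * size H → ∃[ s ] H s ≡ true × 2ℚ * Det s < 1ℚ × 1ℚ ≤ 2ℚ * mass H s T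
    good-start H large =
      let s , f<in = sum-<⇒∃< f inside Σf<Σin
          s∈H = ¬-not (λ s∉H → ℚ.<-irrefl (trans (f-outside s s∉H) (sym (cong 𝟙 s∉H))) f<in)
      in s , s∈H , conclude s s∈H f<in
      where
      open WatchedChain P P-sym P-nonneg P-row H using (inside; inside-nonneg; escape; survival; sum-escape)
      open ℚ.≤-Reasoning
      f : Fin N → ℚ
      f s = 2ℚ * (inside s * Det s) + 2ℚ * (inside s * inside s - inside s * mass H s T)
      -- Outside H both `f` and `inside` vanish, so an index with `f` strictly below `inside` lies
      -- in H.
      f-outside : ∀ s → H s ≡ false → f s ≡ 0ℚ
      f-outside s s∉H = trans (cong (λ x → 2ℚ * (𝟙 x * Det s) + 2ℚ * (𝟙 x * 𝟙 x - 𝟙 x * mass H s T)) s∉H)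
        (solve 2 (λ x y → :2 :* (:0 :* x) :+ :2 :* (:0 :* :0 :- :0 :* y) := :0) refl (Det s) (mass H s T))
      conclude : ∀ s → H s ≡ true → f s < inside s → 2ℚ * Det s < 1ℚ × 1ℚ ≤ 2ℚ * mass H s T
      conclude s s∈H f<in = ℚ.≤-<-trans (≤-by (2ℚ * (1ℚ - mass H s T)) (*-nonneg 0≤2 (p≤q⇒0≤q-p mass≤1)) refl) h
        , ℚ.<⇒≤ (begin-strict
            1ℚ  ≡⟨ solve 1 (λ y → :1 := :2 :* y :+ (:2 :* (:1 :- y) :- :1)) refl (mass H s T) ⟩
            2ℚ * mass H s T + (2ℚ * (1ℚ - mass H s T) - 1ℚ)  <⟨ ℚ.+-monoʳ-< (2ℚ * mass H s T) (ℚ.+-monoˡ-< (- 1ℚ) lost<1) ⟩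
            2ℚ * mass H s T + (1ℚ - 1ℚ)  ≡⟨ ℚ.+-identityʳ (2ℚ * mass H s T) ⟩
            2ℚ * mass H s T  ∎)
        where
        mass≤1 : mass H s T ≤ 1ℚ
        mass≤1 = ℚ.≤-trans (mass-antitone H s {0} {T} ℕ.z≤n) (𝟙≤1 (H s))
        h : 2ℚ * Det s + 2ℚ * (1ℚ - mass H s T) < 1ℚ
        h = subst₂ _<_ (trans (cong (λ x → 2ℚ * (𝟙 x * Det s) + 2ℚ * (𝟙 x * 𝟙 x - 𝟙 x * mass H s T)) s∈H)
          (solve 2 (λ x y → :2 :* (:1 :* x) :+ :2 :* (:1 :* :1 :- :1 :* y) := :2 :* x :+ :2 :* (:1 :- y)) refl (Det s) (mass H s T))) (cong 𝟙 s∈H) f<in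
        lost<1 : 2ℚ * (1ℚ - mass H s T) < 1ℚ
        lost<1 = ℚ.≤-<-trans (≤-by (2ℚ * Det s) (*-nonneg 0≤2 (0≤Det s)) (ℚ.+-comm (2ℚ * Det s) (2ℚ * (1ℚ - mass H s T)))) h
      Σf : sum f ≡ 2ℚ * (inside · Det) + 2ℚ * (inside · inside - inside · (λ s → mass H s T))
      Σf = trans (∑-distrib-+ (λ s → 2ℚ * (inside s * Det s)) (λ s → 2ℚ * (inside s * inside s - inside s * mass H s T)))
        (cong₂ _+_ (sum-*ˡ 2ℚ (λ s → inside s * Det s)) (trans (sum-*ˡ 2ℚ (λ s → inside s * inside s - inside s * mass H s T)) (cong (2ℚ *_) (sum-- (λ s → inside s * inside s) (λ s → inside s * mass H s T)))))
      τ E : ℚ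
      τ = fromℕ T
      E = sum (escape ℓ)
      lost : inside · inside - inside · (λ s → mass H s T) ≤ τ * E
      lost = begin
        inside · inside - inside · (λ s → mass H s T)  ≤⟨ ℚ.+-monoˡ-≤ (- (inside · (λ s → mass H s T))) (survival ℓ T) ⟩
        inside · (λ s → mass H s T) + τ * E - inside · (λ s → mass H s T)  ≡⟨ solve 2 (λ x y → x :+ y :- x := y) refl (inside · (λ s → mass H s T)) (τ * E) ⟩
        τ * E  ∎
      in·Det≤ : inside · Det ≤ sum Det
      in·Det≤ = sum-mono-≤ (λ s → subst (inside s * Det s ≤_) (ℚ.*-identityˡ (Det s)) (*-monoʳ-≤ (0≤Det s) (𝟙≤1 (H s))))
      fromℕ-ℓ : fromℕ ℓ ≡ fromℕ 8 * ν * τ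
      fromℕ-ℓ = trans (fromℕ-* (8 ℕ.* m) T) (cong (_* τ) (fromℕ-* 8 m))
      Σf<Σin : sum f < sum inside
      Σf<Σin = ℚ.*-cancelˡ-<-nonNeg (fromℕ 8 * ν) {{ℚ.nonNegative (*-nonneg (fromℕ-nonneg 8) 0≤ν)}} (begin-strict
        fromℕ 8 * ν * sum f
          ≡⟨ cong (fromℕ 8 * ν *_) Σf ⟩
        fromℕ 8 * ν * (2ℚ * (inside · Det) + 2ℚ * (inside · inside - inside · (λ s → mass H s T)))
          ≤⟨ *-monoˡ-≤ (*-nonneg (fromℕ-nonneg 8) 0≤ν) (ℚ.+-mono-≤ (*-monoˡ-≤ 0≤2 in·Det≤) (*-monoˡ-≤ 0≤2 lost)) ⟩
        fromℕ 8 * ν * (2ℚ * sum Det + 2ℚ * (τ * E))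
          ≡⟨ solve 4 (λ n x t e → :ℕ 8 :* n :* (:2 :* x :+ :2 :* (t :* e)) := :2 :* (:ℕ 8 :* n :* x) :+ :2 :* (:ℕ 8 :* n :* t :* e)) refl ν (sum Det) τ E ⟩
        2ℚ * (fromℕ 8 * ν * sum Det) + 2ℚ * (fromℕ 8 * ν * τ * E)
          <⟨ ℚ.+-mono-<-≤ (*-monoˡ-< {2ℚ} 0<2 rare) (*-monoˡ-≤ 0≤2 (subst (λ x → x * E ≤ 𝑁) fromℕ-ℓ (sum-escape ℓ))) ⟩
        2ℚ * 𝑁 + 2ℚ * 𝑁
          ≤⟨ ℚ.+-mono-≤ (*-monoˡ-≤ 0≤2 (ℚ.<⇒≤ large)) (*-monoˡ-≤ 0≤2 (ℚ.<⇒≤ large)) ⟩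
        2ℚ * (2ℚ * ν * size H) + 2ℚ * (2ℚ * ν * size H)
          ≡⟨ solve 2 (λ n x → :2 :* (:2 :* n :* x) :+ :2 :* (:2 :* n :* x) := :ℕ 8 :* n :* x) refl ν (size H) ⟩
        fromℕ 8 * ν * sum inside
          ∎)

    find-cluster : ∀ H → 𝑁 < 2ℚ * ν * size H → Cluster H
    find-cluster H large =
      let s , s∈H , undetected , survives = good-start H large
          t , t<T , spread , slow-t = slow H s survives
      in byDec (fromℕ 16 * ν * conflict H s t ℚ.<? Δ * (blend H s t · blend H s t))
           (cluster H s t s∈H slow-t)
           (λ ¬few → contradiction undetected (λ h → ℚ.<-irrefl refl (ℚ.<-≤-trans h (detects H s t s∈H t<T spread (ℚ.≮⇒≥ ¬few)))))

    labelling : ∀ j H → count H ℕ.≤ j → Labelling H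
    labelling j H size≤ = byDec (𝑁 ℚ.<? 2ℚ * ν * size H) (λ large → descend j size≤ (find-cluster H large)) (λ ¬large → singletons H (ℚ.≮⇒≥ ¬large))
      where
      descend : ∀ j → count H ℕ.≤ j → Cluster H → Labelling H
      descend zero    size≤ C = contradiction (ℕ.<-≤-trans (remaining-smaller H C) size≤) λ ()
      descend (suc j) size≤ C = extend H C (labelling j (remaining H (proj₁ C)) (ℕ.s≤s⁻¹ (ℕ.≤-trans (remaining-smaller H C) size≤)))

    good-labelling : ∃[ k ] Σ[ c ∈ (Fin N → Fin k) ] β * sum₂ (bad c) ≤ fromℕ 26 * Δ * 𝑁
    good-labelling =
      let k , c , few = labelling (count {N} (λ _ → true)) (λ _ → true) ℕ.≤-refl
      in k , c , (begin
        β * sum₂ (bad c)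
          ≡⟨ cong (β *_) (sum₂-cong (λ u v → sym (trans (ℚ.*-identityˡ (1ℚ * bad c u v)) (ℚ.*-identityˡ (bad c u v))))) ⟩
        β * badWithin (λ _ → true) c
          ≤⟨ few ⟩
        fromℕ 10 * Δ * size (λ _ → true) + fromℕ 16 * Δ * 𝑁
          ≡⟨ cong (λ x → fromℕ 10 * Δ * x + fromℕ 16 * Δ * 𝑁) (trans (sum-const N 1ℚ) (ℚ.*-identityʳ 𝑁)) ⟩
        fromℕ 10 * Δ * 𝑁 + fromℕ 16 * Δ * 𝑁
          ≡⟨ solve 2 (λ D n → :ℕ 10 :* D :* n :+ :ℕ 16 :* D :* n := :ℕ 26 :* D :* n) refl Δ 𝑁 ⟩
        fromℕ 26 * Δ * 𝑁
          ∎)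
      where open ℚ.≤-Reasoning


-- Expectations, sure events and query counts of programs

1/ : (n : ℕ) → .{{NonZero n}} → ℚ
1/ n = (ℤ.+ 1) ℚ./ n

1/-nonneg : ∀ n .{{_ : NonZero n}} → 0ℚ ≤ 1/ n
1/-nonneg n = ℚ.nonNegative⁻¹ (1/ n) {{ℚ.normalize-nonNeg 1 n}}

1/-inverse : ∀ n .{{_ : NonZero n}} → 1/ n * fromℕ n ≡ 1ℚ
1/-inverse (suc n) = ℚ.toℚᵘ-injective (begin
  ℚ.toℚᵘ (1/ (suc n) * fromℕ (suc n))  ≈⟨ ℚ.toℚᵘ-homo-* (1/ (suc n)) (fromℕ (suc n)) ⟩
  ℚ.toℚᵘ (1/ (suc n)) ℚᵘ.* ℚ.toℚᵘ (fromℕ (suc n))  ≈⟨ ℚᵘ.*-cong (ℚ.toℚᵘ-fromℚᵘ (mkℚᵘ (ℤ.+ 1) n)) (ℚ.toℚᵘ-fromℚᵘ (mkℚᵘ (ℤ.+ (suc n)) 0)) ⟩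
  mkℚᵘ (ℤ.+ 1) n ℚᵘ.* mkℚᵘ (ℤ.+ (suc n)) 0  ≈⟨ ℚᵘ.*≡* (cong (λ x → ℤ.+ x) (trans (ℕ.*-identityʳ (suc n ℕ.+ 0)) (cong (ℕ._+ 0) (sym (ℕ.*-identityʳ (suc n)))))) ⟩
  ℚ.toℚᵘ 1ℚ  ∎)
  where open import Relation.Binary.Reasoning.Setoid ℚᵘ.≃-setoid

1/-average : ∀ n .{{_ : NonZero n}} c → 1/ n * sum {n} (λ _ → c) ≡ c
1/-average n c = begin
  1/ n * sum {n} (λ _ → c)  ≡⟨ cong (1/ n *_) (sum-const n c) ⟩
  1/ n * (fromℕ n * c)  ≡⟨ ℚ.*-assoc (1/ n) (fromℕ n) c ⟨
  1/ n * fromℕ n * c  ≡⟨ cong (_* c) (1/-inverse n) ⟩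
  1ℚ * c  ≡⟨ ℚ.*-identityˡ c ⟩
  c  ∎
  where open ≡-Reasoning

module Semantics {N d : ℕ} (O : Oracle N d) where

  private
    variable
      A B : Set

  -- Extends `Pr` from events to rational observables, as second moments require.
  𝔼 : (A → ℚ) → Program N d A → ℚ
  𝔼 f (return x)    = f x
  𝔼 f (query v i k) = 𝔼 f (k (O v i))
  𝔼 f (uniform n k) = 1/ n * sum (λ j → 𝔼 f (k j))

  Pr≡𝔼 : ∀ (E : A → Bool) p → Pr O E p ≡ 𝔼 (λ x → 𝟙 (E x)) p
  Pr≡𝔼 E (return x)    = refl
  Pr≡𝔼 E (query v i k) = Pr≡𝔼 E (k (O v i))
  Pr≡𝔼 E (uniform n k) = cong (1/ n *_) (sum-cong-≗ {n} (λ j → Pr≡𝔼 E (k j)))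

  𝔼->>= : ∀ (f : B → ℚ) (p : Program N d A) k → 𝔼 f (p >>= k) ≡ 𝔼 (λ x → 𝔼 f (k x)) p
  𝔼->>= f (return x)    k = refl
  𝔼->>= f (query v i l) k = 𝔼->>= f (l (O v i)) k
  𝔼->>= f (uniform n l) k = cong (1/ n *_) (sum-cong-≗ {n} (λ j → 𝔼->>= f (l j) k))

  -- Quantifies over all random choices but follows only the true answers of the oracle, so facts
  -- about the graph can enter.
  Always : (A → Set) → Program N d A → Set
  Always E (return x)    = E x
  Always E (query v i k) = Always E (k (O v i))
  Always E (uniform n k) = ∀ j → Always E (k j)

  always : {E : A → Set} → (∀ x → E x) → ∀ p → Always E p
  always e (return x)    = e x
  always e (query v i k) = always e (k (O v i))
  always e (uniform n k) = λ j → always e (k j)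

  always-map : {E F : A → Set} → (∀ x → E x → F x) → ∀ p → Always E p → Always F p
  always-map e (return x)    h = e x h
  always-map e (query v i k) h = always-map e (k (O v i)) h
  always-map e (uniform n k) h = λ j → always-map e (k j) (h j)

  always->>= : {E : B → Set} (p : Program N d A) {k : A → Program N d B} →
               Always (λ x → Always E (k x)) p → Always E (p >>= k)
  always->>= (return x)    h = h
  always->>= (query v i l) h = always->>= (l (O v i)) h
  always->>= (uniform n l) h = λ j → always->>= (l j) (h j)

  𝔼-mono-always : ∀ {f g : A → ℚ} p → Always (λ x → f x ≤ g x) p → 𝔼 f p ≤ 𝔼 g p
  𝔼-mono-always (return x)    h = h
  𝔼-mono-always (query v i k) h = 𝔼-mono-always (k (O v i)) h
  𝔼-mono-always (uniform n k) h = *-monoˡ-≤ (1/-nonneg n) (sum-mono-≤ (λ j → 𝔼-mono-always (k j) (h j)))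

  𝔼-mono : ∀ {f g : A → ℚ} → (∀ x → f x ≤ g x) → ∀ p → 𝔼 f p ≤ 𝔼 g p
  𝔼-mono f≤g p = 𝔼-mono-always p (always f≤g p)

  𝔼-cong-always : ∀ {f g : A → ℚ} p → Always (λ x → f x ≡ g x) p → 𝔼 f p ≡ 𝔼 g p
  𝔼-cong-always (return x)    h = h
  𝔼-cong-always (query v i k) h = 𝔼-cong-always (k (O v i)) h
  𝔼-cong-always (uniform n k) h = cong (1/ n *_) (sum-cong-≗ {n} (λ j → 𝔼-cong-always (k j) (h j)))

  𝔼-cong : ∀ {f g : A → ℚ} → (∀ x → f x ≡ g x) → ∀ p → 𝔼 f p ≡ 𝔼 g p
  𝔼-cong f≗g p = 𝔼-cong-always p (always f≗g p)

  𝔼-const : ∀ c (p : Program N d A) → 𝔼 (λ _ → c) p ≡ c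
  𝔼-const c (return x)    = refl
  𝔼-const c (query v i k) = 𝔼-const c (k (O v i))
  𝔼-const c (uniform n k) = trans (cong (1/ n *_) (sum-cong-≗ {n} (λ j → 𝔼-const c (k j)))) (1/-average n c)

  𝔼-nonneg : ∀ {f : A → ℚ} → (∀ x → 0ℚ ≤ f x) → ∀ p → 0ℚ ≤ 𝔼 f p
  𝔼-nonneg {f = f} 0≤f p = subst (_≤ 𝔼 f p) (𝔼-const 0ℚ p) (𝔼-mono 0≤f p)

  𝔼-+ : ∀ (f g : A → ℚ) p → 𝔼 (λ x → f x + g x) p ≡ 𝔼 f p + 𝔼 g p
  𝔼-+ f g (return x)    = refl
  𝔼-+ f g (query v i k) = 𝔼-+ f g (k (O v i))
  𝔼-+ f g (uniform n k) = begin
    1/ n * sum (λ j → 𝔼 (λ x → f x + g x) (k j))  ≡⟨ cong (1/ n *_) (trans (sum-cong-≗ {n} (λ j → 𝔼-+ f g (k j))) (∑-distrib-+ (λ j → 𝔼 f (k j)) (λ j → 𝔼 g (k j)))) ⟩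
    1/ n * (sum (λ j → 𝔼 f (k j)) + sum (λ j → 𝔼 g (k j)))  ≡⟨ ℚ.*-distribˡ-+ (1/ n) (sum (λ j → 𝔼 f (k j))) (sum (λ j → 𝔼 g (k j))) ⟩
    𝔼 f (uniform n k) + 𝔼 g (uniform n k)  ∎
    where open ≡-Reasoning

  𝔼-* : ∀ c (f : A → ℚ) p → 𝔼 (λ x → c * f x) p ≡ c * 𝔼 f p
  𝔼-* c f (return x)    = refl
  𝔼-* c f (query v i k) = 𝔼-* c f (k (O v i))
  𝔼-* c f (uniform n k) = begin
    1/ n * sum (λ j → 𝔼 (λ x → c * f x) (k j))  ≡⟨ cong (1/ n *_) (trans (sum-cong-≗ {n} (λ j → 𝔼-* c f (k j))) (sum-*ˡ c (λ j → 𝔼 f (k j)))) ⟩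
    1/ n * (c * sum (λ j → 𝔼 f (k j)))  ≡⟨ solve 3 (λ x c s → x :* (c :* s) := c :* (x :* s)) refl (1/ n) c (sum (λ j → 𝔼 f (k j))) ⟩
    c * 𝔼 f (uniform n k)  ∎
    where open ≡-Reasoning

  𝔼-- : ∀ (f g : A → ℚ) p → 𝔼 (λ x → f x - g x) p ≡ 𝔼 f p - 𝔼 g p
  𝔼-- f g p = begin
    𝔼 (λ x → f x - g x) p  ≡⟨ 𝔼-cong (λ x → solve 2 (λ x y → x :- y := x :+ con (- 1ℚ) :* y) refl (f x) (g x)) p ⟩
    𝔼 (λ x → f x + - 1ℚ * g x) p  ≡⟨ trans (𝔼-+ f (λ x → - 1ℚ * g x) p) (cong (𝔼 f p +_) (𝔼-* (- 1ℚ) g p)) ⟩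
    𝔼 f p + - 1ℚ * 𝔼 g p  ≡⟨ solve 2 (λ x y → x :+ con (- 1ℚ) :* y := x :- y) refl (𝔼 f p) (𝔼 g p) ⟩
    𝔼 f p - 𝔼 g p  ∎
    where open ≡-Reasoning

  𝔼-sum : ∀ {n} (f : Fin n → A → ℚ) p → 𝔼 (λ x → sum (λ i → f i x)) p ≡ sum (λ i → 𝔼 (f i) p)
  𝔼-sum {n = zero}  f p = 𝔼-const 0ℚ p
  𝔼-sum {n = suc n} f p = trans (𝔼-+ (f zero) (λ x → sum (λ i → f (suc i) x)) p) (cong (𝔼 (f zero) p +_) (𝔼-sum (f ∘ suc) p))

  always-mapM : {E : B → Set} {g : A → Program N d B} → (∀ x → Always E (g x)) →
                ∀ xs → Always (All E) (mapM g xs)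
  always-mapM {E = E} {g} e [] = []
  always-mapM {E = E} {g} e (x ∷ xs) = always->>= (g x) (always-map (λ y Ey →
    always->>= (mapM g xs) (always-map (λ ys Eys → Ey ∷ Eys) (mapM g xs) (always-mapM e xs))) (g x) (e x))

  always-mapM-≡ : {g : A → Program N d B} {h : A → B} → (∀ x → Always (_≡ h x) (g x)) →
                  ∀ xs → Always (_≡ List.map h xs) (mapM g xs)
  always-mapM-≡ e [] = refl
  always-mapM-≡ {g = g} e (x ∷ xs) = always->>= (g x) (always-map (λ y y≡ →
    always->>= (mapM g xs) (always-map (λ ys ys≡ → cong₂ _∷_ y≡ ys≡) (mapM g xs) (always-mapM-≡ e xs))) (g x) (e x))

  always-replicateM : {E : A → Set} → ∀ n p → Always E p → Always (λ xs → length xs ≡ n × All E xs) (replicateM n p)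
  always-replicateM zero p e = refl , []
  always-replicateM (suc n) p e = always->>= p (always-map (λ y Ey →
    always->>= (replicateM n p) (always-map (λ ys (len , Eys) → cong suc len , Ey ∷ Eys) (replicateM n p) (always-replicateM n p e))) p e)

  max≤ : ∀ {n} (f : Fin n → ℕ) b → (∀ j → f j ℕ.≤ b) → Data.Vec.Functional.foldr ℕ._⊔_ 0 f ℕ.≤ b
  max≤ {zero}  f b h = ℕ.z≤n
  max≤ {suc n} f b h = ℕ.⊔-lub (h zero) (max≤ (f ∘ suc) b (h ∘ suc))

  ≤max : ∀ {n} (f : Fin n → ℕ) j → f j ℕ.≤ Data.Vec.Functional.foldr ℕ._⊔_ 0 f
  ≤max {suc n} f zero    = ℕ.m≤m⊔n (f zero) _
  ≤max {suc n} f (suc j) = ℕ.≤-trans (≤max (f ∘ suc) j) (ℕ.m≤n⊔m (f zero) _)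

  -- The continuation is bounded only on outcomes that can occur: the number of neighbourhoods
  -- queried depends on the lengths of the walks.
  queries->>= : ∀ {a b} (p : Program N d A) {k : A → Program N d B} → queries O p ℕ.≤ a →
                Always (λ x → queries O (k x) ℕ.≤ b) p → queries O (p >>= k) ℕ.≤ a ℕ.+ b
  queries->>= {a = a} {b} (return x) p≤a h = ℕ.≤-trans h (ℕ.m≤n+m b a)
  queries->>= (query v i l) (ℕ.s≤s p≤a) h = ℕ.s≤s (queries->>= (l (O v i)) p≤a h)
  queries->>= {a = a} {b} (uniform n l) {k} p≤a h =
    max≤ (λ j → queries O (l j >>= k)) (a ℕ.+ b) (λ j → queries->>= (l j) (ℕ.≤-trans (≤max (λ j → queries O (l j)) j) p≤a) (h j))

  queries-mapM : ∀ {a} {g : A → Program N d B} → (∀ x → queries O (g x) ℕ.≤ a) →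
                 ∀ xs → queries O (mapM g xs) ℕ.≤ length xs ℕ.* a
  queries-mapM g≤a [] = ℕ.z≤n
  queries-mapM {a = a} {g} g≤a (x ∷ xs) = queries->>= (g x) (g≤a x) (always (λ y →
    ℕ.≤-trans (queries->>= {b = 0} (mapM g xs) (queries-mapM g≤a xs) (always (λ _ → ℕ.z≤n) (mapM g xs))) (ℕ.≤-reflexive (ℕ.+-identityʳ (length xs ℕ.* a)))) (g x))

-- Sums over lists

sumᴸ : {A : Set} → (A → ℚ) → List A → ℚ
sumᴸ f []       = 0ℚ
sumᴸ f (x ∷ xs) = f x + sumᴸ f xs

sumᴸ-lookup : {A : Set} (f : A → ℚ) (xs : List A) → sum (λ j → f (List.lookup xs j)) ≡ sumᴸ f xs
sumᴸ-lookup f []       = refl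
sumᴸ-lookup f (x ∷ xs) = cong (f x +_) (sumᴸ-lookup f xs)

sumᴸ-1 : {A : Set} (xs : List A) → sumᴸ (λ _ → 1ℚ) xs ≡ fromℕ (length xs)
sumᴸ-1 []       = refl
sumᴸ-1 (x ∷ xs) = trans (cong (1ℚ +_) (sumᴸ-1 xs)) (sym (fromℕ-suc (length xs)))

sumᴸ-++ : {A : Set} (f : A → ℚ) (xs ys : List A) → sumᴸ f (xs ++ ys) ≡ sumᴸ f xs + sumᴸ f ys
sumᴸ-++ f []       ys = sym (ℚ.+-identityˡ (sumᴸ f ys))
sumᴸ-++ f (x ∷ xs) ys = trans (cong (f x +_) (sumᴸ-++ f xs ys)) (sym (ℚ.+-assoc (f x) (sumᴸ f xs) (sumᴸ f ys)))

sumᴸ-↭ : {A : Set} (f : A → ℚ) {xs ys : List A} → xs ↭ ys → sumᴸ f xs ≡ sumᴸ f ys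
sumᴸ-↭ f Perm.refl = refl
sumᴸ-↭ f (Perm.prep x p) = cong (f x +_) (sumᴸ-↭ f p)
sumᴸ-↭ f (Perm.swap {xs = xs} {ys = ys} x y p) = trans (cong (λ z → f x + (f y + z)) (sumᴸ-↭ f p))
  (solve 3 (λ x y z → x :+ (y :+ z) := y :+ (x :+ z)) refl (f x) (f y) (sumᴸ f ys))
sumᴸ-↭ f (Perm.trans p q) = trans (sumᴸ-↭ f p) (sumᴸ-↭ f q)

sumᴸ-mapMaybe-tabulate : {A B : Set} (f : B → ℚ) (h : A → Maybe B) (g : Fin n → A) →
  sumᴸ f (mapMaybe h (tabulate g)) ≡ sum (λ i → Maybe.maybe f 0ℚ (h (g i)))
sumᴸ-mapMaybe-tabulate {zero}  f h g = refl
sumᴸ-mapMaybe-tabulate {suc n} f h g with h (g zero)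
... | just y  = cong (f y +_) (sumᴸ-mapMaybe-tabulate f h (g ∘ suc))
... | nothing = trans (sumᴸ-mapMaybe-tabulate f h (g ∘ suc)) (sym (ℚ.+-identityˡ _))

-- A random step

module _ {N d : ℕ} (O : Oracle N d) where
  open Semantics O

  ofSign-sum : ∀ σ (f : Fin N → ℚ) xs →
    sumᴸ f (ofSign σ xs) ≡ sumᴸ (λ (w , τ) → 𝟙 (does (τ Sign.≟ σ)) * f w) xs
  ofSign-sum σ f [] = refl
  ofSign-sum σ f ((w , τ) ∷ xs) with does (τ Sign.≟ σ)
  ... | true  = cong₂ _+_ (sym (ℚ.*-identityˡ (f w))) (ofSign-sum σ f xs)
  ... | false = trans (ofSign-sum σ f xs) (trans (sym (ℚ.+-identityˡ _)) (cong (_+ sumᴸ (λ (w , τ) → 𝟙 (does (τ Sign.≟ σ)) * f w) xs) (sym (ℚ.*-zeroˡ (f w)))))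

  sum-<ᵇ : ∀ k n → k ℕ.≤ n → (g : Bool → ℚ) →
    sum {n} (λ j → g (Fin.toℕ j ℕ.<ᵇ k)) ≡ fromℕ k * g true + (fromℕ n - fromℕ k) * g false
  sum-<ᵇ zero n _ g = trans (sum-const n (g false))
    (solve 3 (λ x y n → n :* y := :0 :* x :+ (n :- :0) :* y) refl (g true) (g false) (fromℕ n))
  sum-<ᵇ (suc k) (suc n) (ℕ.s≤s k≤n) g = begin
    g true + sum {n} (λ j → g (Fin.toℕ j ℕ.<ᵇ k))  ≡⟨ cong (g true +_) (sum-<ᵇ k n k≤n g) ⟩
    g true + (fromℕ k * g true + (fromℕ n - fromℕ k) * g false)  ≡⟨ solve 4 (λ x y k n → x :+ (k :* x :+ (n :- k) :* y) := (:1 :+ k) :* x :+ ((:1 :+ n) :- (:1 :+ k)) :* y) refl (g true) (g false) (fromℕ k) (fromℕ n) ⟩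
    (1ℚ + fromℕ k) * g true + ((1ℚ + fromℕ n) - (1ℚ + fromℕ k)) * g false  ≡⟨ cong₂ (λ x y → x * g true + (y - x) * g false) (fromℕ-suc k) (fromℕ-suc n) ⟨
    fromℕ (suc k) * g true + (fromℕ (suc n) - fromℕ (suc k)) * g false  ∎
    where open ≡-Reasoning

  -- Multiplied by the length, the identity also covers the empty list, where the default has weight
  -- 0. The factor is supplied by the bias of the coin in `𝔼-move`.
  𝔼-pick : ∀ (f : Fin N → ℚ) v xs → fromℕ (length xs) * 𝔼 f (pick v xs) ≡ sumᴸ f xs
  𝔼-pick f v [] = ℚ.*-zeroˡ (f v)
  𝔼-pick f v xs@(_ ∷ _) = begin
    fromℕ (length xs) * (1/ (length xs) * sum (λ j → f (List.lookup xs j)))  ≡⟨ solve 3 (λ x y z → x :* (y :* z) := (y :* x) :* z) refl (fromℕ (length xs)) (1/ (length xs)) (sum (λ j → f (List.lookup xs j))) ⟩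
    1/ (length xs) * fromℕ (length xs) * sum (λ j → f (List.lookup xs j))  ≡⟨ cong₂ _*_ (1/-inverse (length xs)) (sumᴸ-lookup f xs) ⟩
    1ℚ * sumᴸ f xs  ≡⟨ ℚ.*-identityˡ (sumᴸ f xs) ⟩
    sumᴸ f xs  ∎
    where open ≡-Reasoning

  𝔼-move : .{{_ : NonZero d}} → ∀ (f : Fin N → ℚ) v xs → length xs ℕ.≤ d →
    𝔼 f (bernoulli (length xs) d >>= λ move → if move then pick v xs else return v) ≡
    1/ d * (sumᴸ f xs + (fromℕ d - fromℕ (length xs)) * f v)
  𝔼-move f v xs xs≤d = cong (1/ d *_) (trans (sum-<ᵇ (length xs) d xs≤d (λ b → 𝔼 f (if b then pick v xs else return v)))
    (cong (_+ (fromℕ d - fromℕ (length xs)) * f v) (𝔼-pick f v xs)))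


-- Oracle access to a signed graph

-- With at most `d` neighbours, `d` queries read the whole list, and the error symbols drop out.
catMaybes-prefix : {A : Set} → ∀ d (xs : List A) → length xs ℕ.≤ d →
  catMaybes (tabulate {n = d} (λ i → head (drop (Fin.toℕ i) xs))) ≡ xs
catMaybes-prefix zero    []       _ = refl
catMaybes-prefix (suc d) []       _ = trans (cong catMaybes (List.tabulate-cong {n = d} (λ i → head-[] (suc (Fin.toℕ i))))) (nothings d)
  where
  head-[] : ∀ {A : Set} n → head (drop {A = A} n []) ≡ nothing
  head-[] zero    = refl
  head-[] (suc n) = refl
  nothings : ∀ {A : Set} d → catMaybes (tabulate {n = d} (λ _ → nothing {A = A})) ≡ []
  nothings zero    = refl
  nothings (suc d) = nothings d
catMaybes-prefix (suc d) (x ∷ xs) (ℕ.s≤s xs≤d) = cong (x ∷_) (catMaybes-prefix d xs xs≤d)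

∈-mapMaybe⁻ : {A B : Set} (f : A → Maybe B) (xs : List A) {y : B} → y ∈ mapMaybe f xs → ∃[ x ] f x ≡ just y
∈-mapMaybe⁻ f (x ∷ xs) y∈ with f x in eq
... | nothing = ∈-mapMaybe⁻ f xs y∈
... | just z with y∈
...   | here refl = x , eq
...   | there y∈′ = ∈-mapMaybe⁻ f xs y∈′

∈-mapMaybe⁺ : {A B : Set} (f : A → Maybe B) {xs : List A} {x : A} {y : B} → x ∈ xs → f x ≡ just y → y ∈ mapMaybe f xs
∈-mapMaybe⁺ f {z ∷ xs} (here refl) eq with f z | eq
... | just _ | refl = here refl
∈-mapMaybe⁺ f {z ∷ xs} (there x∈) eq with f z
... | just _  = there (∈-mapMaybe⁺ f x∈ eq)
... | nothing = ∈-mapMaybe⁺ f x∈ eq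

hasSign : Sign → Maybe Sign → Bool
hasSign σ (just τ) = does (τ Sign.≟ σ)
hasSign σ nothing  = false

hasSign⇒≡ : ∀ σ e → hasSign σ e ≡ true → e ≡ just σ
hasSign⇒≡ σ (just τ) h with yes τ≡σ ← τ Sign.≟ σ = cong just τ≡σ

module GraphAccess {N d : ℕ} (G : SignedGraph N) (access : Access G d) where

  open SignedGraph G
  open Access access
  open Semantics oracle

  pos neg : Fin N → Fin N → Bool
  pos u v = hasSign Sign.+ (edge u v)
  neg u v = hasSign Sign.- (edge u v)

  pos-sym : ∀ u v → pos u v ≡ pos v u
  pos-sym u v = cong (hasSign Sign.+) (symmetric u v)

  length-neighbours : ∀ v → length (neighbours v) ≡ degree v
  length-neighbours v = Perm.↭-length (ordering v)

  neighbours≤d : ∀ v → length (neighbours v) ℕ.≤ d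
  neighbours≤d v = subst (ℕ._≤ d) (sym (length-neighbours v)) (degree≤d v)

  neighbourhood-neighbours : ∀ v → Always (_≡ neighbours v) (neighbourhood v)
  neighbourhood-neighbours v = always->>= (mapM (λ i → query v i return) (allFin d))
    (always-map (λ answers eq → trans (cong catMaybes (trans eq (List.map-tabulate id (oracle v)))) (catMaybes-prefix d (neighbours v) (neighbours≤d v)))
      (mapM (λ i → query v i return) (allFin d)) (always-mapM-≡ {h = oracle v} (λ i → refl) (allFin d)))

  queries-neighbourhood : ∀ v → queries oracle (neighbourhood v) ℕ.≤ d
  queries-neighbourhood v = begin
    queries oracle (neighbourhood v)  ≤⟨ queries->>= {b = 0} (mapM (λ i → query v i return) (allFin d)) (queries-mapM {a = 1} {g = λ i → query v i return} (λ i → ℕ.≤-refl) (allFin d)) (always (λ _ → ℕ.z≤n) (mapM (λ i → query v i return) (allFin d))) ⟩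
    length (allFin d) ℕ.* 1 ℕ.+ 0  ≡⟨ trans (ℕ.+-identityʳ (length (allFin d) ℕ.* 1)) (trans (ℕ.*-identityʳ (length (allFin d))) (List.length-tabulate {n = d} id)) ⟩
    d  ∎
    where open ℕ.≤-Reasoning

  𝔼-yields : ∀ {A : Set} {x : A} (f : A → ℚ) (p : Program N d A) → Always (_≡ x) p → 𝔼 f p ≡ f x
  𝔼-yields {x = x} f p h = trans (𝔼-cong-always p (always-map (λ y y≡x → cong f y≡x) p h)) (𝔼-const (f x) p)

  sum-ofSign : ∀ σ (f : Fin N → ℚ) v →
    sumᴸ f (ofSign σ (neighbours v)) ≡ sum (λ w → 𝟙 (hasSign σ (edge v w)) * f w)
  sum-ofSign σ f v = begin
    sumᴸ f (ofSign σ (neighbours v))  ≡⟨ ofSign-sum oracle σ f (neighbours v) ⟩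
    sumᴸ g (neighbours v)  ≡⟨ sumᴸ-↭ g (ordering v) ⟩
    sumᴸ g (incidences v)  ≡⟨ sumᴸ-mapMaybe-tabulate g (λ w → Maybe.map (w ,_) (edge v w)) id ⟩
    sum (λ w → Maybe.maybe g 0ℚ (Maybe.map (w ,_) (edge v w)))  ≡⟨ sum-cong-≗ {N} (λ w → term w (edge v w)) ⟩
    sum (λ w → 𝟙 (hasSign σ (edge v w)) * f w)  ∎
    where
    open ≡-Reasoning
    g : Fin N × Sign → ℚ
    g (w , τ) = 𝟙 (does (τ Sign.≟ σ)) * f w
    term : ∀ w e → Maybe.maybe g 0ℚ (Maybe.map (w ,_) e) ≡ 𝟙 (hasSign σ e) * f w
    term w (just τ) = refl
    term w nothing  = sym (ℚ.*-zeroˡ (f w))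

  degree-sum : ∀ v → sum (λ w → 𝟙 (pos v w) + 𝟙 (neg v w)) ≤ fromℕ d
  degree-sum v = begin
    sum (λ w → 𝟙 (pos v w) + 𝟙 (neg v w))  ≡⟨ sum-cong-≗ {N} (λ w → term w (edge v w)) ⟨
    sum (λ w → Maybe.maybe (λ _ → 1ℚ) 0ℚ (Maybe.map (w ,_) (edge v w)))  ≡⟨ sumᴸ-mapMaybe-tabulate (λ _ → 1ℚ) (λ w → Maybe.map (w ,_) (edge v w)) id ⟨
    sumᴸ (λ _ → 1ℚ) (incidences v)  ≡⟨ sumᴸ-1 (incidences v) ⟩
    fromℕ (degree v)  ≤⟨ fromℕ-mono-≤ (degree≤d v) ⟩
    fromℕ d  ∎
    where
    open ℚ.≤-Reasoning
    term : ∀ (w : Fin N) e → Maybe.maybe (λ _ → 1ℚ) 0ℚ (Maybe.map (w ,_) e) ≡ 𝟙 (hasSign Sign.+ e) + 𝟙 (hasSign Sign.- e)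
    term w (just Sign.+) = refl
    term w (just Sign.-) = refl
    term w nothing       = refl

  ofSign-edge : ∀ σ v w → w ∈ ofSign σ (neighbours v) → edge v w ≡ just σ
  ofSign-edge σ v w w∈ with Mem.∈-map⁻ proj₁ w∈
  ... | (w , τ) , wτ∈ , refl with Mem.∈-filter⁻ (λ (_ , τ) → τ Sign.≟ σ) {xs = neighbours v} wτ∈
  ... | wτ∈′ , refl = incident (Perm.∈-resp-↭ (ordering v) wτ∈′)
    where
    incident : (w , σ) ∈ incidences v → edge v w ≡ just σ
    incident h with ∈-mapMaybe⁻ (λ w → Maybe.map (w ,_) (edge v w)) (allFin N) h
    ... | x , eq with edge v x in e | eq
    ...   | just τ | refl = e

  edge-ofSign : ∀ σ v w → edge v w ≡ just σ → w ∈ ofSign σ (neighbours v)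
  edge-ofSign σ v w e = Mem.∈-map⁺ proj₁ (Mem.∈-filter⁺ (λ (_ , τ) → τ Sign.≟ σ)
    (Perm.∈-resp-↭ (Perm.↭-sym (ordering v)) (∈-mapMaybe⁺ (λ w → Maybe.map (w ,_) (edge v w)) (Mem.∈-allFin w) (cong (Maybe.map (w ,_)) e))) refl)

  ofSign≤d : ∀ σ v → length (ofSign σ (neighbours v)) ℕ.≤ d
  ofSign≤d σ v = begin
    length (ofSign σ (neighbours v))  ≡⟨ List.length-map proj₁ (filter (λ (_ , τ) → τ Sign.≟ σ) (neighbours v)) ⟩
    length (filter (λ (_ , τ) → τ Sign.≟ σ) (neighbours v))  ≤⟨ List.length-filter (λ (_ , τ) → τ Sign.≟ σ) (neighbours v) ⟩
    length (neighbours v)  ≤⟨ neighbours≤d v ⟩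
    d  ∎
    where open ℕ.≤-Reasoning

  -- The walk on the positive subgraph and the procedure bad-cycle

  module Walk .{{d≢0 : NonZero d}} where

    stay : Fin N → ℚ
    stay v = fromℕ d - fromℕ (length (ofSign Sign.+ (neighbours v)))

    -- The coin of bias d⁺/d and the choice among d⁺ neighbours give each of them probability 1/d,
    -- whatever the degree; this is the source of symmetry.
    P : Fin N → Fin N → ℚ
    P v w = 1/ d * (𝟙 (pos v w) + stay v * pointMass v w)

    stay-nonneg : ∀ v → 0ℚ ≤ stay v
    stay-nonneg v = p≤q⇒0≤q-p (fromℕ-mono-≤ (ofSign≤d Sign.+ v))

    P-nonneg : ∀ v w → 0ℚ ≤ P v w
    P-nonneg v w = *-nonneg (1/-nonneg d) (+-nonneg (𝟙-nonneg (pos v w)) (*-nonneg (stay-nonneg v) (pointMass-nonneg v w)))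

    pointMass-sym : ∀ {n} (i j : Fin n) → pointMass i j ≡ pointMass j i
    pointMass-sym zero    zero    = refl
    pointMass-sym zero    (suc j) = refl
    pointMass-sym (suc i) zero    = refl
    pointMass-sym (suc i) (suc j) = pointMass-sym i j

    P-sym : ∀ v w → P v w ≡ P w v
    P-sym v w = cong (1/ d *_) (cong₂ _+_ (cong 𝟙 (pos-sym v w)) (trans (pointMass-* v w stay) (cong (stay w *_) (pointMass-sym v w))))

    P-⋆ : ∀ f v → (P ⋆ f) v ≡ 1/ d * (sumᴸ f (ofSign Sign.+ (neighbours v)) + stay v * f v)
    P-⋆ f v = begin
      (P ⋆ f) v
        ≡⟨ sum-cong-≗ {N} (λ w → solve 5 (λ r e s p f → r :* (e :+ s :* p) :* f := r :* (e :* f :+ s :* (p :* f))) refl (1/ d) (𝟙 (pos v w)) (stay v) (pointMass v w) (f w)) ⟩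
      sum (λ w → 1/ d * (𝟙 (pos v w) * f w + stay v * (pointMass v w * f w)))
        ≡⟨ sum-*ˡ (1/ d) (λ w → 𝟙 (pos v w) * f w + stay v * (pointMass v w * f w)) ⟩
      1/ d * sum (λ w → 𝟙 (pos v w) * f w + stay v * (pointMass v w * f w))
        ≡⟨ cong (1/ d *_) (trans (∑-distrib-+ (λ w → 𝟙 (pos v w) * f w) (λ w → stay v * (pointMass v w * f w))) (cong₂ _+_ (sym (sum-ofSign Sign.+ f v)) (trans (sum-*ˡ (stay v) (λ w → pointMass v w * f w)) (cong (stay v *_) (pointMass-· v f))))) ⟩
      1/ d * (sumᴸ f (ofSign Sign.+ (neighbours v)) + stay v * f v)
        ∎
      where open ≡-Reasoning

    P-row : ∀ v → sum (P v) ≡ 1ℚ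
    P-row v = begin
      sum (P v)  ≡⟨ sum-cong-≗ {N} (λ w → ℚ.*-identityʳ (P v w)) ⟨
      (P ⋆ (λ _ → 1ℚ)) v  ≡⟨ P-⋆ (λ _ → 1ℚ) v ⟩
      1/ d * (sumᴸ (λ _ → 1ℚ) (ofSign Sign.+ (neighbours v)) + stay v * 1ℚ)  ≡⟨ cong (λ x → 1/ d * (x + stay v * 1ℚ)) (sumᴸ-1 (ofSign Sign.+ (neighbours v))) ⟩
      1/ d * (k + (fromℕ d - k) * 1ℚ)  ≡⟨ solve 3 (λ r k d → r :* (k :+ (d :- k) :* :1) := r :* d) refl (1/ d) k (fromℕ d) ⟩
      1/ d * fromℕ d  ≡⟨ 1/-inverse d ⟩
      1ℚ  ∎
      where
      open ≡-Reasoning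
      k : ℚ
      k = fromℕ (length (ofSign Sign.+ (neighbours v)))

    pos≤P : ∀ v w → 𝟙 (pos v w) ≤ fromℕ d * P v w
    pos≤P v w = ≤-by (stay v * pointMass v w) (*-nonneg (stay-nonneg v) (pointMass-nonneg v w)) (begin
      fromℕ d * (1/ d * (𝟙 (pos v w) + stay v * pointMass v w))  ≡⟨ solve 3 (λ d r x → d :* (r :* x) := r :* d :* x) refl (fromℕ d) (1/ d) (𝟙 (pos v w) + stay v * pointMass v w) ⟩
      1/ d * fromℕ d * (𝟙 (pos v w) + stay v * pointMass v w)  ≡⟨ cong (_* (𝟙 (pos v w) + stay v * pointMass v w)) (1/-inverse d) ⟩
      1ℚ * (𝟙 (pos v w) + stay v * pointMass v w)  ≡⟨ ℚ.*-identityˡ (𝟙 (pos v w) + stay v * pointMass v w) ⟩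
      𝟙 (pos v w) + stay v * pointMass v w  ∎)
      where open ≡-Reasoning

    𝔼-step : ∀ f v → 𝔼 f (step v) ≡ (P ⋆ f) v
    𝔼-step f v = begin
      𝔼 f (step v)  ≡⟨ 𝔼->>= f (neighbourhood v) move ⟩
      𝔼 (λ xs → 𝔼 f (move xs)) (neighbourhood v)  ≡⟨ 𝔼-yields (λ xs → 𝔼 f (move xs)) (neighbourhood v) (neighbourhood-neighbours v) ⟩
      𝔼 f (move (neighbours v))  ≡⟨ 𝔼-move oracle f v (ofSign Sign.+ (neighbours v)) (ofSign≤d Sign.+ v) ⟩
      1/ d * (sumᴸ f (ofSign Sign.+ (neighbours v)) + stay v * f v)  ≡⟨ P-⋆ f v ⟨
      (P ⋆ f) v  ∎
      where
      open ≡-Reasoning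
      move : List (Fin N × Sign) → Program N d (Fin N)
      move xs = bernoulli (length (ofSign Sign.+ xs)) d >>= λ move → if move then pick v (ofSign Sign.+ xs) else return v

    𝔼-walk-suc : ∀ L v (g : List (Fin N) → ℚ) →
      𝔼 g (walk (suc L) v) ≡ (P ⋆ (λ w → 𝔼 (λ vs → g (v ∷ vs)) (walk L w))) v
    𝔼-walk-suc L v g = begin
      𝔼 g (walk (suc L) v)  ≡⟨ 𝔼->>= g (step v) (λ w → walk L w >>= λ vs → return (v ∷ vs)) ⟩
      𝔼 (λ w → 𝔼 g (walk L w >>= λ vs → return (v ∷ vs))) (step v)  ≡⟨ 𝔼-cong (λ w → 𝔼->>= g (walk L w) (λ vs → return (v ∷ vs))) (step v) ⟩
      𝔼 (λ w → 𝔼 (λ vs → g (v ∷ vs)) (walk L w)) (step v)  ≡⟨ 𝔼-step (λ w → 𝔼 (λ vs → g (v ∷ vs)) (walk L w)) v ⟩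
      (P ⋆ (λ w → 𝔼 (λ vs → g (v ∷ vs)) (walk L w))) v  ∎
      where open ≡-Reasoning

    -- `E v` is needed because the walk may hold and because `pick` falls back to `v` on an empty
    -- list.
    step-always : ∀ {E : Fin N → Set} v → E v → (∀ w → edge v w ≡ just Sign.+ → E w) → Always E (step v)
    step-always {E} v Ev Ew = always->>= (neighbourhood v) (always-map go (neighbourhood v) (neighbourhood-neighbours v))
      where
      pick-always : ∀ xs → (∀ w → w ∈ xs → E w) → Always E (pick v xs)
      pick-always []         h = Ev
      pick-always xs@(_ ∷ _) h = λ j → h (List.lookup xs j) (Mem.∈-lookup {xs = xs} j)
      move : ∀ b → Always E (if b then pick v (ofSign Sign.+ (neighbours v)) else return v)
      move true  = pick-always (ofSign Sign.+ (neighbours v)) (λ w w∈ → Ew w (ofSign-edge Sign.+ v w w∈))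
      move false = Ev
      go : ∀ xs → xs ≡ neighbours v → Always E (bernoulli (length (ofSign Sign.+ xs)) d >>= λ b → if b then pick v (ofSign Sign.+ xs) else return v)
      go xs refl = λ j → move (Fin.toℕ j ℕ.<ᵇ length (ofSign Sign.+ (neighbours v)))

    walk-always : ∀ {E : Fin N → Set} → (∀ v w → E v → edge v w ≡ just Sign.+ → E w) →
      ∀ L v → E v → Always (All E) (walk L v)
    walk-always closed zero    v Ev = Ev ∷ []
    walk-always closed (suc L) v Ev = always->>= (step v) (always-map (λ w Ew →
      always->>= (walk L w) (always-map (λ vs Evs → Ev ∷ Evs) (walk L w) (walk-always closed L w Ew))) (step v) (step-always v Ev (λ w → closed v w Ev)))

    walk-length : ∀ L v → Always (λ vs → length vs ≡ suc L) (walk L v)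
    walk-length zero    v = refl
    walk-length (suc L) v = always->>= (step v) (always (λ w →
      always->>= (walk L w) (always-map (λ vs → cong suc) (walk L w) (walk-length L w))) (step v))

    queries-step : ∀ v → queries oracle (step v) ℕ.≤ d
    queries-step v = ℕ.≤-trans (queries->>= {a = d} {b = 0} (neighbourhood v) (queries-neighbourhood v) (always (λ xs →
      queries->>= {a = 0} {b = 0} (bernoulli (length (ofSign Sign.+ xs)) d) {λ b → if b then pick v (ofSign Sign.+ xs) else return v} (max≤ {d} (λ _ → 0) 0 (λ _ → ℕ.z≤n)) (λ j → no-queries (Fin.toℕ j ℕ.<ᵇ length (ofSign Sign.+ xs)) (ofSign Sign.+ xs))) (neighbourhood v))) (ℕ.≤-reflexive (ℕ.+-identityʳ d))
      where
      no-queries : ∀ b xs → queries oracle (if b then pick v xs else return v) ℕ.≤ 0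
      no-queries true  []         = ℕ.z≤n
      no-queries true  xs@(_ ∷ _) = max≤ {length xs} (λ _ → 0) 0 (λ _ → ℕ.z≤n)
      no-queries false xs         = ℕ.z≤n

    queries-walk : ∀ L v → queries oracle (walk L v) ℕ.≤ L ℕ.* d
    queries-walk zero    v = ℕ.z≤n
    queries-walk (suc L) v = queries->>= (step v) (queries-step v) (always (λ w →
      ℕ.≤-trans (queries->>= {b = 0} (walk L w) (queries-walk L w) (always (λ _ → ℕ.z≤n) (walk L w))) (ℕ.≤-reflexive (ℕ.+-identityʳ (L ℕ.* d)))) (step v))

    module _ (walks : List (List (Fin N))) where

      visited : List (Fin N)
      visited = deduplicate Fin._≟_ (concat walks)

      negativeFrom : Fin N → List (Fin N × Fin N)
      negativeFrom u = List.map (u ,_) (filter (λ w → mem? Fin._≟_ w visited) (ofSign Sign.- (neighbours u)))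

      verdict : Maybe (List (Fin N))
      verdict = Maybe.map (cycleThrough walks) (head (concat (List.map negativeFrom visited)))

    mapM-return : ∀ {B C : Set} {E : C → Set} (g : Fin N → Program N d B) (h : Fin N → B) → (∀ u → Always (_≡ h u) (g u)) →
      ∀ K (k : List B → C) → E (k (List.map h K)) → Always E (mapM g K >>= λ ns → return (k ns))
    mapM-return {E = E} g h g≡h K k Ek = always->>= (mapM g K) (always-map (λ ns eq → subst (λ ns → E (k ns)) (sym eq) Ek) (mapM g K) (always-mapM-≡ g≡h K))

    negativeFrom-yields : ∀ ws u → Always (_≡ negativeFrom ws u)
      (neighbourhood u >>= λ xs → return (List.map (u ,_) (filter (λ w → mem? Fin._≟_ w (visited ws)) (ofSign Sign.- xs))))
    negativeFrom-yields ws u = always->>= (neighbourhood u) (always-map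
      (λ xs eq → cong (λ xs → List.map (u ,_) (filter (λ w → mem? Fin._≟_ w (visited ws)) (ofSign Sign.- xs))) eq)
      (neighbourhood u) (neighbourhood-neighbours u))

    badCycle-always : ∀ {m L s} {E : Maybe (List (Fin N)) → Set} {F : List (List (Fin N)) → Set} →
      Always F (replicateM m (walk L s)) → (∀ ws → F ws → E (verdict ws)) → Always E (badCycle m L s)
    badCycle-always {m} {L} {s} {E} hF hE = always->>= (replicateM m (walk L s)) (always-map (λ ws Fws →
      -- The underscore is the function local to `badCycle`, found by unification; `negativeFrom` is
      -- its value on the true neighbour lists.
      mapM-return {E = E} _ (negativeFrom ws) (negativeFrom-yields ws) (visited ws) (λ ns → Maybe.map (cycleThrough ws) (head (concat ns))) (hE ws Fws))
      (replicateM m (walk L s)) hF)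

    𝔼-badCycle : ∀ m L s (f : Maybe (List (Fin N)) → ℚ) →
      𝔼 f (badCycle m L s) ≡ 𝔼 (λ ws → f (verdict ws)) (replicateM m (walk L s))
    𝔼-badCycle m L s f = trans (𝔼->>= f (replicateM m (walk L s)) _) (𝔼-cong (λ ws →
      𝔼-mapM-return _ (negativeFrom ws) (negativeFrom-yields ws) (visited ws) (λ ns → Maybe.map (cycleThrough ws) (head (concat ns)))) (replicateM m (walk L s)))
      where
      𝔼-mapM-return : ∀ {B : Set} (g : Fin N → Program N d B) (h : Fin N → B) → (∀ u → Always (_≡ h u) (g u)) →
        ∀ K (k : List B → Maybe (List (Fin N))) → 𝔼 f (mapM g K >>= λ ns → return (k ns)) ≡ f (k (List.map h K))
      𝔼-mapM-return g h g≡h K k = 𝔼-yields f (mapM g K >>= λ ns → return (k ns)) (mapM-return g h g≡h K k refl)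

    -- A walk contributes at most `suc L` nodes to the visited set, its start included, and each of
    -- them costs `d` further queries.
    queries-badCycle : ∀ m L s → queries oracle (badCycle m L s) ℕ.≤ m ℕ.* (L ℕ.* d) ℕ.+ m ℕ.* suc L ℕ.* d
    queries-badCycle m L s = queries->>= {b = m ℕ.* suc L ℕ.* d} (replicateM m (walk L s)) walks≤
      (always-map (λ ws (len , lens) → ℕ.≤-trans (queries-mapM-return _ (queries-negativeFrom ws) (visited ws) (λ ns → Maybe.map (cycleThrough ws) (head (concat ns))))
        (ℕ.*-monoˡ-≤ d (visited≤ ws len lens))) (replicateM m (walk L s)) (always-replicateM m (walk L s) (walk-length L s)))
      where
      queries-return : ∀ {A B : Set} {a} (p : Program N d A) (k : A → B) → queries oracle p ℕ.≤ a → queries oracle (p >>= λ x → return (k x)) ℕ.≤ a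
      queries-return {a = a} p k p≤a = ℕ.≤-trans (queries->>= {b = 0} p p≤a (always (λ _ → ℕ.z≤n) p)) (ℕ.≤-reflexive (ℕ.+-identityʳ a))
      queries-negativeFrom : ∀ ws u → queries oracle (neighbourhood u >>= λ xs → return (List.map (u ,_) (filter (λ w → mem? Fin._≟_ w (visited ws)) (ofSign Sign.- xs)))) ℕ.≤ d
      queries-negativeFrom ws u = queries-return (neighbourhood u) (λ xs → List.map (u ,_) (filter (λ w → mem? Fin._≟_ w (visited ws)) (ofSign Sign.- xs))) (queries-neighbourhood u)
      queries-mapM-return : ∀ {B C : Set} {a} (g : Fin N → Program N d B) → (∀ u → queries oracle (g u) ℕ.≤ a) →
        ∀ K (k : List B → C) → queries oracle (mapM g K >>= λ ns → return (k ns)) ℕ.≤ length K ℕ.* a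
      queries-mapM-return g g≤a K k = queries-return (mapM g K) k (queries-mapM g≤a K)
      walks≤ : queries oracle (replicateM m (walk L s)) ℕ.≤ m ℕ.* (L ℕ.* d)
      walks≤ = ℕ.≤-trans (queries-mapM (λ _ → queries-walk L s) (replicate m (walk L s))) (ℕ.≤-reflexive (cong (ℕ._* (L ℕ.* d)) (List.length-replicate m)))
      length-concat : ∀ c (ws : List (List (Fin N))) → All (λ w → length w ≡ c) ws → length (concat ws) ≡ length ws ℕ.* c
      length-concat c []       []       = refl
      length-concat c (w ∷ ws) (h ∷ hs) = trans (List.length-++ w) (cong₂ ℕ._+_ h (length-concat c ws hs))
      visited≤ : ∀ ws → length ws ≡ m → All (λ w → length w ≡ suc L) ws → length (visited ws) ℕ.≤ m ℕ.* suc L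
      visited≤ ws len lens = ℕ.≤-trans (List.length-deduplicate Fin._≟_ (concat ws)) (ℕ.≤-reflexive (trans (length-concat (suc L) ws lens) (cong (ℕ._* suc L) len)))

    conflicts : List (List (Fin N)) → List (Fin N × Fin N)
    conflicts ws = concat (List.map (negativeFrom ws) (visited ws))

    ∈-conflicts⁺ : ∀ ws {u v} → u ∈ concat ws → v ∈ concat ws → edge u v ≡ just Sign.- → (u , v) ∈ conflicts ws
    ∈-conflicts⁺ ws {u} {v} u∈ v∈ e = Mem.∈-concat⁺′
      (Mem.∈-map⁺ (u ,_) (Mem.∈-filter⁺ (λ w → mem? Fin._≟_ w (visited ws)) (edge-ofSign Sign.- u v e) (Mem.∈-deduplicate⁺ Fin._≟_ v∈)))
      (Mem.∈-map⁺ (negativeFrom ws) (Mem.∈-deduplicate⁺ Fin._≟_ u∈))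

    ∈-conflicts⁻ : ∀ ws {x} → x ∈ conflicts ws → ∃[ u ] ∃[ v ] u ∈ concat ws × v ∈ concat ws × edge u v ≡ just Sign.-
    ∈-conflicts⁻ ws x∈ with Mem.∈-concat⁻′ (List.map (negativeFrom ws) (visited ws)) x∈
    ... | _ , x∈from , from∈ with Mem.∈-map⁻ (negativeFrom ws) from∈
    ... | u , u∈ , refl with Mem.∈-map⁻ (u ,_) x∈from
    ... | v , v∈f , refl with Mem.∈-filter⁻ (λ w → mem? Fin._≟_ w (visited ws)) {xs = ofSign Sign.- (neighbours u)} v∈f
    ... | v∈neg , v∈ = u , v , Mem.∈-deduplicate⁻ Fin._≟_ (concat ws) u∈ , Mem.∈-deduplicate⁻ Fin._≟_ (concat ws) v∈ , ofSign-edge Sign.- u v v∈neg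

    verdict-nothing⁺ : ∀ ws → (∀ {u v} → u ∈ concat ws → v ∈ concat ws → edge u v ≢ just Sign.-) → verdict ws ≡ nothing
    verdict-nothing⁺ ws none with conflicts ws in eq
    ... | []    = refl
    ... | x ∷ _ with ∈-conflicts⁻ ws {x} (subst (x ∈_) (sym eq) (here refl))
    ...   | u , v , u∈ , v∈ , e = contradiction e (none u∈ v∈)

    verdict-nothing⁻ : ∀ ws → Maybe.is-just (verdict ws) ≡ false → ∀ {u v} → u ∈ concat ws → v ∈ concat ws → neg u v ≡ false
    verdict-nothing⁻ ws h {u} {v} u∈ v∈ = ¬-not (λ n → absurd (conflicts ws) refl (∈-conflicts⁺ ws u∈ v∈ (hasSign⇒≡ Sign.- (edge u v) n)))
      where
      absurd : ∀ xs → conflicts ws ≡ xs → (u , v) ∈ xs → _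
      absurd (x ∷ xs) eq _ = contradiction (trans (sym (cong (λ c → Maybe.is-just (Maybe.map (cycleThrough ws) (head c))) eq)) h) λ ()


-- The second moment method

sumᴸ-0 : {A : Set} {f : A → ℚ} (xs : List A) → All (λ x → f x ≡ 0ℚ) xs → sumᴸ f xs ≡ 0ℚ
sumᴸ-0 []       []          = refl
sumᴸ-0 (x ∷ xs) (fx≡0 ∷ h) = trans (cong₂ _+_ fx≡0 (sumᴸ-0 xs h)) refl

sumᴸ-· : {A : Set} (q : Fin n → ℚ) (g : A → Fin n → ℚ) (xs : List A) →
  q · (λ v → sumᴸ (λ x → g x v) xs) ≡ sumᴸ (λ x → q · g x) xs
sumᴸ-· q g []       = ·-0ʳ q
sumᴸ-· q g (x ∷ xs) = trans (·-+ʳ q (g x) (λ v → sumᴸ (λ x → g x v) xs)) (cong (q · g x +_) (sumᴸ-· q g xs))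

sumᴸ-cong : {A : Set} {f g : A → ℚ} → (∀ x → f x ≡ g x) → ∀ xs → sumᴸ f xs ≡ sumᴸ g xs
sumᴸ-cong f≗g []       = refl
sumᴸ-cong f≗g (x ∷ xs) = cong₂ _+_ (f≗g x) (sumᴸ-cong f≗g xs)

at : (Fin n → ℚ) → Maybe (Fin n) → ℚ
at f = Maybe.maybe f 0ℚ

at-square : (f : Fin n → ℚ) (x : Maybe (Fin n)) → at f x * at f x ≡ at (λ u → f u * f u) x
at-square f (just u) = refl
at-square f nothing  = refl

module IID {N d : ℕ} (O : Oracle N d) {W : Set} (w : Program N d W) where
  open Semantics O

  𝔼ⁿ : ℕ → (List W → ℚ) → ℚ
  𝔼ⁿ k F = 𝔼 F (replicateM k w)

  𝔼ⁿ-suc : ∀ k F → 𝔼ⁿ (suc k) F ≡ 𝔼 (λ y → 𝔼ⁿ k (λ ys → F (y ∷ ys))) w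
  𝔼ⁿ-suc k F = trans (𝔼->>= F w (λ y → replicateM k w >>= λ ys → return (y ∷ ys)))
    (𝔼-cong (λ y → 𝔼->>= F (replicateM k w) (λ ys → return (y ∷ ys))) w)

  -- Splits the samples into independent groups. Counting collisions only between two groups avoids
  -- diagonal terms.
  𝔼ⁿ-++ : ∀ k l F → 𝔼ⁿ (k ℕ.+ l) F ≡ 𝔼ⁿ k (λ xs → 𝔼ⁿ l (λ ys → F (xs ++ ys)))
  𝔼ⁿ-++ zero    l F = refl
  𝔼ⁿ-++ (suc k) l F = begin
    𝔼ⁿ (suc k ℕ.+ l) F  ≡⟨ 𝔼ⁿ-suc (k ℕ.+ l) F ⟩
    𝔼 (λ y → 𝔼ⁿ (k ℕ.+ l) (λ zs → F (y ∷ zs))) w  ≡⟨ 𝔼-cong (λ y → 𝔼ⁿ-++ k l (λ zs → F (y ∷ zs))) w ⟩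
    𝔼 (λ y → 𝔼ⁿ k (λ xs → 𝔼ⁿ l (λ ys → F (y ∷ xs ++ ys)))) w  ≡⟨ 𝔼ⁿ-suc k (λ xs → 𝔼ⁿ l (λ ys → F (xs ++ ys))) ⟨
    𝔼ⁿ (suc k) (λ xs → 𝔼ⁿ l (λ ys → F (xs ++ ys)))  ∎
    where open ≡-Reasoning

  mean : ∀ k (Y : W → ℚ) → 𝔼ⁿ k (sumᴸ Y) ≡ fromℕ k * 𝔼 Y w
  mean zero    Y = sym (ℚ.*-zeroˡ (𝔼 Y w))
  mean (suc k) Y = begin
    𝔼ⁿ (suc k) (sumᴸ Y)  ≡⟨ 𝔼ⁿ-suc k (sumᴸ Y) ⟩
    𝔼 (λ y → 𝔼ⁿ k (λ ys → Y y + sumᴸ Y ys)) w  ≡⟨ 𝔼-cong (λ y → trans (𝔼-+ (λ _ → Y y) (sumᴸ Y) (replicateM k w)) (cong₂ _+_ (𝔼-const (Y y) (replicateM k w)) (mean k Y))) w ⟩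
    𝔼 (λ y → Y y + fromℕ k * 𝔼 Y w) w  ≡⟨ trans (𝔼-+ Y (λ _ → fromℕ k * 𝔼 Y w) w) (cong (𝔼 Y w +_) (𝔼-const (fromℕ k * 𝔼 Y w) w)) ⟩
    𝔼 Y w + fromℕ k * 𝔼 Y w  ≡⟨ solve 2 (λ y k → y :+ k :* y := (:1 :+ k) :* y) refl (𝔼 Y w) (fromℕ k) ⟩
    (1ℚ + fromℕ k) * 𝔼 Y w  ≡⟨ cong (_* 𝔼 Y w) (fromℕ-suc k) ⟨
    fromℕ (suc k) * 𝔼 Y w  ∎
    where open ≡-Reasoning

  -- The variance of an independent sum, with the subtracted squares of the mean dropped.
  meanSquare : ∀ k (Y : W → ℚ) → 𝔼ⁿ k (λ ws → sumᴸ Y ws * sumᴸ Y ws) ≤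
    fromℕ k * 𝔼 (λ y → Y y * Y y) w + fromℕ k * fromℕ k * (𝔼 Y w * 𝔼 Y w)
  meanSquare zero    Y = ℚ.≤-reflexive (solve 2 (λ x y → :0 := :0 :* x :+ :0 :* :0 :* y) refl (𝔼 (λ y → Y y * Y y) w) (𝔼 Y w * 𝔼 Y w))
  meanSquare (suc k) Y = begin
    𝔼ⁿ (suc k) (λ ws → sumᴸ Y ws * sumᴸ Y ws)
      ≡⟨ 𝔼ⁿ-suc k (λ ws → sumᴸ Y ws * sumᴸ Y ws) ⟩
    𝔼 (λ y → 𝔼ⁿ k (λ ys → (Y y + sumᴸ Y ys) * (Y y + sumᴸ Y ys))) w
      ≡⟨ 𝔼-cong expand w ⟩
    𝔼 (λ y → (Y y * Y y + 2ℚ * (K * μ) * Y y) + S) w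
      ≡⟨ trans (𝔼-+ (λ y → Y y * Y y + 2ℚ * (K * μ) * Y y) (λ _ → S) w) (cong₂ _+_ (trans (𝔼-+ (λ y → Y y * Y y) (λ y → 2ℚ * (K * μ) * Y y) w) (cong (μ₂ +_) (𝔼-* (2ℚ * (K * μ)) Y w))) (𝔼-const S w)) ⟩
    (μ₂ + 2ℚ * (K * μ) * μ) + S
      ≤⟨ ℚ.+-monoʳ-≤ (μ₂ + 2ℚ * (K * μ) * μ) (meanSquare k Y) ⟩
    (μ₂ + 2ℚ * (K * μ) * μ) + (K * μ₂ + K * K * (μ * μ))
      ≤⟨ ≤-by (μ * μ) (square-nonneg μ) (solve 3 (λ m2 m k → (:1 :+ k) :* m2 :+ (:1 :+ k) :* (:1 :+ k) :* (m :* m) := ((m2 :+ :2 :* (k :* m) :* m) :+ (k :* m2 :+ k :* k :* (m :* m))) :+ m :* m) refl μ₂ μ K) ⟩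
    (1ℚ + K) * μ₂ + (1ℚ + K) * (1ℚ + K) * (μ * μ)
      ≡⟨ cong (λ z → z * μ₂ + z * z * (μ * μ)) (fromℕ-suc k) ⟨
    fromℕ (suc k) * μ₂ + fromℕ (suc k) * fromℕ (suc k) * (μ * μ)
      ∎
    where
    open ℚ.≤-Reasoning
    K μ μ₂ S : ℚ
    K = fromℕ k
    μ = 𝔼 Y w
    μ₂ = 𝔼 (λ y → Y y * Y y) w
    S = 𝔼ⁿ k (λ ws → sumᴸ Y ws * sumᴸ Y ws)
    expand : ∀ y → 𝔼ⁿ k (λ ys → (Y y + sumᴸ Y ys) * (Y y + sumᴸ Y ys)) ≡ (Y y * Y y + 2ℚ * (K * μ) * Y y) + S
    expand y = begin-equality
      𝔼ⁿ k (λ ys → (Y y + sumᴸ Y ys) * (Y y + sumᴸ Y ys))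
        ≡⟨ 𝔼-cong (λ ys → solve 2 (λ y s → (y :+ s) :* (y :+ s) := (y :* y :+ :2 :* y :* s) :+ s :* s) refl (Y y) (sumᴸ Y ys)) (replicateM k w) ⟩
      𝔼ⁿ k (λ ys → (Y y * Y y + 2ℚ * Y y * sumᴸ Y ys) + sumᴸ Y ys * sumᴸ Y ys)
        ≡⟨ trans (𝔼-+ (λ ys → Y y * Y y + 2ℚ * Y y * sumᴸ Y ys) (λ ys → sumᴸ Y ys * sumᴸ Y ys) (replicateM k w)) (cong (_+ S) (trans (𝔼-+ (λ _ → Y y * Y y) (λ ys → 2ℚ * Y y * sumᴸ Y ys) (replicateM k w)) (cong₂ _+_ (𝔼-const (Y y * Y y) (replicateM k w)) (trans (𝔼-* (2ℚ * Y y) (sumᴸ Y) (replicateM k w)) (cong (2ℚ * Y y *_) (mean k Y)))))) ⟩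
      (Y y * Y y + 2ℚ * Y y * (K * μ)) + S
        ≡⟨ solve 3 (λ y m s → (y :* y :+ :2 :* y :* m) :+ s := (y :* y :+ :2 :* m :* y) :+ s) refl (Y y) (K * μ) S ⟩
      (Y y * Y y + 2ℚ * (K * μ) * Y y) + S
        ∎

  -- Each sample carries two (partial) marks; collisions are counted between
  -- marks of independent samples, and q is the expected sum of point masses.
  module Collisions (a b : W → Maybe (Fin N)) (q : Fin N → ℚ) (0≤q : ∀ u → 0ℚ ≤ q u)
    (q-law : ∀ f → 𝔼 (λ x → at f (a x) + at f (b x)) w ≡ q · f)
    (e : Fin N → Fin N → Bool) (e-sym : ∀ u v → e u v ≡ e v u) (k : ℕ) where

    φ : W → (Fin N → ℚ) → ℚ
    φ x f = at f (a x) + at f (b x)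

    ε : Fin N → Fin N → ℚ
    ε u v = 𝟙 (e u v)

    r : Fin N → ℚ
    r = ε ⋆ q

    r² : Fin N → ℚ
    r² u = r u * r u

    hits : List W → Fin N → ℚ
    hits xs v = sumᴸ (λ x → φ x (λ u → ε u v)) xs

    collisions : List W → List W → ℚ
    collisions xs ys = sumᴸ (λ y → φ y (hits xs)) ys

    K μ κ : ℚ
    K = fromℕ k
    μ = q · r
    κ = q · r²

    -- Two marks of one walk are dependent, so only the parallelogram law is available; it costs a
    -- factor 2.
    φ-square : ∀ f x → φ x f * φ x f ≤ 2ℚ * φ x (λ u → f u * f u)
    φ-square f x = ≤-by ((at f (a x) - at f (b x)) * (at f (a x) - at f (b x))) (square-nonneg (at f (a x) - at f (b x))) (begin
      2ℚ * φ x (λ u → f u * f u)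
        ≡⟨ cong (2ℚ *_) (cong₂ _+_ (at-square f (a x)) (at-square f (b x))) ⟨
      2ℚ * (at f (a x) * at f (a x) + at f (b x) * at f (b x))
        ≡⟨ solve 2 (λ x y → :2 :* (x :* x :+ y :* y) := (x :+ y) :* (x :+ y) :+ (x :- y) :* (x :- y)) refl (at f (a x)) (at f (b x)) ⟩
      φ x f * φ x f + (at f (a x) - at f (b x)) * (at f (a x) - at f (b x))
        ∎)
      where open ≡-Reasoning

    𝔼-φ² : ∀ f → 𝔼 (λ x → φ x f * φ x f) w ≤ 2ℚ * (q · (λ u → f u * f u))
    𝔼-φ² f = ℚ.≤-trans (𝔼-mono (φ-square f) w) (ℚ.≤-reflexive (trans (𝔼-* 2ℚ (λ x → φ x (λ u → f u * f u)) w) (cong (2ℚ *_) (q-law (λ u → f u * f u)))))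

    q·hits : ∀ xs → q · hits xs ≡ sumᴸ (λ x → φ x r) xs
    q·hits xs = trans (sumᴸ-· q (λ x v → φ x (λ u → ε u v)) xs) (sumᴸ-cong term xs)
      where
      q·ε : ∀ u → q · (λ v → ε u v) ≡ r u
      q·ε u = ·-comm q (ε u)
      at-r : ∀ y → q · (λ v → at (λ u → ε u v) y) ≡ at r y
      at-r (just u) = q·ε u
      at-r nothing  = ·-0ʳ q
      term : ∀ x → q · (λ v → φ x (λ u → ε u v)) ≡ φ x r
      term x = trans (·-+ʳ q (λ v → at (λ u → ε u v) (a x)) (λ v → at (λ u → ε u v) (b x))) (cong₂ _+_ (at-r (a x)) (at-r (b x)))

    𝔼-collisions : 𝔼ⁿ k (λ xs → 𝔼ⁿ k (collisions xs)) ≡ K * K * μ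
    𝔼-collisions = begin
      𝔼ⁿ k (λ xs → 𝔼ⁿ k (collisions xs))  ≡⟨ 𝔼-cong (λ xs → trans (mean k (λ y → φ y (hits xs))) (cong (K *_) (trans (q-law (hits xs)) (q·hits xs)))) (replicateM k w) ⟩
      𝔼ⁿ k (λ xs → K * sumᴸ (λ x → φ x r) xs)  ≡⟨ 𝔼-* K (sumᴸ (λ x → φ x r)) (replicateM k w) ⟩
      K * 𝔼ⁿ k (sumᴸ (λ x → φ x r))  ≡⟨ cong (K *_) (trans (mean k (λ x → φ x r)) (cong (K *_) (q-law r))) ⟩
      K * (K * μ)  ≡⟨ ℚ.*-assoc K K μ ⟨
      K * K * μ  ∎
      where open ≡-Reasoning

    0≤K : 0ℚ ≤ K
    0≤K = fromℕ-nonneg k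

    0≤K² : 0ℚ ≤ K * K
    0≤K² = square-nonneg K

    -- At a fixed node the hits of one sample are a sum of two values in {0, 1}, so their second
    -- moment is at most twice their mean.
    𝔼-hits² : 𝔼ⁿ k (λ xs → q · (λ v → hits xs v * hits xs v)) ≤ K * (2ℚ * μ) + K * K * κ
    𝔼-hits² = begin
      𝔼ⁿ k (λ xs → q · (λ v → hits xs v * hits xs v))
        ≡⟨ 𝔼-sum (λ v xs → q v * (hits xs v * hits xs v)) (replicateM k w) ⟩
      sum (λ v → 𝔼ⁿ k (λ xs → q v * (hits xs v * hits xs v)))
        ≡⟨ sum-cong-≗ {N} (λ v → 𝔼-* (q v) (λ xs → hits xs v * hits xs v) (replicateM k w)) ⟩
      q · (λ v → 𝔼ⁿ k (λ xs → hits xs v * hits xs v))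
        ≤⟨ ·-monoʳ 0≤q each ⟩
      q · (λ v → K * 2ℚ * r v + K * K * r² v)
        ≡⟨ trans (·-+ʳ q (λ v → K * 2ℚ * r v) (λ v → K * K * r² v)) (cong₂ _+_ (trans (·-*ʳ (K * 2ℚ) q r) (ℚ.*-assoc K 2ℚ μ)) (·-*ʳ (K * K) q r²)) ⟩
      K * (2ℚ * μ) + K * K * κ
        ∎
      where
      open ℚ.≤-Reasoning
      q·ε : ∀ v → q · (λ u → ε u v) ≡ r v
      q·ε v = trans (·-comm q (λ u → ε u v)) (sum-cong-≗ {N} (λ u → cong (λ x → 𝟙 x * q u) (e-sym u v)))
      each : ∀ v → 𝔼ⁿ k (λ xs → hits xs v * hits xs v) ≤ K * 2ℚ * r v + K * K * r² v
      each v = begin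
        𝔼ⁿ k (λ xs → hits xs v * hits xs v)
          ≤⟨ meanSquare k (λ x → φ x (λ u → ε u v)) ⟩
        K * 𝔼 (λ x → φ x (λ u → ε u v) * φ x (λ u → ε u v)) w + K * K * (𝔼 (λ x → φ x (λ u → ε u v)) w * 𝔼 (λ x → φ x (λ u → ε u v)) w)
          ≤⟨ ℚ.+-mono-≤ (*-monoˡ-≤ 0≤K (𝔼-φ² (λ u → ε u v))) (ℚ.≤-reflexive (cong (λ x → K * K * (x * x)) (trans (q-law (λ u → ε u v)) (q·ε v)))) ⟩
        K * (2ℚ * (q · (λ u → ε u v * ε u v))) + K * K * r² v
          ≡⟨ cong (λ x → K * (2ℚ * x) + K * K * r² v) (trans (·-congˡ q (λ u → 𝟙-idem (e u v))) (q·ε v)) ⟩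
        K * (2ℚ * r v) + K * K * r² v
          ≡⟨ cong (_+ K * K * r² v) (ℚ.*-assoc K 2ℚ (r v)) ⟨
        K * 2ℚ * r v + K * K * r² v
          ∎

    -- Given `xs`, the terms over `ys` are independent. Their second moment involves q · hits² and
    -- the square of q · hits, and the latter is once more the square of an independent sum.
    𝔼-collisions² : 𝔼ⁿ k (λ xs → 𝔼ⁿ k (λ ys → collisions xs ys * collisions xs ys)) ≤
      (fromℕ 4 * (K * K * μ) + fromℕ 4 * (K * K * K * κ)) + K * K * μ * (K * K * μ)
    𝔼-collisions² = begin
      𝔼ⁿ k (λ xs → 𝔼ⁿ k (λ ys → collisions xs ys * collisions xs ys))
        ≤⟨ 𝔼-mono (λ xs → ℚ.≤-trans (meanSquare k (λ y → φ y (hits xs))) (ℚ.+-mono-≤ (*-monoˡ-≤ 0≤K (𝔼-φ² (hits xs))) (ℚ.≤-reflexive (cong (λ x → K * K * (x * x)) (trans (q-law (hits xs)) (q·hits xs)))))) (replicateM k w) ⟩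
      𝔼ⁿ k (λ xs → K * (2ℚ * (q · (λ v → hits xs v * hits xs v))) + K * K * (S xs * S xs))
        ≡⟨ trans (𝔼-+ (λ xs → K * (2ℚ * (q · (λ v → hits xs v * hits xs v)))) (λ xs → K * K * (S xs * S xs)) (replicateM k w))
             (cong₂ _+_ (trans (𝔼-* K (λ xs → 2ℚ * (q · (λ v → hits xs v * hits xs v))) (replicateM k w)) (cong (K *_) (𝔼-* 2ℚ (λ xs → q · (λ v → hits xs v * hits xs v)) (replicateM k w)))) (𝔼-* (K * K) (λ xs → S xs * S xs) (replicateM k w))) ⟩
      K * (2ℚ * 𝔼ⁿ k (λ xs → q · (λ v → hits xs v * hits xs v))) + K * K * 𝔼ⁿ k (λ xs → S xs * S xs)
        ≤⟨ ℚ.+-mono-≤ (*-monoˡ-≤ 0≤K (*-monoˡ-≤ 0≤2 𝔼-hits²)) (*-monoˡ-≤ 0≤K² (ℚ.≤-trans (meanSquare k (λ x → φ x r)) (ℚ.+-mono-≤ (*-monoˡ-≤ 0≤K (𝔼-φ² r)) (ℚ.≤-reflexive (cong (λ x → K * K * (x * x)) (q-law r)))))) ⟩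
      K * (2ℚ * (K * (2ℚ * μ) + K * K * κ)) + K * K * (K * (2ℚ * κ) + K * K * (μ * μ))
        ≡⟨ solve 3 (λ K m k → K :* (:2 :* (K :* (:2 :* m) :+ K :* K :* k)) :+ K :* K :* (K :* (:2 :* k) :+ K :* K :* (m :* m)) := (:ℕ 4 :* (K :* K :* m) :+ :ℕ 4 :* (K :* K :* K :* k)) :+ K :* K :* m :* (K :* K :* m)) refl K μ κ ⟩
      (fromℕ 4 * (K * K * μ) + fromℕ 4 * (K * K * K * κ)) + K * K * μ * (K * K * μ)
        ∎
      where
      open ℚ.≤-Reasoning
      S : List W → ℚ
      S = sumᴸ (λ x → φ x r)

    M : ℚ
    M = K * K * μ

    -- 1[X ≠ 0] ≥ 2X/M − (X/M)², with the denominators cleared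
    detection : ∀ {F : List W → ℚ} → fromℕ 16 ≤ M → fromℕ 16 * κ ≤ K * μ * μ →
      (∀ xs ys → 2ℚ * M * collisions xs ys - collisions xs ys * collisions xs ys ≤ M * M * F (xs ++ ys)) →
      1ℚ ≤ 2ℚ * 𝔼ⁿ (k ℕ.+ k) F
    detection {F} 16≤M κ-small pointwise = *-cancelˡ-≤ (M * M) (*-pos 0<M 0<M) (begin
      M * M * 1ℚ
        -- Each hypothesis bounds one of 4 M and 4 K³κ by M²/4, so at least M²/2 is left of 2 M² -
        -- M² - 4 M - 4 K³κ, and doubling restores M².
        ≤⟨ ≤-by (½ * M * (M - fromℕ 16) + ½ * (K * K * K) * (K * μ * μ - fromℕ 16 * κ)) (+-nonneg (*-nonneg (*-nonneg 0≤½ 0≤M) (p≤q⇒0≤q-p 16≤M)) (*-nonneg (*-nonneg 0≤½ (*-nonneg 0≤K² 0≤K)) (p≤q⇒0≤q-p κ-small)))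
             (solve 3 (λ K m k → :2 :* (:2 :* (K :* K :* m) :* (K :* K :* m) :- ((:ℕ 4 :* (K :* K :* m) :+ :ℕ 4 :* (K :* K :* K :* k)) :+ K :* K :* m :* (K :* K :* m))) := (K :* K :* m) :* (K :* K :* m) :* :1 :+ (con ½ :* (K :* K :* m) :* (K :* K :* m :- :ℕ 16) :+ con ½ :* (K :* K :* K) :* (K :* m :* m :- :ℕ 16 :* k))) refl K μ κ) ⟩
      2ℚ * (2ℚ * M * M - ((fromℕ 4 * M + fromℕ 4 * (K * K * K * κ)) + M * M))
        ≤⟨ *-monoˡ-≤ 0≤2 (ℚ.+-mono-≤ (ℚ.≤-reflexive (cong (2ℚ * M *_) (sym 𝔼-collisions))) (ℚ.neg-antimono-≤ 𝔼-collisions²)) ⟩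
      2ℚ * (2ℚ * M * 𝔼ⁿ k (λ xs → 𝔼ⁿ k (collisions xs)) - 𝔼ⁿ k (λ xs → 𝔼ⁿ k (λ ys → collisions xs ys * collisions xs ys)))
        ≡⟨ cong (2ℚ *_) combine ⟨
      2ℚ * 𝔼ⁿ k (λ xs → 𝔼ⁿ k (λ ys → 2ℚ * M * collisions xs ys - collisions xs ys * collisions xs ys))
        ≤⟨ *-monoˡ-≤ 0≤2 (𝔼-mono (λ xs → 𝔼-mono (pointwise xs) (replicateM k w)) (replicateM k w)) ⟩
      2ℚ * 𝔼ⁿ k (λ xs → 𝔼ⁿ k (λ ys → M * M * F (xs ++ ys)))
        ≡⟨ cong (2ℚ *_) (trans (𝔼-cong (λ xs → 𝔼-* (M * M) (λ ys → F (xs ++ ys)) (replicateM k w)) (replicateM k w)) (trans (𝔼-* (M * M) (λ xs → 𝔼ⁿ k (λ ys → F (xs ++ ys))) (replicateM k w)) (cong (M * M *_) (sym (𝔼ⁿ-++ k k F))))) ⟩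
      2ℚ * (M * M * 𝔼ⁿ (k ℕ.+ k) F)
        ≡⟨ solve 2 (λ m f → :2 :* (m :* f) := m :* (:2 :* f)) refl (M * M) (𝔼ⁿ (k ℕ.+ k) F) ⟩
      M * M * (2ℚ * 𝔼ⁿ (k ℕ.+ k) F)
        ∎)
      where
      open ℚ.≤-Reasoning
      ½ : ℚ
      ½ = 1/ 2
      0≤½ : 0ℚ ≤ ½
      0≤½ = 1/-nonneg 2
      0<M : 0ℚ < M
      0<M = ℚ.<-≤-trans (fromℕ-pos 16) 16≤M
      0≤M : 0ℚ ≤ M
      0≤M = ℚ.<⇒≤ 0<M
      combine : 𝔼ⁿ k (λ xs → 𝔼ⁿ k (λ ys → 2ℚ * M * collisions xs ys - collisions xs ys * collisions xs ys)) ≡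
        2ℚ * M * 𝔼ⁿ k (λ xs → 𝔼ⁿ k (collisions xs)) - 𝔼ⁿ k (λ xs → 𝔼ⁿ k (λ ys → collisions xs ys * collisions xs ys))
      combine = trans (𝔼-cong (λ xs → trans (𝔼-- (λ ys → 2ℚ * M * collisions xs ys) (λ ys → collisions xs ys * collisions xs ys) (replicateM k w)) (cong (λ x → x - 𝔼ⁿ k (λ ys → collisions xs ys * collisions xs ys)) (𝔼-* (2ℚ * M) (collisions xs) (replicateM k w)))) (replicateM k w))
        (trans (𝔼-- (λ xs → 2ℚ * M * 𝔼ⁿ k (collisions xs)) (λ xs → 𝔼ⁿ k (λ ys → collisions xs ys * collisions xs ys)) (replicateM k w)) (cong (λ x → x - 𝔼ⁿ k (λ xs → 𝔼ⁿ k (λ ys → collisions xs ys * collisions xs ys))) (𝔼-* (2ℚ * M) (λ xs → 𝔼ⁿ k (collisions xs)) (replicateM k w))))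


-- Marking the returns of a walk

module Marks {N : ℕ} (H : Fin N → Bool) (ℓ : ℕ) where

  -- the node at which the walk makes its return number t to H, provided that
  -- it wanders outside H for at most j steps before the first visit to H and
  -- for at most ℓ steps between any two consecutive visits
  mark : ℕ → ℕ → List (Fin N) → Maybe (Fin N)
  mark t       j       []       = nothing
  mark zero    zero    (v ∷ vs) = if H v then just v else nothing
  mark zero    (suc j) (v ∷ vs) = if H v then just v else mark zero j vs
  mark (suc t) zero    (v ∷ vs) = if H v then mark t ℓ vs else nothing
  mark (suc t) (suc j) (v ∷ vs) = if H v then mark t ℓ vs else mark (suc t) j vs

  mark-∈ : ∀ t j vs {x} → mark t j vs ≡ just x → x ∈ vs
  mark-∈ zero    zero    (v ∷ vs) h with true ← H v | refl ← h = here refl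
  mark-∈ zero    (suc j) (v ∷ vs) h with H v
  ... | true with refl ← h = here refl
  ... | false = there (mark-∈ zero j vs h)
  mark-∈ (suc t) zero    (v ∷ vs) h with true ← H v = there (mark-∈ t ℓ vs h)
  mark-∈ (suc t) (suc j) (v ∷ vs) h with H v
  ... | true  = there (mark-∈ t ℓ vs h)
  ... | false = there (mark-∈ (suc t) j vs h)

-- The probability of finding a bad cycle

module Detection {N d : ℕ} .{{d≢0 : NonZero d}} .{{N≢0 : NonZero N}} (G : SignedGraph N) (access : Access G d) where

  open Access access using (oracle)
  open Semantics oracle
  open GraphAccess G access
  open Walk

  detectionProbability : ℕ → ℕ → Fin N → ℚ
  detectionProbability m L s = 𝔼 (λ r → 𝟙 (Maybe.is-just r)) (badCycle m L s)

  module _ (H : Fin N → Bool) (ℓ : ℕ) where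

    open Marks H ℓ
    open WatchedChain P P-sym P-nonneg P-row H

    -- A return takes at most `suc ℓ` steps and the first visit at most `j`, so the walk never ends
    -- before its mark is decided. The recursion of `mark` then mirrors those of `first` and
    -- `returns`.
    𝔼-mark : ∀ L t j f v → t ℕ.* suc ℓ ℕ.+ j ℕ.≤ L →
      𝔼 (λ vs → at f (mark t j vs)) (walk L v) ≡ first j (returns ℓ t f) v
    𝔼-mark zero zero zero f v _ with H v
    ... | true  = sym (ℚ.*-identityˡ (f v))
    ... | false = sym (ℚ.*-zeroˡ (f v))
    𝔼-mark (suc L) zero zero f v _ = trans (𝔼-walk-suc L v (λ vs → at f (mark zero zero vs))) (cases (H v) refl)
      where
      cases : ∀ b → H v ≡ b → (P ⋆ (λ w → 𝔼 (λ vs → at f (if H v then just v else nothing)) (walk L w))) v ≡ inside v * f v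
      cases b eq = trans (·-congˡ (P v) (λ w → 𝔼-const (at f (if H v then just v else nothing)) (walk L w)))
        (trans (sum-*ʳ (at f (if H v then just v else nothing)) (P v)) (trans (cong (_* at f (if H v then just v else nothing)) (P-row v))
          (trans (ℚ.*-identityˡ (at f (if H v then just v else nothing))) (value (H v)))))
        where
        value : ∀ b → at f (if b then just v else nothing) ≡ 𝟙 b * f v
        value true  = sym (ℚ.*-identityˡ (f v))
        value false = sym (ℚ.*-zeroˡ (f v))
    𝔼-mark (suc L) zero (suc j) f v (ℕ.s≤s j≤L) = trans (𝔼-walk-suc L v (λ vs → at f (mark zero (suc j) vs))) (cases (H v))
      where
      cases : ∀ b → (P ⋆ (λ w → 𝔼 (λ vs → at f (if b then just v else mark zero j vs)) (walk L w))) v ≡ 𝟙 b * f v + 𝟙 (not b) * (P ⋆ first j f) v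
      cases true = begin
        (P ⋆ (λ w → 𝔼 (λ vs → f v) (walk L w))) v  ≡⟨ ·-congˡ (P v) (λ w → 𝔼-const (f v) (walk L w)) ⟩
        P v · (λ _ → f v)  ≡⟨ trans (sum-*ʳ (f v) (P v)) (cong (_* f v) (P-row v)) ⟩
        1ℚ * f v  ≡⟨ solve 2 (λ x y → :1 :* x := :1 :* x :+ :0 :* y) refl (f v) ((P ⋆ first j f) v) ⟩
        1ℚ * f v + 0ℚ * (P ⋆ first j f) v  ∎
        where open ≡-Reasoning
      cases false = trans (·-congˡ (P v) (λ w → 𝔼-mark L zero j f w j≤L))
        (solve 2 (λ x y → y := :0 :* x :+ :1 :* y) refl (f v) ((P ⋆ first j f) v))
    𝔼-mark (suc L) (suc t) j f v (ℕ.s≤s h) = trans (𝔼-walk-suc L v (λ vs → at f (mark (suc t) j vs))) (value j h)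
      where
      F : Fin N → ℚ
      F = returns ℓ (suc t) f
      t*+ℓ≤ : t ℕ.* suc ℓ ℕ.+ ℓ ℕ.≤ L
      t*+ℓ≤ = ℕ.≤-trans (ℕ.≤-reflexive (ℕ.+-comm (t ℕ.* suc ℓ) ℓ)) (ℕ.≤-trans (ℕ.m≤m+n (ℓ ℕ.+ t ℕ.* suc ℓ) j) h)
      arrive : (P ⋆ (λ w → 𝔼 (λ vs → at f (mark t ℓ vs)) (walk L w))) v ≡ F v
      arrive = ·-congˡ (P v) (λ w → 𝔼-mark L t ℓ f w t*+ℓ≤)
      value : ∀ j → ℓ ℕ.+ t ℕ.* suc ℓ ℕ.+ j ℕ.≤ L → (P ⋆ (λ w → 𝔼 (λ vs → at f (mark (suc t) j (v ∷ vs))) (walk L w))) v ≡ first j F v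
      value zero _ = cases (H v)
        where
        cases : ∀ b → (P ⋆ (λ w → 𝔼 (λ vs → at f (if b then mark t ℓ vs else nothing)) (walk L w))) v ≡ 𝟙 b * F v
        cases true  = trans arrive (sym (ℚ.*-identityˡ (F v)))
        cases false = trans (·-congˡ (P v) (λ w → 𝔼-const 0ℚ (walk L w))) (trans (·-0ʳ (P v)) (sym (ℚ.*-zeroˡ (F v))))
      value (suc j) h = cases (H v)
        where
        j≤ : suc t ℕ.* suc ℓ ℕ.+ j ℕ.≤ L
        j≤ = ℕ.≤-trans (ℕ.≤-reflexive (sym (ℕ.+-suc (ℓ ℕ.+ t ℕ.* suc ℓ) j))) h
        cases : ∀ b → (P ⋆ (λ w → 𝔼 (λ vs → at f (if b then mark t ℓ vs else mark (suc t) j vs)) (walk L w))) v ≡ 𝟙 b * F v + 𝟙 (not b) * (P ⋆ first j F) v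
        cases true  = trans arrive (solve 2 (λ x y → x := :1 :* x :+ :0 :* y) refl (F v) ((P ⋆ first j F) v))
        cases false = trans (·-congˡ (P v) (λ w → 𝔼-mark L (suc t) j f w j≤)) (solve 2 (λ x y → y := :0 :* x :+ :1 :* y) refl (F v) ((P ⋆ first j F) v))

  module _ (m : ℕ) .{{m≢0 : NonZero m}} (i : ℕ) (8N≤2^i : 8 ℕ.* N ℕ.≤ 2 ℕ.^ i)
    (k : ℕ) (k-large : fromℕ 262144 * (fromℕ m * fromℕ m) * fromℕ N ≤ fromℕ k * fromℕ k) where

    open Clustering P P-sym P-nonneg P-row pos neg pos-sym d degree-sum pos≤P m i 8N≤2^i public

    -- `T` returns of at most `suc ℓ` steps, and one more block for the initial allowance `ℓ` of
    -- `mark`.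
    walkLength : ℕ
    walkLength = suc T ℕ.* suc ℓ

    neg-sym : ∀ u v → neg u v ≡ neg v u
    neg-sym u v = cong (hasSign Sign.-) (SignedGraph.symmetric G u v)

    -- Marking the returns `t` and `suc t` of each walk realises the blend as the expected sum of
    -- point masses. A negative edge between marks joins two visited nodes, so it is found.
    detects : ∀ H s t → H s ≡ true → t ℕ.< T →
      1ℚ ≤ fromℕ 4 * 𝑁 * (blend H s t · blend H s t) →
      Δ * (blend H s t · blend H s t) ≤ fromℕ 16 * ν * conflict H s t →
      1ℚ ≤ 2ℚ * detectionProbability (k ℕ.+ k) walkLength s
    detects H s t s∈H t<T spread many = subst (λ x → 1ℚ ≤ 2ℚ * x) (sym (𝔼-badCycle (k ℕ.+ k) walkLength s (λ r → 𝟙 (Maybe.is-just r))))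
      (detection {λ ws → 𝟙 (Maybe.is-just (verdict ws))} 16≤M κ-small pointwise)
      where
      open Marks H ℓ
      open WatchedChain P P-sym P-nonneg P-row H
      open ℚ.≤-Reasoning
      q : Fin N → ℚ
      q = blend H s t
      law-mark : ∀ t f → t ℕ.* suc ℓ ℕ.+ ℓ ℕ.≤ walkLength → 𝔼 (λ vs → at f (mark t ℓ vs)) (walk walkLength s) ≡ law H s t · f
      law-mark t f h = trans (𝔼-mark H ℓ walkLength t ℓ f s h) (trans (first-returns ℓ t f s s∈H) (sym (law-· H s t f)))
      t*+ℓ≤ : ∀ {t} → t ℕ.≤ T → t ℕ.* suc ℓ ℕ.+ ℓ ℕ.≤ walkLength
      t*+ℓ≤ {t} t≤T = ℕ.≤-trans (ℕ.+-mono-≤ (ℕ.*-monoˡ-≤ (suc ℓ) t≤T) (ℕ.n≤1+n ℓ)) (ℕ.≤-reflexive (ℕ.+-comm (T ℕ.* suc ℓ) (suc ℓ)))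
      q-law : ∀ f → 𝔼 (λ vs → at f (mark t ℓ vs) + at f (mark (suc t) ℓ vs)) (walk walkLength s) ≡ q · f
      q-law f = trans (𝔼-+ (λ vs → at f (mark t ℓ vs)) (λ vs → at f (mark (suc t) ℓ vs)) (walk walkLength s))
        (trans (cong₂ _+_ (law-mark t f (t*+ℓ≤ (ℕ.<⇒≤ t<T))) (law-mark (suc t) f (t*+ℓ≤ t<T)))
          (sym (·-+ˡ (law H s t) (law H s (suc t)) f)))
      open IID oracle (walk walkLength s)
      open Collisions (mark t ℓ) (mark (suc t) ℓ) q (blend-nonneg H s t) q-law neg neg-sym k
      qq : ℚ
      qq = q · q
      0≤r : ∀ u → 0ℚ ≤ r u
      0≤r u = ·-nonneg (λ v → 𝟙-nonneg (neg u v)) (blend-nonneg H s t)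
      0≤μ : 0ℚ ≤ μ
      0≤μ = ·-nonneg (blend-nonneg H s t) 0≤r
      Δ≤ : Δ ≤ fromℕ 64 * ν * 𝑁 * μ
      Δ≤ = begin
        Δ  ≡⟨ ℚ.*-identityʳ Δ ⟨
        Δ * 1ℚ  ≤⟨ *-monoˡ-≤ 0≤Δ spread ⟩
        Δ * (fromℕ 4 * 𝑁 * qq)  ≡⟨ solve 3 (λ D n x → D :* (:ℕ 4 :* n :* x) := :ℕ 4 :* n :* (D :* x)) refl Δ 𝑁 qq ⟩
        fromℕ 4 * 𝑁 * (Δ * qq)  ≤⟨ *-monoˡ-≤ (*-nonneg (fromℕ-nonneg 4) (fromℕ-nonneg N)) many ⟩
        fromℕ 4 * 𝑁 * (fromℕ 16 * ν * μ)  ≡⟨ solve 3 (λ N n x → :ℕ 4 :* N :* (:ℕ 16 :* n :* x) := :ℕ 64 :* n :* N :* x) refl 𝑁 ν μ ⟩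
        fromℕ 64 * ν * 𝑁 * μ  ∎
      -- 262144 = 4096 · 64: the 64 comes from `Δ≤`, and 4096 = 16² · 16 is what `q-small` consumes.
      M-large : fromℕ 4096 * ν * Δ ≤ M
      M-large = begin
        fromℕ 4096 * ν * Δ  ≤⟨ *-monoˡ-≤ (*-nonneg (fromℕ-nonneg 4096) 0≤ν) Δ≤ ⟩
        fromℕ 4096 * ν * (fromℕ 64 * ν * 𝑁 * μ)  ≡⟨ solve 3 (λ n N m → :ℕ 4096 :* n :* (:ℕ 64 :* n :* N :* m) := :ℕ 262144 :* (n :* n) :* N :* m) refl ν 𝑁 μ ⟩
        fromℕ 262144 * (ν * ν) * 𝑁 * μ  ≤⟨ *-monoʳ-≤ 0≤μ k-large ⟩
        K * K * μ  ∎
      1≤fromℕ : ∀ n .{{_ : NonZero n}} → 1ℚ ≤ fromℕ n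
      1≤fromℕ (suc n) = fromℕ-mono-≤ {1} {suc n} (ℕ.s≤s ℕ.z≤n)
      16≤M : fromℕ 16 ≤ M
      16≤M = begin
        fromℕ 16  ≤⟨ fromℕ-mono-≤ {16} {4096} (ℕ.≤ᵇ⇒≤ 16 4096 _) ⟩
        fromℕ 4096  ≡⟨ solve 0 (:ℕ 4096 := :ℕ 4096 :* :1 :* :1) refl ⟩
        fromℕ 4096 * 1ℚ * 1ℚ  ≤⟨ *-mono-≤ (ℚ.≤-trans (fromℕ-nonneg 4096) (ℚ.≤-reflexive (sym (ℚ.*-identityʳ (fromℕ 4096))))) 0≤Δ (*-monoˡ-≤ (fromℕ-nonneg 4096) (1≤fromℕ m)) (1≤fromℕ d) ⟩
        fromℕ 4096 * ν * Δ  ≤⟨ M-large ⟩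
        M  ∎
      0≤Kμ : 0ℚ ≤ K * μ
      0≤Kμ = *-nonneg 0≤K 0≤μ
      -- The square of `q v` is one term of ‖q‖², which `many` bounds by the conflicts μ; no
      -- separate bound on the maximum of q is needed.
      q-small : ∀ v → fromℕ 16 * Δ * q v ≤ K * μ
      q-small v = square-cancel-≤ 0≤Kμ (begin
        fromℕ 16 * Δ * q v * (fromℕ 16 * Δ * q v)  ≡⟨ solve 2 (λ D x → :ℕ 16 :* D :* x :* (:ℕ 16 :* D :* x) := :ℕ 256 :* D :* (D :* (x :* x))) refl Δ (q v) ⟩
        fromℕ 256 * Δ * (Δ * (q v * q v))  ≤⟨ *-monoˡ-≤ (*-nonneg (fromℕ-nonneg 256) 0≤Δ) (ℚ.≤-trans (*-monoˡ-≤ 0≤Δ (term≤sum (λ u → square-nonneg (q u)) v)) many) ⟩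
        fromℕ 256 * Δ * (fromℕ 16 * ν * μ)  ≡⟨ solve 3 (λ D n m → :ℕ 256 :* D :* (:ℕ 16 :* n :* m) := :ℕ 4096 :* n :* D :* m) refl Δ ν μ ⟩
        fromℕ 4096 * ν * Δ * μ  ≤⟨ *-monoʳ-≤ 0≤μ M-large ⟩
        K * K * μ * μ  ≡⟨ solve 2 (λ k m → k :* k :* m :* m := k :* m :* (k :* m)) refl K μ ⟩
        K * μ * (K * μ)  ∎)
      neg-degree : ∀ u → sum (λ v → 𝟙 (neg u v)) ≤ Δ
      neg-degree u = ℚ.≤-trans (sum-mono-≤ (λ v → ≤-by (𝟙 (pos u v)) (𝟙-nonneg (pos u v)) (ℚ.+-comm (𝟙 (pos u v)) (𝟙 (neg u v))))) (degree-sum u)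
      r-small : ∀ u → fromℕ 16 * r u ≤ K * μ
      r-small u = *-cancelˡ-≤ Δ (fromℕ-pos d) (begin
        Δ * (fromℕ 16 * r u)  ≡⟨ solve 2 (λ D x → D :* (:ℕ 16 :* x) := :ℕ 16 :* D :* x) refl Δ (r u) ⟩
        fromℕ 16 * Δ * r u  ≡⟨ ·-*ʳ (fromℕ 16 * Δ) (λ v → 𝟙 (neg u v)) q ⟨
        (λ v → 𝟙 (neg u v)) · (λ v → fromℕ 16 * Δ * q v)  ≤⟨ ·-monoʳ (λ v → 𝟙-nonneg (neg u v)) q-small ⟩
        (λ v → 𝟙 (neg u v)) · (λ _ → K * μ)  ≡⟨ sum-*ʳ (K * μ) (λ v → 𝟙 (neg u v)) ⟩
        sum (λ v → 𝟙 (neg u v)) * (K * μ)  ≤⟨ *-monoʳ-≤ 0≤Kμ (neg-degree u) ⟩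
        Δ * (K * μ)  ∎)
      -- Bounding one of the two factors `r` uniformly leaves μ.
      κ-small : fromℕ 16 * κ ≤ K * μ * μ
      κ-small = begin
        fromℕ 16 * κ  ≡⟨ ·-*ʳ (fromℕ 16) q r² ⟨
        q · (λ u → fromℕ 16 * (r u * r u))  ≤⟨ ·-monoʳ (blend-nonneg H s t) (λ u → ℚ.≤-trans (ℚ.≤-reflexive (sym (ℚ.*-assoc (fromℕ 16) (r u) (r u)))) (*-monoʳ-≤ (0≤r u) (r-small u))) ⟩
        q · (λ u → K * μ * r u)  ≡⟨ ·-*ʳ (K * μ) q r ⟩
        K * μ * μ  ∎
      -- With a verdict this is 0 ≤ (M - X)²; without one no negative edge joins visited nodes, so X
      -- = 0.
      pointwise : ∀ xs ys → 2ℚ * M * collisions xs ys - collisions xs ys * collisions xs ys ≤ M * M * 𝟙 (Maybe.is-just (verdict (xs ++ ys)))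
      pointwise xs ys = cases (Maybe.is-just (verdict (xs ++ ys))) refl
        where
        X : ℚ
        X = collisions xs ys
        at-0 : ∀ {f : Fin N → ℚ} x → (∀ u → x ≡ just u → f u ≡ 0ℚ) → at f x ≡ 0ℚ
        at-0 (just u) h = h u refl
        at-0 nothing  h = refl
        φ-0 : ∀ {f : Fin N → ℚ} ws → (∀ u → u ∈ ws → f u ≡ 0ℚ) → φ ws f ≡ 0ℚ
        φ-0 ws h = cong₂ _+_ (at-0 (mark t ℓ ws) (λ u eq → h u (mark-∈ t ℓ ws eq))) (at-0 (mark (suc t) ℓ ws) (λ u eq → h u (mark-∈ (suc t) ℓ ws eq)))
        X≡0 : Maybe.is-just (verdict (xs ++ ys)) ≡ false → X ≡ 0ℚ
        X≡0 h = sumᴸ-0 ys (All.tabulate (λ {y} y∈ → φ-0 y (λ v v∈ → sumᴸ-0 xs (All.tabulate (λ {x} x∈ → φ-0 x (λ u u∈ →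
          cong 𝟙 (verdict-nothing⁻ (xs ++ ys) h (Mem.∈-concat⁺′ u∈ (Mem.∈-++⁺ˡ x∈)) (Mem.∈-concat⁺′ v∈ (Mem.∈-++⁺ʳ xs y∈)))))))))
        cases : ∀ b → Maybe.is-just (verdict (xs ++ ys)) ≡ b → 2ℚ * M * X - X * X ≤ M * M * 𝟙 b
        cases true  _ = ≤-by ((M - X) * (M - X)) (square-nonneg (M - X)) (solve 2 (λ m x → m :* m :* :1 := (:2 :* m :* x :- x :* x) :+ (m :- x) :* (m :- x)) refl M X)
        cases false h = ℚ.≤-reflexive (trans (cong (λ x → 2ℚ * M * x - x * x) (X≡0 h)) (solve 1 (λ m → :2 :* m :* :0 :- :0 :* :0 := m :* m :* :0) refl M))


-- The main loop

module Repetition (I : Input) (G : SignedGraph (Input.#nodes I)) (access : Access G (Input.degreeBound I))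
  (w L : ℕ) where

  open Input I
  open Access access using (oracle)
  open Semantics oracle
  open Detection G access using (detectionProbability)
  open GraphAccess.Walk G access using (queries-badCycle)

  rejection : ℚ
  rejection = 1/ #nodes * sum (detectionProbability w L)

  acceptance : ℕ → ℚ
  acceptance zero    = 1ℚ
  acceptance (suc t) = (1ℚ - rejection) * acceptance t

  -- `rest` stands for the anonymous case distinction on the result of `badCycle`. For the tester
  -- all equations hold by computation.
  record IsLoop (F : ℕ → Program #nodes degreeBound Bool) : Set where
    field
      rest : (ℕ → Fin #nodes → Maybe (List (Fin #nodes)) → Program #nodes degreeBound Bool)
      F-zero : F zero ≡ return true
      F-suc  : ∀ t → F (suc t) ≡ (uniform #nodes return >>= λ s → badCycle w L s >>= rest t s)
      rest-just    : ∀ t s c → rest t s (just c) ≡ return false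
      rest-nothing : ∀ t s → rest t s nothing ≡ F t

  module _ {F : ℕ → Program #nodes degreeBound Bool} (isLoop : IsLoop F) where

    open IsLoop isLoop

    acceptance-loop : ∀ t → 𝔼 𝟙 (F t) ≡ acceptance t
    acceptance-loop zero    = cong (𝔼 𝟙) F-zero
    acceptance-loop (suc t) = begin
      𝔼 𝟙 (F (suc t))
        ≡⟨ cong (𝔼 𝟙) (F-suc t) ⟩
      1/ #nodes * sum (λ s → 𝔼 𝟙 (badCycle w L s >>= rest t s))
        ≡⟨ cong (1/ #nodes *_) (trans (sum-cong-≗ {#nodes} round) (sum-*ʳ (acceptance t) (λ s → 1ℚ - detectionProbability w L s))) ⟩
      1/ #nodes * (sum (λ s → 1ℚ - detectionProbability w L s) * acceptance t)
        ≡⟨ ℚ.*-assoc (1/ #nodes) (sum (λ s → 1ℚ - detectionProbability w L s)) (acceptance t) ⟨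
      1/ #nodes * sum (λ s → 1ℚ - detectionProbability w L s) * acceptance t
        ≡⟨ cong (_* acceptance t) average ⟩
      (1ℚ - rejection) * acceptance t
        ∎
      where
      open ≡-Reasoning
      result : ∀ s c → 𝔼 𝟙 (rest t s c) ≡ (1ℚ - 𝟙 (Maybe.is-just c)) * acceptance t
      result s (just c) = trans (cong (𝔼 𝟙) (rest-just t s c)) (sym (ℚ.*-zeroˡ (acceptance t)))
      result s nothing  = trans (cong (𝔼 𝟙) (rest-nothing t s)) (trans (acceptance-loop t) (sym (ℚ.*-identityˡ (acceptance t))))
      round : ∀ s → 𝔼 𝟙 (badCycle w L s >>= rest t s) ≡ (1ℚ - detectionProbability w L s) * acceptance t
      round s = begin
        𝔼 𝟙 (badCycle w L s >>= rest t s)  ≡⟨ 𝔼->>= 𝟙 (badCycle w L s) (rest t s) ⟩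
        𝔼 (λ c → 𝔼 𝟙 (rest t s c)) (badCycle w L s)  ≡⟨ 𝔼-cong (λ c → trans (result s c) (ℚ.*-comm (1ℚ - 𝟙 (Maybe.is-just c)) (acceptance t))) (badCycle w L s) ⟩
        𝔼 (λ c → acceptance t * (1ℚ - 𝟙 (Maybe.is-just c))) (badCycle w L s)  ≡⟨ trans (𝔼-* (acceptance t) (λ c → 1ℚ - 𝟙 (Maybe.is-just c)) (badCycle w L s)) (cong (acceptance t *_) (trans (𝔼-- (λ _ → 1ℚ) (λ c → 𝟙 (Maybe.is-just c)) (badCycle w L s)) (cong (λ x → x - detectionProbability w L s) (𝔼-const 1ℚ (badCycle w L s))))) ⟩
        acceptance t * (1ℚ - detectionProbability w L s)  ≡⟨ ℚ.*-comm (acceptance t) (1ℚ - detectionProbability w L s) ⟩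
        (1ℚ - detectionProbability w L s) * acceptance t  ∎
      average : 1/ #nodes * sum (λ s → 1ℚ - detectionProbability w L s) ≡ 1ℚ - rejection
      average = begin
        1/ #nodes * sum (λ s → 1ℚ - detectionProbability w L s)  ≡⟨ cong (1/ #nodes *_) (sum-- (λ _ → 1ℚ) (detectionProbability w L)) ⟩
        1/ #nodes * (sum {#nodes} (λ _ → 1ℚ) - sum (detectionProbability w L))  ≡⟨ solve 3 (λ r x y → r :* (x :- y) := r :* x :- r :* y) refl (1/ #nodes) (sum {#nodes} (λ _ → 1ℚ)) (sum (detectionProbability w L)) ⟩
        1/ #nodes * sum {#nodes} (λ _ → 1ℚ) - rejection  ≡⟨ cong (λ x → x - rejection) (1/-average #nodes 1ℚ) ⟩
        1ℚ - rejection  ∎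

    queries-loop : ∀ t → queries oracle (F t) ℕ.≤ t ℕ.* (w ℕ.* (L ℕ.* degreeBound) ℕ.+ w ℕ.* suc L ℕ.* degreeBound)
    queries-loop zero    = ℕ.≤-reflexive (cong (queries oracle) F-zero)
    queries-loop (suc t) = ℕ.≤-trans (ℕ.≤-reflexive (cong (queries oracle) (F-suc t)))
      (max≤ {#nodes} (λ s → queries oracle (badCycle w L s >>= rest t s)) _ (λ s → queries->>= (badCycle w L s) (queries-badCycle w L s) (always (result s) (badCycle w L s))))
      where
      result : ∀ s c → queries oracle (rest t s c) ℕ.≤ t ℕ.* (w ℕ.* (L ℕ.* degreeBound) ℕ.+ w ℕ.* suc L ℕ.* degreeBound)
      result s (just c) = ℕ.≤-trans (ℕ.≤-reflexive (cong (queries oracle) (rest-just t s c))) ℕ.z≤n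
      result s nothing  = ℕ.≤-trans (ℕ.≤-reflexive (cong (queries oracle) (rest-nothing t s))) (queries-loop t)

module _ (repetitions #walks ℓ : Input → ℕ) (I : Input)
  (G : SignedGraph (Input.#nodes I)) (access : Access G (Input.degreeBound I)) where

  open Input I
  open Access access using (oracle)
  open Semantics oracle
  open Repetition I G access (#walks I) (ℓ I)

  record Analysis (p : Program #nodes degreeBound Bool) (t : ℕ) : Set where
    constructor analysis
    field
      accepts : 𝔼 𝟙 p ≡ acceptance t
      queries≤ : queries oracle p ℕ.≤ t ℕ.* (#walks I ℕ.* (ℓ I ℕ.* degreeBound) ℕ.+ #walks I ℕ.* suc (ℓ I) ℕ.* degreeBound)

  loop-analysis : (F : ℕ → Program #nodes degreeBound Bool) → IsLoop F → ∀ t → Analysis (F t) t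
  loop-analysis F isLoop t = analysis (acceptance-loop isLoop t) (queries-loop isLoop t)

  tester-analysis : Analysis (randomWalkTester repetitions #walks ℓ I) (repetitions I)
  -- The loop of randomWalkTester is local to it and cannot be named here, so
  -- the argument _ is left to unification.
  tester-analysis with repetitions I | loop-analysis _ record
    { F-zero       = refl
    ; F-suc        = λ t → refl
    ; rest-just    = λ t s c → refl
    ; rest-nothing = λ t s → refl
    }
  ... | t | analysed = analysed t


-- Distance to clusterability

sumᴸ-tabulate : {A : Set} (f : A → ℚ) (g : Fin n → A) → sumᴸ f (tabulate g) ≡ sum (λ i → f (g i))
sumᴸ-tabulate {zero}  f g = refl
sumᴸ-tabulate {suc n} f g = cong (f (g zero) +_) (sumᴸ-tabulate f (g ∘ suc))

sumᴸ-map : {A B : Set} (f : B → ℚ) (g : A → B) (xs : List A) → sumᴸ f (List.map g xs) ≡ sumᴸ (λ x → f (g x)) xs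
sumᴸ-map f g []       = refl
sumᴸ-map f g (x ∷ xs) = cong (f (g x) +_) (sumᴸ-map f g xs)

sumᴸ-cartesianProduct : {A B : Set} (f : A × B → ℚ) (xs : List A) (ys : List B) →
  sumᴸ f (cartesianProduct xs ys) ≡ sumᴸ (λ x → sumᴸ (λ y → f (x , y)) ys) xs
sumᴸ-cartesianProduct f []       ys = refl
sumᴸ-cartesianProduct f (x ∷ xs) ys = trans (sumᴸ-++ f (List.map (x ,_) ys) (cartesianProduct xs ys))
  (cong₂ _+_ (sumᴸ-map f (x ,_) ys) (sumᴸ-cartesianProduct f xs ys))

sumᴸ-filter-≤ : {A : Set} {P : A → Set} (P? : ∀ x → Dec (P x)) {f : A → ℚ} → (∀ x → 0ℚ ≤ f x) → ∀ xs → sumᴸ f (filter P? xs) ≤ sumᴸ f xs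
sumᴸ-filter-≤ P? 0≤f [] = ℚ.≤-refl
sumᴸ-filter-≤ P? {f} 0≤f (x ∷ xs) with does (P? x)
... | true  = ℚ.+-monoʳ-≤ (f x) (sumᴸ-filter-≤ P? 0≤f xs)
... | false = ℚ.≤-trans (sumᴸ-filter-≤ P? 0≤f xs) (≤-by (f x) (0≤f x) (ℚ.+-comm (f x) (sumᴸ f xs)))

length-filter-≤-sumᴸ : {A : Set} {P : A → Set} (P? : ∀ x → Dec (P x)) {f : A → ℚ} → (∀ x → 0ℚ ≤ f x) → (∀ x → P x → 1ℚ ≤ f x) →
  ∀ xs → fromℕ (length (filter P? xs)) ≤ sumᴸ f xs
length-filter-≤-sumᴸ P? 0≤f 1≤f [] = ℚ.≤-refl
length-filter-≤-sumᴸ P? {f} 0≤f 1≤f (x ∷ xs) with P? x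
... | yes p = ℚ.≤-trans (ℚ.≤-reflexive (fromℕ-suc (length (filter P? xs)))) (ℚ.+-mono-≤ (1≤f x p) (length-filter-≤-sumᴸ P? 0≤f 1≤f xs))
... | no _  = ℚ.≤-trans (length-filter-≤-sumᴸ P? 0≤f 1≤f xs) (≤-by (f x) (0≤f x) (ℚ.+-comm (f x) (sumᴸ f xs)))

agreeing : Bool → Maybe Sign → Maybe Sign
agreeing true  (just Sign.+) = just Sign.+
agreeing false (just Sign.-) = just Sign.-
agreeing _     _             = nothing

module Cleaning {N k : ℕ} (G : SignedGraph N) (c : Fin N → Fin k) where

  open SignedGraph G

  together : Fin N → Fin N → Bool
  together u v = does (c u Fin.≟ c v)

  together-sym : ∀ u v → together u v ≡ together v u
  together-sym u v with c u Fin.≟ c v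
  ... | yes eq = sym (dec-true (c v Fin.≟ c u) (sym eq))
  ... | no neq = sym (dec-false (c v Fin.≟ c u) (neq ∘ sym))

  -- Deleting the edges that contradict the labelling is enough; none is added or switched.
  cleaned : SignedGraph N
  cleaned = record
    { edge      = λ u v → agreeing (together u v) (edge u v)
    ; symmetric = λ u v → cong₂ agreeing (together-sym u v) (symmetric u v)
    ; loopless  = λ v → trans (cong (agreeing (together v v)) (loopless v)) (agreeing-nothing (together v v))
    }
    where
    agreeing-nothing : ∀ b → agreeing b nothing ≡ nothing
    agreeing-nothing true  = refl
    agreeing-nothing false = refl

  cleaned-clusterable : Clusterable cleaned
  cleaned-clusterable = k , c
    , (λ u v e → does-true (c u Fin.≟ c v) (agreeing-+ (together u v) (edge u v) e))
    , (λ u v e → does-false (c u Fin.≟ c v) (agreeing-- (together u v) (edge u v) e))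
    where
    agreeing-+ : ∀ b e → agreeing b e ≡ just Sign.+ → b ≡ true
    agreeing-+ true  (just Sign.+) _ = refl
    agreeing-+ false (just Sign.-) ()
    agreeing-- : ∀ b e → agreeing b e ≡ just Sign.- → b ≡ false
    agreeing-- false (just Sign.-) _ = refl
    agreeing-- true  (just Sign.+) ()

  badPair : Fin N → Fin N → ℚ
  badPair u v = 𝟙 (hasSign Sign.+ (edge u v)) * 𝟙 (not (together u v)) + 𝟙 (hasSign Sign.- (edge u v)) * 𝟙 (together u v)

  badPair-nonneg : ∀ u v → 0ℚ ≤ badPair u v
  badPair-nonneg u v = +-nonneg (*-nonneg (𝟙-nonneg (hasSign Sign.+ (edge u v))) (𝟙-nonneg (not (together u v)))) (*-nonneg (𝟙-nonneg (hasSign Sign.- (edge u v))) (𝟙-nonneg (together u v)))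

  -- Dropping the condition u < v loses a factor 2, which the constants absorb.
  modifications≤ : fromℕ (modifications G cleaned) ≤ sum₂ badPair
  modifications≤ = begin
    fromℕ (modifications G cleaned)
      ≤⟨ length-filter-≤-sumᴸ _ bad-nonneg (λ (u , v) → changed (together u v) (edge u v)) (nodePairs N) ⟩
    sumᴸ bad (nodePairs N)
      ≤⟨ sumᴸ-filter-≤ _ bad-nonneg (cartesianProduct (allFin N) (allFin N)) ⟩
    sumᴸ bad (cartesianProduct (allFin N) (allFin N))
      ≡⟨ sumᴸ-cartesianProduct bad (allFin N) (allFin N) ⟩
    sumᴸ (λ u → sumᴸ (badPair u) (allFin N)) (allFin N)
      ≡⟨ trans (sumᴸ-tabulate (λ u → sumᴸ (badPair u) (allFin N)) id) (sum-cong-≗ {N} (λ u → sumᴸ-tabulate (badPair u) id)) ⟩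
    sum₂ badPair
      ∎
    where
    open ℚ.≤-Reasoning
    bad : Fin N × Fin N → ℚ
    bad (u , v) = badPair u v
    bad-nonneg : ∀ x → 0ℚ ≤ bad x
    bad-nonneg (u , v) = badPair-nonneg u v
    changed : ∀ b e → e ≢ agreeing b e → 1ℚ ≤ 𝟙 (hasSign Sign.+ e) * 𝟙 (not b) + 𝟙 (hasSign Sign.- e) * 𝟙 b
    changed true  (just Sign.+) h = contradiction refl h
    changed true  (just Sign.-) h = ℚ.≤-refl
    changed false (just Sign.+) h = ℚ.≤-refl
    changed false (just Sign.-) h = contradiction refl h
    changed true  nothing       h = contradiction refl h
    changed false nothing       h = contradiction refl h

  far⇒many-bad : ∀ {ε d} → Far ε d Clusterable G → ε * fromℕ (d ℕ.* N) ≤ sum₂ badPair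
  far⇒many-bad far = ℚ.≤-trans (far cleaned cleaned-clusterable) modifications≤

-- When every node has its own label, at most d N ordered pairs are bad. So for ε > 1 no graph needs
-- rejection, and the tester may be idle.
far⇒ε≤1 : ∀ {N d ε} .{{_ : NonZero N}} .{{_ : NonZero d}} (G : SignedGraph N) → Access G d → Far ε d Clusterable G → ε ≤ 1ℚ
far⇒ε≤1 {N} {d} {ε} G access far = ℚ.*-cancelʳ-≤-pos (fromℕ (d ℕ.* N)) {{ℚ.positive (fromℕ-pos (d ℕ.* N) {{ℕ.m*n≢0 d N}})}} (begin
  ε * fromℕ (d ℕ.* N)  ≤⟨ far⇒many-bad {ε} {d} far ⟩
  sum₂ badPair  ≤⟨ sum-mono-≤ (λ u → ℚ.≤-trans (sum-mono-≤ (λ v → bad≤ (pos u v) (neg u v) (together u v))) (degree-sum u)) ⟩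
  sum {N} (λ _ → fromℕ d)  ≡⟨ sum-const N (fromℕ d) ⟩
  fromℕ N * fromℕ d  ≡⟨ trans (ℚ.*-comm (fromℕ N) (fromℕ d)) (sym (fromℕ-* d N)) ⟩
  fromℕ (d ℕ.* N)  ≡⟨ ℚ.*-identityˡ (fromℕ (d ℕ.* N)) ⟨
  1ℚ * fromℕ (d ℕ.* N)  ∎)
  where
  open ℚ.≤-Reasoning
  open Cleaning G id
  open GraphAccess G access
  bad≤ : ∀ x y b → 𝟙 x * 𝟙 (not b) + 𝟙 y * 𝟙 b ≤ 𝟙 x + 𝟙 y
  bad≤ x y true  = ≤-by (𝟙 x) (𝟙-nonneg x) (solve 2 (λ x y → x :+ y := (x :* :0 :+ y :* :1) :+ x) refl (𝟙 x) (𝟙 y))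
  bad≤ x y false = ≤-by (𝟙 y) (𝟙-nonneg y) (solve 2 (λ x y → x :+ y := (x :* :1 :+ y :* :0) :+ y) refl (𝟙 x) (𝟙 y))

module Soundness {N d : ℕ} .{{d≢0 : NonZero d}} .{{N≢0 : NonZero N}} (G : SignedGraph N) (access : Access G d)
  (m : ℕ) .{{m≢0 : NonZero m}} (i : ℕ) (8N≤2^i : 8 ℕ.* N ℕ.≤ 2 ℕ.^ i)
  (k : ℕ) (k-large : fromℕ 262144 * (fromℕ m * fromℕ m) * fromℕ N ≤ fromℕ k * fromℕ k) where

  open Access access using (oracle)
  open Semantics oracle
  open Detection G access using (detectionProbability; walkLength; good-labelling; detects)
  open GraphAccess G access
  open Walk

  -- By contraposition: rare detection yields a labelling whose bad pairs, times 32 m, number at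
  -- most 26 d N, whereas farness and m ε ≥ 1 demand 32 d N.
  far⇒detected : ∀ {ε} → 1ℚ ≤ fromℕ m * ε → Far ε d Clusterable G →
    fromℕ N ≤ fromℕ 8 * fromℕ m * sum (detectionProbability (k ℕ.+ k) (walkLength m i 8N≤2^i k k-large))
  far⇒detected {ε} 1≤mε far = ℚ.≮⇒≥ (λ rare → refute (good-labelling m i 8N≤2^i k k-large Det Det-nonneg (detects m i 8N≤2^i k k-large) rare))
    where
    open ℚ.≤-Reasoning
    Det : Fin N → ℚ
    Det = detectionProbability (k ℕ.+ k) (walkLength m i 8N≤2^i k k-large)
    Det-nonneg : ∀ s → 0ℚ ≤ Det s
    Det-nonneg s = 𝔼-nonneg (λ c → 𝟙-nonneg (Maybe.is-just c)) (badCycle (k ℕ.+ k) (walkLength m i 8N≤2^i k k-large) s)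
    ν Δ 𝑁 : ℚ
    ν = fromℕ m
    Δ = fromℕ d
    𝑁 = fromℕ N
    0≤ν : 0ℚ ≤ ν
    0≤ν = fromℕ-nonneg m
    0≤ΔN : 0ℚ ≤ Δ * 𝑁
    0≤ΔN = *-nonneg (fromℕ-nonneg d) (fromℕ-nonneg N)
    refute : ¬ (∃[ l ] Σ[ c ∈ (Fin N → Fin l) ] fromℕ (32 ℕ.* m) * sum₂ (Cleaning.badPair G c) ≤ fromℕ 26 * Δ * 𝑁)
    refute (l , c , few) = ℚ.<-irrefl refl (begin-strict
      fromℕ 26 * Δ * 𝑁  ≡⟨ ℚ.*-assoc (fromℕ 26) Δ 𝑁 ⟩
      fromℕ 26 * (Δ * 𝑁)  <⟨ ℚ.*-monoˡ-<-pos (Δ * 𝑁) {{ℚ.positive (*-pos (fromℕ-pos d) (fromℕ-pos N))}} 26<32 ⟩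
      fromℕ 32 * (Δ * 𝑁)  ≡⟨ cong (_* (Δ * 𝑁)) (ℚ.*-identityʳ (fromℕ 32)) ⟨
      fromℕ 32 * 1ℚ * (Δ * 𝑁)  ≤⟨ *-monoʳ-≤ 0≤ΔN (*-monoˡ-≤ (fromℕ-nonneg 32) 1≤mε) ⟩
      fromℕ 32 * (ν * ε) * (Δ * 𝑁)  ≡⟨ solve 3 (λ n e x → :ℕ 32 :* (n :* e) :* x := :ℕ 32 :* n :* (e :* x)) refl ν ε (Δ * 𝑁) ⟩
      fromℕ 32 * ν * (ε * (Δ * 𝑁))  ≡⟨ cong (λ x → fromℕ 32 * ν * (ε * x)) (fromℕ-* d N) ⟨
      fromℕ 32 * ν * (ε * fromℕ (d ℕ.* N))  ≤⟨ *-monoˡ-≤ (*-nonneg (fromℕ-nonneg 32) 0≤ν) (Cleaning.far⇒many-bad G c {ε} {d} far) ⟩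
      fromℕ 32 * ν * sum₂ (Cleaning.badPair G c)  ≡⟨ cong (_* sum₂ (Cleaning.badPair G c)) (fromℕ-* 32 m) ⟨
      fromℕ (32 ℕ.* m) * sum₂ (Cleaning.badPair G c)  ≤⟨ few ⟩
      fromℕ 26 * Δ * 𝑁  ∎)
      where
      26<32 : fromℕ 26 < fromℕ 32
      26<32 = ℚ.*<* (ℤ.+<+ (ℕ.<ᵇ⇒< 26 32 _))

-- Components are closed under positive edges, so every walk stays in the component of `s`, where no
-- negative edge joins two nodes.
clusterable⇒undetected : ∀ {N d} .{{_ : NonZero N}} .{{_ : NonZero d}} (G : SignedGraph N) (access : Access G d) → Clusterable G →
  ∀ w L s → Detection.detectionProbability G access w L s ≡ 0ℚ
clusterable⇒undetected {N} {d} G access (k , c , same , different) w L s =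
  trans (𝔼-cong-always (badCycle w L s) (badCycle-always {w} {L} {s} {E = λ r → 𝟙 (Maybe.is-just r) ≡ 0ℚ}
    (always-map (λ ws → proj₂) (replicateM w (walk L s)) (always-replicateM w (walk L s) (walk-always {E = λ v → c v ≡ c s} (λ v w v~s e → trans (sym (same v w e)) v~s) L s refl)))
    (λ ws all → cong (λ r → 𝟙 (Maybe.is-just r)) (verdict-nothing⁺ ws (λ {u} {v} u∈ v∈ e → different u v e (trans (inside ws all u∈) (sym (inside ws all v∈)))))) ))
    (𝔼-const 0ℚ (badCycle w L s))
  where
  open Access access using (oracle)
  open Semantics oracle
  open GraphAccess G access
  open Walk
  inside : ∀ ws → All (All (λ v → c v ≡ c s)) ws → ∀ {u} → u ∈ concat ws → c u ≡ c s
  inside ws all u∈ = All.lookup (All.concat⁺ all) u∈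


-- The parameters of the tester

-- ⌈√n⌉: it advances exactly when the square of the old value falls short of the new argument.
root : ℕ → ℕ
root zero    = 0
root (suc n) with root n ℕ.* root n ℕ.<? suc n
... | yes _ = suc (root n)
... | no  _ = root n

root-bounds : ∀ n → n ℕ.≤ root n ℕ.* root n × root n ℕ.* root n ℕ.≤ 4 ℕ.* n
root-bounds zero = ℕ.z≤n , ℕ.z≤n
root-bounds (suc n) with root-bounds n | root n ℕ.* root n ℕ.<? suc n
... | lower , upper | no r²≮1+n = ℕ.≮⇒≥ r²≮1+n , ℕ.≤-trans upper (ℕ.*-monoʳ-≤ 4 (ℕ.n≤1+n n))
... | lower , upper | yes r²<1+n = lower′ , upper′
  where
  open ℕ.≤-Reasoning
  r : ℕ
  r = root n
  square-suc : ∀ r → suc r ℕ.* suc r ≡ suc (r ℕ.* r) ℕ.+ (r ℕ.+ r)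
  square-suc = solve-∀
  r≤r² : ∀ r → r ℕ.≤ r ℕ.* r
  r≤r² zero    = ℕ.z≤n
  r≤r² (suc r) = ℕ.m≤m*n (suc r) (suc r)
  lower′ : suc n ℕ.≤ suc r ℕ.* suc r
  lower′ = begin
    suc n  ≤⟨ ℕ.s≤s lower ⟩
    suc (r ℕ.* r)  ≤⟨ ℕ.m≤m+n (suc (r ℕ.* r)) (r ℕ.+ r) ⟩
    suc (r ℕ.* r) ℕ.+ (r ℕ.+ r)  ≡⟨ square-suc r ⟨
    suc r ℕ.* suc r  ∎
  r≤n : r ℕ.≤ n
  r≤n = ℕ.≤-trans (r≤r² r) (ℕ.s≤s⁻¹ r²<1+n)
  upper′ : suc r ℕ.* suc r ℕ.≤ 4 ℕ.* suc n
  upper′ = begin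
    suc r ℕ.* suc r  ≡⟨ square-suc r ⟩
    suc (r ℕ.* r) ℕ.+ (r ℕ.+ r)  ≤⟨ ℕ.+-mono-≤ r²<1+n (ℕ.+-mono-≤ r≤n r≤n) ⟩
    suc n ℕ.+ (n ℕ.+ n)  ≤⟨ ℕ.+-monoʳ-≤ (suc n) (ℕ.+-mono-≤ (ℕ.n≤1+n n) (ℕ.n≤1+n n)) ⟩
    suc n ℕ.+ (suc n ℕ.+ suc n)  ≤⟨ ℕ.m≤m+n (suc n ℕ.+ (suc n ℕ.+ suc n)) (suc n) ⟩
    suc n ℕ.+ (suc n ℕ.+ suc n) ℕ.+ suc n  ≡⟨ four (suc n) ⟨
    4 ℕ.* suc n  ∎
    where
    four : ∀ x → 4 ℕ.* x ≡ x ℕ.+ (x ℕ.+ x) ℕ.+ x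
    four = solve-∀

n≤2^⌈log₂n⌉ : ∀ n → n ℕ.≤ 2 ℕ.^ ⌈log₂ n ⌉
n≤2^⌈log₂n⌉ n = go n n ℕ.≤-refl
  where
  open ℕ.≤-Reasoning
  go : ∀ k n → n ℕ.≤ k → n ℕ.≤ 2 ℕ.^ ⌈log₂ n ⌉
  go k       zero          _ = ℕ.z≤n
  go k       (suc zero)    _ = ℕ.m^n>0 2 ⌈log₂ 1 ⌉
  go (suc k) n@(suc (suc n′)) (ℕ.s≤s n≤k) = begin
    n  ≡⟨ ℕ.⌊n/2⌋+⌈n/2⌉≡n n ⟨
    ℕ.⌊ n /2⌋ ℕ.+ h  ≤⟨ ℕ.+-mono-≤ (ℕ.⌊n/2⌋≤⌈n/2⌉ n) (ℕ.m≤m+n h 0) ⟩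
    2 ℕ.* h  ≤⟨ ℕ.*-monoʳ-≤ 2 (go k h (ℕ.≤-trans (ℕ.s≤s⁻¹ (ℕ.⌈n/2⌉<n n′)) n≤k)) ⟩
    2 ℕ.^ suc ⌈log₂ h ⌉  ≡⟨ cong (2 ℕ.^_) (trans (cong suc (⌈log₂⌈n/2⌉⌉≡⌈log₂n⌉∸1 n)) (ℕ.suc-pred ⌈log₂ n ⌉ {{ℕ.>-nonZero (⌈log₂⌉-mono-≤ {2} {n} (ℕ.s≤s (ℕ.s≤s ℕ.z≤n)))}})) ⟩
    2 ℕ.^ ⌈log₂ n ⌉  ∎
    where
    h : ℕ
    h = ℕ.⌈ n /2⌉

-- ⌊1/ε⌋ + 1, for ε > 0
inverse : ℚ → ℕ
inverse ε = suc (ℚ.↧ₙ ε ℕ./ suc (ℕ.pred ℤ.∣ ℚ.↥ ε ∣))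

-- `suc (ℕ.pred _)` presents the numerator in a visibly nonzero form, as the division in `inverse`
-- requires.
*-denominator : ∀ ε .{{_ : ℚ.Positive ε}} → ε * fromℕ (ℚ.↧ₙ ε) ≡ fromℕ (suc (ℕ.pred ℤ.∣ ℚ.↥ ε ∣))
*-denominator ε@(ℚ.mkℚ ℤ.+[1+ p ] q c) = ℚ.toℚᵘ-injective (begin
  ℚ.toℚᵘ (ε * fromℕ (suc q))  ≈⟨ ℚ.toℚᵘ-homo-* ε (fromℕ (suc q)) ⟩
  mkℚᵘ ℤ.+[1+ p ] q ℚᵘ.* ℚ.toℚᵘ (fromℕ (suc q))  ≈⟨ ℚᵘ.*-congˡ {mkℚᵘ ℤ.+[1+ p ] q} (ℚ.toℚᵘ-fromℚᵘ (mkℚᵘ (ℤ.+ (suc q)) 0)) ⟩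
  mkℚᵘ ℤ.+[1+ p ] q ℚᵘ.* mkℚᵘ (ℤ.+ (suc q)) 0  ≈⟨ ℚᵘ.*≡* (cong (λ x → ℤ.+ x) (ℕ.*-assoc (suc p) (suc q) 1)) ⟩
  mkℚᵘ (ℤ.+ (suc p)) 0  ≈⟨ ℚ.toℚᵘ-fromℚᵘ (mkℚᵘ (ℤ.+ (suc p)) 0) ⟨
  ℚ.toℚᵘ (fromℕ (suc p))  ∎)
  where open import Relation.Binary.Reasoning.Setoid ℚᵘ.≃-setoid

module _ (I : Input) where

  open Input I

  n[_] : ℕ
  n[_] = inverse ε

  private
    A B : ℕ
    A = suc (ℕ.pred ℤ.∣ ℚ.↥ ε ∣)
    B = ℚ.↧ₙ ε

  ε*1/ε : ε * 1/ε ≡ 1ℚ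
  ε*1/ε = ℚ.*-inverseʳ ε {{ℚ.pos⇒nonZero ε}}

  1/ε-nonneg : 0ℚ ≤ 1/ε
  1/ε-nonneg = ℚ.<⇒≤ (ℚ.positive⁻¹ 1/ε {{ℚ.1/pos⇒pos ε}})

  1≤n*ε : 1ℚ ≤ fromℕ n[_] * ε
  1≤n*ε = *-cancelˡ-≤ (fromℕ B) (fromℕ-pos B) (begin
    fromℕ B * 1ℚ  ≡⟨ ℚ.*-identityʳ (fromℕ B) ⟩
    fromℕ B  ≤⟨ fromℕ-mono-≤ B≤ ⟩
    fromℕ (n[_] ℕ.* A)  ≡⟨ fromℕ-* n[_] A ⟩
    fromℕ n[_] * fromℕ A  ≡⟨ cong (fromℕ n[_] *_) (*-denominator ε) ⟨
    fromℕ n[_] * (ε * fromℕ B)  ≡⟨ solve 3 (λ n e b → n :* (e :* b) := b :* (n :* e)) refl (fromℕ n[_]) ε (fromℕ B) ⟩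
    fromℕ B * (fromℕ n[_] * ε)  ∎)
    where
    open ℚ.≤-Reasoning
    B≤ : B ℕ.≤ n[_] ℕ.* A
    B≤ = ℕ.≤-trans (ℕ.≤-reflexive (ℕ.m≡m%n+[m/n]*n B A)) (ℕ.+-monoˡ-≤ ((B ℕ./ A) ℕ.* A) (ℕ.<⇒≤ (ℕ.m%n<n B A)))

  -- The floor is at most 1/ε, and so is the added 1 when ε ≤ 1.
  n≤2/ε : ε ≤ 1ℚ → fromℕ n[_] ≤ 2ℚ * 1/ε
  n≤2/ε ε≤1 = begin
    fromℕ n[_]  ≡⟨ fromℕ-suc (B ℕ./ A) ⟩
    1ℚ + fromℕ (B ℕ./ A)  ≤⟨ ℚ.+-mono-≤ 1≤1/ε B/A≤ ⟩
    1/ε + 1/ε  ≡⟨ solve 1 (λ x → x :+ x := :2 :* x) refl 1/ε ⟩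
    2ℚ * 1/ε  ∎
    where
    open ℚ.≤-Reasoning
    1≤1/ε : 1ℚ ≤ 1/ε
    1≤1/ε = subst₂ _≤_ ε*1/ε (ℚ.*-identityˡ 1/ε) (*-monoʳ-≤ 1/ε-nonneg ε≤1)
    B/A≤ : fromℕ (B ℕ./ A) ≤ 1/ε
    B/A≤ = *-cancelˡ-≤ (fromℕ A) (fromℕ-pos A) (begin
      fromℕ A * fromℕ (B ℕ./ A)  ≡⟨ trans (ℚ.*-comm (fromℕ A) (fromℕ (B ℕ./ A))) (sym (fromℕ-* (B ℕ./ A) A)) ⟩
      fromℕ ((B ℕ./ A) ℕ.* A)  ≤⟨ fromℕ-mono-≤ (ℕ.m/n*n≤m B A) ⟩
      fromℕ B  ≡⟨ ℚ.*-identityˡ (fromℕ B) ⟨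
      1ℚ * fromℕ B  ≡⟨ cong (_* fromℕ B) ε*1/ε ⟨
      ε * 1/ε * fromℕ B  ≡⟨ solve 3 (λ e i b → e :* i :* b := e :* b :* i) refl ε 1/ε (fromℕ B) ⟩
      ε * fromℕ B * 1/ε  ≡⟨ cong (_* 1/ε) (*-denominator ε) ⟩
      fromℕ A * 1/ε  ∎)

  -- No graph is ε-far from clusterable for ε > 1; there the parameters
  -- vanish, as the asymptotic bounds require for large ε.
  guard : ℕ → ℕ
  guard x = if does (ε ℚ.≤? 1ℚ) then x else 0

  guard-cases : (ε ≤ 1ℚ × (∀ x → guard x ≡ x)) ⊎ (¬ ε ≤ 1ℚ × (∀ x → guard x ≡ 0))
  guard-cases = byDec (ε ℚ.≤? 1ℚ)
    (λ ε≤1 → inj₁ (ε≤1 , λ x → cong (λ b → if b then x else 0) (dec-true (ε ℚ.≤? 1ℚ) ε≤1)))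
    (λ ε≰1 → inj₂ (ε≰1 , λ x → cong (λ b → if b then x else 0) (dec-false (ε ℚ.≤? 1ℚ) ε≰1)))

  logarithm halvings timeBound excursionBound length′ groupSize : ℕ
  logarithm      = 1 ℕ.+ ⌈log₂ #nodes ⌉
  halvings       = 2 ℕ.+ logarithm
  timeBound      = halvings ℕ.* ((32 ℕ.* n[_]) ℕ.* (32 ℕ.* n[_]))
  excursionBound = 8 ℕ.* n[_] ℕ.* timeBound
  length′        = suc timeBound ℕ.* suc excursionBound
  groupSize      = (512 ℕ.* n[_]) ℕ.* root #nodes

  -- `halvings` exceeds ⌈log₂ N⌉ by 3, one of which is hidden in `logarithm`, and 2³ = 8.
  8N≤2^halvings : 8 ℕ.* #nodes ℕ.≤ 2 ℕ.^ halvings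
  8N≤2^halvings = ℕ.≤-trans (ℕ.*-monoʳ-≤ 8 (n≤2^⌈log₂n⌉ #nodes)) (ℕ.≤-reflexive (eight (2 ℕ.^ ⌈log₂ #nodes ⌉)))
    where
    eight : ∀ x → 8 ℕ.* x ≡ 2 ℕ.* (2 ℕ.* (2 ℕ.* x))
    eight = solve-∀

  -- 262144 = 512², and the square of `root` is at least N.
  groupSize-large : fromℕ 262144 * (fromℕ n[_] * fromℕ n[_]) * fromℕ #nodes ≤ fromℕ groupSize * fromℕ groupSize
  groupSize-large = begin
    fromℕ 262144 * (ν * ν) * fromℕ #nodes  ≤⟨ *-monoˡ-≤ (*-nonneg (fromℕ-nonneg 262144) (square-nonneg ν)) (fromℕ-mono-≤ (proj₁ (root-bounds #nodes))) ⟩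
    fromℕ 262144 * (ν * ν) * fromℕ (root #nodes ℕ.* root #nodes)  ≡⟨ cong (fromℕ 262144 * (ν * ν) *_) (fromℕ-* (root #nodes) (root #nodes)) ⟩
    fromℕ 262144 * (ν * ν) * (ρ * ρ)  ≡⟨ solve 2 (λ n r → :ℕ 262144 :* (n :* n) :* (r :* r) := :ℕ 512 :* n :* r :* (:ℕ 512 :* n :* r)) refl ν ρ ⟩
    fromℕ 512 * ν * ρ * (fromℕ 512 * ν * ρ)  ≡⟨ cong (λ x → x * x) (trans (fromℕ-* (512 ℕ.* n[_]) (root #nodes)) (cong (_* ρ) (fromℕ-* 512 n[_]))) ⟨
    fromℕ groupSize * fromℕ groupSize  ∎
    where
    open ℚ.≤-Reasoning
    ν ρ : ℚ
    ν = fromℕ n[_]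
    ρ = fromℕ (root #nodes)

-- Asymptotic bounds

monomial : ℕ → ℕ → ℕ → Input → ℕ
monomial a b k I = Input.degreeBound I ℕ.^ a ℕ.* (logarithm I ℕ.^ b ℕ.* n[_] I ℕ.^ k)

monomial-≢0 : ∀ a b k I → NonZero (monomial a b k I)
monomial-≢0 a b k I = ℕ.m*n≢0 (degreeBound ℕ.^ a) _ {{ℕ.m^n≢0 degreeBound a}} {{ℕ.m*n≢0 (logarithm I ℕ.^ b) (n[_] I ℕ.^ k) {{ℕ.m^n≢0 (logarithm I) b}} {{ℕ.m^n≢0 (n[_] I) k}}}}
  where open Input I

monomial-* : ∀ a b k a′ b′ k′ I → monomial a b k I ℕ.* monomial a′ b′ k′ I ≡ monomial (a ℕ.+ a′) (b ℕ.+ b′) (k ℕ.+ k′) I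
monomial-* a b k a′ b′ k′ I = trans (interchange (x ℕ.^ a) (y ℕ.^ b) (z ℕ.^ k) (x ℕ.^ a′) (y ℕ.^ b′) (z ℕ.^ k′))
  (sym (cong₂ ℕ._*_ (ℕ.^-distribˡ-+-* x a a′) (cong₂ ℕ._*_ (ℕ.^-distribˡ-+-* y b b′) (ℕ.^-distribˡ-+-* z k k′))))
  where
  x y z : ℕ
  x = Input.degreeBound I
  y = logarithm I
  z = n[_] I
  interchange : ∀ p q r p′ q′ r′ → p ℕ.* (q ℕ.* r) ℕ.* (p′ ℕ.* (q′ ℕ.* r′)) ≡ p ℕ.* p′ ℕ.* (q ℕ.* q′ ℕ.* (r ℕ.* r′))
  interchange = solve-∀

-- The growth of every quantity free of √N. Closure under sums and products lets bounds follow the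
-- shape of the definitions.
PolyBounded : (Input → ℕ) → Set
PolyBounded f = ∃[ c ] ∃[ a ] ∃[ b ] ∃[ k ] ∀ I → f I ℕ.≤ c ℕ.* monomial a b k I

const-polynomial : ∀ c → PolyBounded (λ _ → c)
const-polynomial c = c , 0 , 0 , 0 , λ I → ℕ.≤-reflexive (sym (ℕ.*-identityʳ c))

degreeBound-polynomial : PolyBounded Input.degreeBound
degreeBound-polynomial = 1 , 1 , 0 , 0 , λ I → ℕ.≤-reflexive (x≡ (Input.degreeBound I))
  where
  x≡ : ∀ x → x ≡ 1 ℕ.* (x ℕ.* 1 ℕ.* 1)
  x≡ = solve-∀

logarithm-polynomial : PolyBounded logarithm
logarithm-polynomial = 1 , 0 , 1 , 0 , λ I → ℕ.≤-reflexive (x≡ (logarithm I))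
  where
  x≡ : ∀ x → x ≡ 1 ℕ.* (1 ℕ.* (x ℕ.* 1 ℕ.* 1))
  x≡ = solve-∀

n-polynomial : PolyBounded n[_]
n-polynomial = 1 , 0 , 0 , 1 , λ I → ℕ.≤-reflexive (x≡ (n[_] I))
  where
  x≡ : ∀ x → x ≡ 1 ℕ.* (1 ℕ.* (1 ℕ.* (x ℕ.* 1)))
  x≡ = solve-∀

*-polynomial : ∀ {f g} → PolyBounded f → PolyBounded g → PolyBounded (λ I → f I ℕ.* g I)
*-polynomial {f} {g} (c , a , b , k , f≤) (c′ , a′ , b′ , k′ , g≤) = c ℕ.* c′ , a ℕ.+ a′ , b ℕ.+ b′ , k ℕ.+ k′ , λ I → begin
  f I ℕ.* g I  ≤⟨ ℕ.*-mono-≤ (f≤ I) (g≤ I) ⟩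
  c ℕ.* monomial a b k I ℕ.* (c′ ℕ.* monomial a′ b′ k′ I)  ≡⟨ swap c (monomial a b k I) c′ (monomial a′ b′ k′ I) ⟩
  c ℕ.* c′ ℕ.* (monomial a b k I ℕ.* monomial a′ b′ k′ I)  ≡⟨ cong (c ℕ.* c′ ℕ.*_) (monomial-* a b k a′ b′ k′ I) ⟩
  c ℕ.* c′ ℕ.* monomial (a ℕ.+ a′) (b ℕ.+ b′) (k ℕ.+ k′) I  ∎
  where
  open ℕ.≤-Reasoning
  swap : ∀ c x c′ x′ → c ℕ.* x ℕ.* (c′ ℕ.* x′) ≡ c ℕ.* c′ ℕ.* (x ℕ.* x′)
  swap = solve-∀

-- Monomials are at least 1, so each is bounded by the product of both; the wasted exponents are
-- harmless.
+-polynomial : ∀ {f g} → PolyBounded f → PolyBounded g → PolyBounded (λ I → f I ℕ.+ g I)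
+-polynomial {f} {g} (c , a , b , k , f≤) (c′ , a′ , b′ , k′ , g≤) = c ℕ.+ c′ , a ℕ.+ a′ , b ℕ.+ b′ , k ℕ.+ k′ , λ I →
  let x = monomial a b k I; y = monomial a′ b′ k′ I in begin
  f I ℕ.+ g I  ≤⟨ ℕ.+-mono-≤ (f≤ I) (g≤ I) ⟩
  c ℕ.* x ℕ.+ c′ ℕ.* y  ≤⟨ ℕ.+-mono-≤ (ℕ.*-monoʳ-≤ c (ℕ.m≤m*n x y {{monomial-≢0 a′ b′ k′ I}})) (ℕ.*-monoʳ-≤ c′ (ℕ.m≤n*m y x {{monomial-≢0 a b k I}})) ⟩
  c ℕ.* (x ℕ.* y) ℕ.+ c′ ℕ.* (x ℕ.* y)  ≡⟨ ℕ.*-distribʳ-+ (x ℕ.* y) c c′ ⟨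
  (c ℕ.+ c′) ℕ.* (x ℕ.* y)  ≡⟨ cong ((c ℕ.+ c′) ℕ.*_) (monomial-* a b k a′ b′ k′ I) ⟩
  (c ℕ.+ c′) ℕ.* monomial (a ℕ.+ a′) (b ℕ.+ b′) (k ℕ.+ k′) I  ∎
  where open ℕ.≤-Reasoning

length′-polynomial : PolyBounded length′
length′-polynomial = *-polynomial (+-polynomial (const-polynomial 1) time) (+-polynomial (const-polynomial 1) (*-polynomial (*-polynomial (const-polynomial 8) n-polynomial) time))
  where
  32n : PolyBounded (λ I → 32 ℕ.* n[_] I)
  32n = *-polynomial (const-polynomial 32) n-polynomial
  time : PolyBounded timeBound
  time = *-polynomial (+-polynomial (const-polynomial 2) logarithm-polynomial) (*-polynomial 32n 32n)

^-nonneg : ∀ {x} → 0ℚ ≤ x → ∀ k → 0ℚ ≤ x ^ k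
^-nonneg 0≤x zero    = 0≤1
^-nonneg 0≤x (suc k) = *-nonneg 0≤x (^-nonneg 0≤x k)

n^k≤ : ∀ I → Input.ε I ≤ 1ℚ → ∀ k → fromℕ (n[_] I ℕ.^ k) ≤ fromℕ (2 ℕ.^ k) * Input.1/ε I ^ k
n^k≤ I ε≤1 zero    = ℚ.≤-refl
n^k≤ I ε≤1 (suc k) = begin
  fromℕ (n[_] I ℕ.* n[_] I ℕ.^ k)  ≡⟨ fromℕ-* (n[_] I) (n[_] I ℕ.^ k) ⟩
  fromℕ (n[_] I) * fromℕ (n[_] I ℕ.^ k)  ≤⟨ *-mono-≤ (fromℕ-nonneg (n[_] I)) (*-nonneg (fromℕ-nonneg (2 ℕ.^ k)) (^-nonneg (1/ε-nonneg I) k)) (n≤2/ε I ε≤1) (n^k≤ I ε≤1 k) ⟩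
  2ℚ * 1/ε * (fromℕ (2 ℕ.^ k) * 1/ε ^ k)  ≡⟨ solve 4 (λ t x p y → t :* x :* (p :* y) := t :* p :* (x :* y)) refl 2ℚ 1/ε (fromℕ (2 ℕ.^ k)) (1/ε ^ k) ⟩
  2ℚ * fromℕ (2 ℕ.^ k) * (1/ε * 1/ε ^ k)  ≡⟨ cong (_* (1/ε * 1/ε ^ k)) (fromℕ-* 2 (2 ℕ.^ k)) ⟨
  fromℕ (2 ℕ.^ suc k) * 1/ε ^ suc k  ∎
  where
  open ℚ.≤-Reasoning
  open Input I using (1/ε)

-- Replacing each factor `n` by 2/ε moves a power of 2 into the constant, and `logarithm` is at most
-- the base of `hidden` for every `x`.
monomial≤hidden : ∀ c a b k I x → Input.ε I ≤ 1ℚ →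
  fromℕ (c ℕ.* monomial a b k I) ≤ fromℕ (hidden (c ℕ.* 2 ℕ.^ k) a b I x) * Input.1/ε I ^ k
monomial≤hidden c a b k I x ε≤1 = begin
  fromℕ (c ℕ.* monomial a b k I)  ≡⟨ cong fromℕ (regroup c (degreeBound ℕ.^ a) (logarithm I ℕ.^ b) (n[_] I ℕ.^ k)) ⟩
  fromℕ (c ℕ.* DL ℕ.* n[_] I ℕ.^ k)  ≡⟨ fromℕ-* (c ℕ.* DL) (n[_] I ℕ.^ k) ⟩
  fromℕ (c ℕ.* DL) * fromℕ (n[_] I ℕ.^ k)  ≤⟨ *-monoˡ-≤ (fromℕ-nonneg (c ℕ.* DL)) (n^k≤ I ε≤1 k) ⟩
  fromℕ (c ℕ.* DL) * (fromℕ (2 ℕ.^ k) * 1/ε ^ k)  ≡⟨ ℚ.*-assoc (fromℕ (c ℕ.* DL)) (fromℕ (2 ℕ.^ k)) (1/ε ^ k) ⟨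
  fromℕ (c ℕ.* DL) * fromℕ (2 ℕ.^ k) * 1/ε ^ k  ≡⟨ cong (_* 1/ε ^ k) (fromℕ-* (c ℕ.* DL) (2 ℕ.^ k)) ⟨
  fromℕ (c ℕ.* DL ℕ.* 2 ℕ.^ k) * 1/ε ^ k  ≤⟨ *-monoʳ-≤ (^-nonneg (1/ε-nonneg I) k) (fromℕ-mono-≤ ≤hidden) ⟩
  fromℕ (hidden (c ℕ.* 2 ℕ.^ k) a b I x) * 1/ε ^ k  ∎
  where
  open ℚ.≤-Reasoning
  open Input I
  DL : ℕ
  DL = degreeBound ℕ.^ a ℕ.* logarithm I ℕ.^ b
  regroup : ∀ c x y z → c ℕ.* (x ℕ.* (y ℕ.* z)) ≡ c ℕ.* (x ℕ.* y) ℕ.* z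
  regroup = solve-∀
  regroup′ : ∀ c x y z → c ℕ.* (x ℕ.* y) ℕ.* z ≡ c ℕ.* z ℕ.* x ℕ.* y
  regroup′ = solve-∀
  ≤hidden : c ℕ.* DL ℕ.* 2 ℕ.^ k ℕ.≤ hidden (c ℕ.* 2 ℕ.^ k) a b I x
  ≤hidden = ℕ.≤-trans (ℕ.≤-reflexive (regroup′ c (degreeBound ℕ.^ a) (logarithm I ℕ.^ b) (2 ℕ.^ k)))
    (ℕ.*-monoʳ-≤ (c ℕ.* 2 ℕ.^ k ℕ.* degreeBound ℕ.^ a) (ℕ.^-monoˡ-≤ b (ℕ.m≤m+n (logarithm I) ⌈log₂ ℤ.∣ ℚ.ceiling x ∣ ⌉)))

guarded-Õ : ∀ {f} → PolyBounded f → Õ[1/poly[ε]] (λ I → guard I (f I))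
guarded-Õ {f} (c , a , b , k , f≤) = k , c ℕ.* 2 ℕ.^ k , a , b , λ I → case guard-cases I of λ where
  (inj₁ (ε≤1 , guard≡)) → ℚ.≤-trans (fromℕ-mono-≤ (ℕ.≤-trans (ℕ.≤-reflexive (guard≡ (f I))) (f≤ I))) (monomial≤hidden c a b k I (Input.1/ε I ^ k) ε≤1)
  (inj₂ (_ , guard≡0)) → ℚ.≤-trans (ℚ.≤-reflexive (cong fromℕ (guard≡0 (f I))))
    (*-nonneg (fromℕ-nonneg (hidden (c ℕ.* 2 ℕ.^ k) a b I (Input.1/ε I ^ k))) (^-nonneg (1/ε-nonneg I) k))

-- The square of `root` is at most 4N, and the 4 is absorbed by doubling the constant. The second
-- alternative serves ε > 1, where the parameters vanish.
root-Õ√ : ∀ {f g} → PolyBounded f →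
  (∀ I → (Input.ε I ≤ 1ℚ × g I ≡ f I ℕ.* root (Input.#nodes I)) ⊎ g I ≡ 0) → Õ[√N/poly[ε]] g
root-Õ√ {f} {g} (c , a , b , k , f≤) bound = k , 2 ℕ.* c ℕ.* 2 ℕ.^ k , a , b , λ I → cases I (bound I)
  where
  module _ (I : Input) where
    open Input I
    open ℚ.≤-Reasoning
    target y h F ρ 𝑁 : ℚ
    target = fromℕ #nodes * (1/ε ^ k) ^ 2
    y = 1/ε ^ k
    h = fromℕ (hidden (2 ℕ.* c ℕ.* 2 ℕ.^ k) a b I target)
    F = fromℕ (f I)
    ρ = fromℕ (root #nodes)
    𝑁 = fromℕ #nodes
    0≤y : 0ℚ ≤ y
    0≤y = ^-nonneg (1/ε-nonneg I) k
    0≤h : 0ℚ ≤ h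
    0≤h = fromℕ-nonneg (hidden (2 ℕ.* c ℕ.* 2 ℕ.^ k) a b I target)
    ρ²≤ : ρ * ρ ≤ fromℕ 4 * 𝑁
    ρ²≤ = subst₂ _≤_ (fromℕ-* (root #nodes) (root #nodes)) (fromℕ-* 4 #nodes) (fromℕ-mono-≤ (proj₂ (root-bounds #nodes)))
    cases : (ε ≤ 1ℚ × g I ≡ f I ℕ.* root #nodes) ⊎ g I ≡ 0 → fromℕ (g I) ^ 2 ≤ h ^ 2 * target
    cases (inj₂ g≡0) = ℚ.≤-trans (ℚ.≤-reflexive (cong (λ x → fromℕ x ^ 2) g≡0))
      (*-nonneg (^-nonneg 0≤h 2) (*-nonneg (fromℕ-nonneg #nodes) (^-nonneg 0≤y 2)))
    cases (inj₁ (ε≤1 , g≡)) = begin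
      fromℕ (g I) ^ 2  ≡⟨ cong (_^ 2) (trans (cong fromℕ g≡) (fromℕ-* (f I) (root #nodes))) ⟩
      (F * ρ) ^ 2  ≡⟨ solve 2 (λ f r → f :* r :* (f :* r :* :1) := f :* f :* (r :* r)) refl F ρ ⟩
      F * F * (ρ * ρ)  ≤⟨ *-monoˡ-≤ (square-nonneg F) ρ²≤ ⟩
      F * F * (fromℕ 4 * 𝑁)  ≡⟨ solve 2 (λ f n → f :* f :* (:ℕ 4 :* n) := :2 :* f :* (:2 :* f) :* n) refl F 𝑁 ⟩
      2ℚ * F * (2ℚ * F) * 𝑁  ≤⟨ *-monoʳ-≤ (fromℕ-nonneg #nodes) (*-mono-≤ 0≤2F (*-nonneg 0≤h 0≤y) 2F≤ 2F≤) ⟩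
      h * y * (h * y) * 𝑁  ≡⟨ solve 3 (λ h y n → h :* y :* (h :* y) :* n := h :* (h :* :1) :* (n :* (y :* (y :* :1)))) refl h y 𝑁 ⟩
      h ^ 2 * target  ∎
      where
      0≤2F : 0ℚ ≤ 2ℚ * F
      0≤2F = *-nonneg 0≤2 (fromℕ-nonneg (f I))
      2F≤ : 2ℚ * F ≤ h * y
      2F≤ = begin
        2ℚ * F  ≡⟨ fromℕ-* 2 (f I) ⟨
        fromℕ (2 ℕ.* f I)  ≤⟨ fromℕ-mono-≤ (ℕ.≤-trans (ℕ.*-monoʳ-≤ 2 (f≤ I)) (ℕ.≤-reflexive (sym (ℕ.*-assoc 2 c (monomial a b k I))))) ⟩
        fromℕ (2 ℕ.* c ℕ.* monomial a b k I)  ≤⟨ monomial≤hidden (2 ℕ.* c) a b k I target ε≤1 ⟩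
        h * y  ∎

-- The tester

repetitions #walks walkLengths queryBound : Input → ℕ
-- Twice 8 n: a round detects with probability at least 1/(8n), and with tp ≥ 2 the bound 1/(1 + tp)
-- on acceptance is at most 1/3.
repetitions I = guard I (16 ℕ.* n[_] I)
#walks I      = guard I (groupSize I ℕ.+ groupSize I)
walkLengths I = guard I (length′ I)
queryBound I  = repetitions I ℕ.* (#walks I ℕ.* (walkLengths I ℕ.* degreeBound) ℕ.+ #walks I ℕ.* suc (walkLengths I) ℕ.* degreeBound)
  where open Input I

repetitions-O : repetitions ∈O Input.1/ε
repetitions-O = 32 , λ I → case guard-cases I of λ where
    (inj₁ (ε≤1 , guard≡)) → begin
      fromℕ (guard I (16 ℕ.* n[_] I))  ≡⟨ trans (cong fromℕ (guard≡ (16 ℕ.* n[_] I))) (fromℕ-* 16 (n[_] I)) ⟩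
      fromℕ 16 * fromℕ (n[_] I)  ≤⟨ *-monoˡ-≤ (fromℕ-nonneg 16) (n≤2/ε I ε≤1) ⟩
      fromℕ 16 * (2ℚ * Input.1/ε I)  ≡⟨ solve 1 (λ x → :ℕ 16 :* (:2 :* x) := :ℕ 32 :* x) refl (Input.1/ε I) ⟩
      fromℕ 32 * Input.1/ε I  ∎
    (inj₂ (_ , guard≡0)) → ℚ.≤-trans (ℚ.≤-reflexive (cong fromℕ (guard≡0 (16 ℕ.* n[_] I)))) (*-nonneg (fromℕ-nonneg 32) (1/ε-nonneg I))
  where open ℚ.≤-Reasoning

#walks-Õ√ : Õ[√N/poly[ε]] #walks
#walks-Õ√ = root-Õ√ (+-polynomial 512n 512n) (λ I → case guard-cases I of λ where
    (inj₁ (ε≤1 , guard≡)) → inj₁ (ε≤1 , trans (guard≡ (groupSize I ℕ.+ groupSize I)) (sym (ℕ.*-distribʳ-+ (root (Input.#nodes I)) (512 ℕ.* n[_] I) (512 ℕ.* n[_] I))))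
    (inj₂ (_ , guard≡0)) → inj₂ (guard≡0 (groupSize I ℕ.+ groupSize I)))
  where
  512n : PolyBounded (λ I → 512 ℕ.* n[_] I)
  512n = *-polynomial (const-polynomial 512) n-polynomial

queryBound-Õ√ : Õ[√N/poly[ε]] queryBound
queryBound-Õ√ = root-Õ√ {f} {queryBound} polynomial (λ I → case guard-cases I of λ where
    (inj₁ (ε≤1 , guard≡)) → inj₁ (ε≤1 , trans (cong₂ (λ r k → r ℕ.* (k ℕ.* (walkLengths I ℕ.* Input.degreeBound I) ℕ.+ k ℕ.* suc (walkLengths I) ℕ.* Input.degreeBound I)) (guard≡ (16 ℕ.* n[_] I)) (guard≡ (groupSize I ℕ.+ groupSize I)))
      (trans (cong (λ L → 16 ℕ.* n[_] I ℕ.* ((groupSize I ℕ.+ groupSize I) ℕ.* (L ℕ.* Input.degreeBound I) ℕ.+ (groupSize I ℕ.+ groupSize I) ℕ.* suc L ℕ.* Input.degreeBound I)) (guard≡ (length′ I)))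
        (factor (16 ℕ.* n[_] I) (512 ℕ.* n[_] I) (root (Input.#nodes I)) (length′ I) (Input.degreeBound I))))
    (inj₂ (_ , guard≡0)) → inj₂ (cong (ℕ._* (#walks I ℕ.* (walkLengths I ℕ.* Input.degreeBound I) ℕ.+ #walks I ℕ.* suc (walkLengths I) ℕ.* Input.degreeBound I)) (guard≡0 (16 ℕ.* n[_] I))))
  where
  f : Input → ℕ
  f I = 16 ℕ.* n[_] I ℕ.* (512 ℕ.* n[_] I ℕ.+ 512 ℕ.* n[_] I) ℕ.* (length′ I ℕ.+ (1 ℕ.+ length′ I)) ℕ.* Input.degreeBound I
  -- The bound is linear in the number of walks, the only parameter that carries √N.
  factor : ∀ r k √N L d → r ℕ.* ((k ℕ.* √N ℕ.+ k ℕ.* √N) ℕ.* (L ℕ.* d) ℕ.+ (k ℕ.* √N ℕ.+ k ℕ.* √N) ℕ.* suc L ℕ.* d) ≡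
           r ℕ.* (k ℕ.+ k) ℕ.* (L ℕ.+ (1 ℕ.+ L)) ℕ.* d ℕ.* √N
  factor = solve-∀
  512n : PolyBounded (λ I → 512 ℕ.* n[_] I)
  512n = *-polynomial (const-polynomial 512) n-polynomial
  polynomial : PolyBounded f
  polynomial = *-polynomial (*-polynomial (*-polynomial (*-polynomial (const-polynomial 16) n-polynomial) (+-polynomial 512n 512n))
    (+-polynomial length′-polynomial (+-polynomial (const-polynomial 1) length′-polynomial))) degreeBound-polynomial

tester : Algorithm
tester = randomWalkTester repetitions #walks walkLengths

queryComplexity : QueryComplexity≤ tester queryBound
queryComplexity I G access = Analysis.queries≤ (tester-analysis repetitions #walks walkLengths I G access)

module _ (I : Input) (G : SignedGraph (Input.#nodes I)) (access : Access G (Input.degreeBound I)) where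

  open Input I
  open Access access using (oracle)
  open Semantics oracle
  open Repetition I G access (#walks I) (walkLengths I)

  Pr-accept : Pr oracle id (tester I) ≡ acceptance (repetitions I)
  Pr-accept = trans (Pr≡𝔼 id (tester I)) (Analysis.accepts (tester-analysis repetitions #walks walkLengths I G access))

  Pr-reject : Pr oracle not (tester I) ≡ 1ℚ - acceptance (repetitions I)
  Pr-reject = begin
    Pr oracle not (tester I)  ≡⟨ Pr≡𝔼 not (tester I) ⟩
    𝔼 (λ b → 𝟙 (not b)) (tester I)  ≡⟨ 𝔼-cong 𝟙-not′ (tester I) ⟩
    𝔼 (λ b → 1ℚ - 𝟙 b) (tester I)  ≡⟨ trans (𝔼-- (λ _ → 1ℚ) 𝟙 (tester I)) (cong (λ x → x - 𝔼 𝟙 (tester I)) (𝔼-const 1ℚ (tester I))) ⟩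
    1ℚ - 𝔼 𝟙 (tester I)  ≡⟨ cong (λ x → 1ℚ - x) (Analysis.accepts (tester-analysis repetitions #walks walkLengths I G access)) ⟩
    1ℚ - acceptance (repetitions I)  ∎
    where
    open ≡-Reasoning
    𝟙-not′ : ∀ b → 𝟙 (not b) ≡ 1ℚ - 𝟙 b
    𝟙-not′ true  = refl
    𝟙-not′ false = refl

  accepts-clusterable : Clusterable G → Pr oracle id (tester I) ≡ 1ℚ
  accepts-clusterable clusterable = trans Pr-accept (always-accepts (repetitions I))
    where
    rejection≡0 : rejection ≡ 0ℚ
    rejection≡0 = trans (cong (1/ #nodes *_) (trans (sum-cong-≗ {#nodes} (clusterable⇒undetected G access clusterable (#walks I) (walkLengths I))) (sum-0 {#nodes}))) (ℚ.*-zeroʳ (1/ #nodes))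
    always-accepts : ∀ t → acceptance t ≡ 1ℚ
    always-accepts zero    = refl
    always-accepts (suc t) = trans (cong₂ (λ x y → (1ℚ - x) * y) rejection≡0 (always-accepts t)) refl

  rejection≤1 : rejection ≤ 1ℚ
  rejection≤1 = begin
    rejection  ≤⟨ *-monoˡ-≤ (1/-nonneg #nodes) (sum-mono-≤ (λ s → 𝔼-mono (λ c → 𝟙≤1 (Maybe.is-just c)) (badCycle (#walks I) (walkLengths I) s))) ⟩
    1/ #nodes * sum {#nodes} (λ s → 𝔼 (λ _ → 1ℚ) (badCycle (#walks I) (walkLengths I) s))  ≡⟨ cong (1/ #nodes *_) (sum-cong-≗ {#nodes} (λ s → 𝔼-const 1ℚ (badCycle (#walks I) (walkLengths I) s))) ⟩
    1/ #nodes * sum {#nodes} (λ _ → 1ℚ)  ≡⟨ 1/-average #nodes 1ℚ ⟩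
    1ℚ  ∎
    where open ℚ.≤-Reasoning

  -- (1 − p)ᵗ ≤ 1 / (1 + tp)
  acceptance-decay : ∀ t → 0ℚ ≤ acceptance t × acceptance t * (1ℚ + fromℕ t * rejection) ≤ 1ℚ
  acceptance-decay zero = 0≤1 , ℚ.≤-reflexive (solve 1 (λ p → :1 :* (:1 :+ :0 :* p) := :1) refl rejection)
  acceptance-decay (suc t) = let 0≤acc , acc≤ = acceptance-decay t in *-nonneg (p≤q⇒0≤q-p rejection≤1) 0≤acc , (begin
    (1ℚ - p) * acceptance t * (1ℚ + fromℕ (suc t) * p)  ≡⟨ cong (λ x → (1ℚ - p) * acceptance t * (1ℚ + x * p)) (fromℕ-suc t) ⟩
    (1ℚ - p) * acceptance t * (1ℚ + (1ℚ + fromℕ t) * p)  ≤⟨ ≤-by (acceptance t * ((1ℚ + fromℕ t) * (p * p))) (*-nonneg 0≤acc (*-nonneg (+-nonneg 0≤1 (fromℕ-nonneg t)) (square-nonneg p)))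
                                                                (solve 3 (λ p a t → a :* (:1 :+ t :* p) := (:1 :- p) :* a :* (:1 :+ (:1 :+ t) :* p) :+ a :* ((:1 :+ t) :* (p :* p))) refl p (acceptance t) (fromℕ t)) ⟩
    acceptance t * (1ℚ + fromℕ t * p)  ≤⟨ acc≤ ⟩
    1ℚ  ∎)
    where
    open ℚ.≤-Reasoning
    p : ℚ
    p = rejection

  rejects-far : Far ε degreeBound Clusterable G → (ℤ.+ 2) ℚ./ 3 ≤ Pr oracle not (tester I)
  rejects-far far = case guard-cases I of λ where
      (inj₁ (ε≤1 , guard≡)) → reject guard≡
      (inj₂ (ε≰1 , _)) → contradiction (far⇒ε≤1 G access far) ε≰1
    where
    open ℚ.≤-Reasoning
    reject : (∀ x → guard I x ≡ x) → (ℤ.+ 2) ℚ./ 3 ≤ Pr oracle not (tester I)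
    reject guard≡ = *-cancelˡ-≤ (fromℕ 3) (fromℕ-pos 3) (begin
      fromℕ 3 * ((ℤ.+ 2) ℚ./ 3)  ≤⟨ ≤-by (1ℚ - acc * fromℕ 3) (p≤q⇒0≤q-p 3acc≤1) (solve 1 (λ a → :ℕ 3 :* (:1 :- a) := :ℕ 3 :* con ((ℤ.+ 2) ℚ./ 3) :+ (:1 :- a :* :ℕ 3)) refl acc) ⟩
      fromℕ 3 * (1ℚ - acc)  ≡⟨ cong (fromℕ 3 *_) Pr-reject ⟨
      fromℕ 3 * Pr oracle not (tester I)  ∎)
      where
      acc ν : ℚ
      acc = acceptance (repetitions I)
      ν = fromℕ (n[_] I)
      detected : fromℕ #nodes ≤ fromℕ 8 * ν * sum (Detection.detectionProbability G access (#walks I) (walkLengths I))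
      detected = subst₂ (λ w L → fromℕ #nodes ≤ fromℕ 8 * ν * sum (Detection.detectionProbability G access w L))
        (sym (guard≡ (groupSize I ℕ.+ groupSize I))) (sym (guard≡ (length′ I)))
        (Soundness.far⇒detected G access (n[_] I) (halvings I) (8N≤2^halvings I) (groupSize I) (groupSize-large I) {ε} (1≤n*ε I) far)
      1≤8νp : 1ℚ ≤ fromℕ 8 * ν * rejection
      1≤8νp = begin
        1ℚ  ≡⟨ 1/-inverse #nodes ⟨
        1/ #nodes * fromℕ #nodes  ≤⟨ *-monoˡ-≤ (1/-nonneg #nodes) detected ⟩
        1/ #nodes * (fromℕ 8 * ν * sum (Detection.detectionProbability G access (#walks I) (walkLengths I)))  ≡⟨ solve 3 (λ r n s → r :* (:ℕ 8 :* n :* s) := :ℕ 8 :* n :* (r :* s)) refl (1/ #nodes) ν (sum (Detection.detectionProbability G access (#walks I) (walkLengths I))) ⟩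
        fromℕ 8 * ν * rejection  ∎
      3≤ : fromℕ 3 ≤ 1ℚ + fromℕ (repetitions I) * rejection
      3≤ = begin
        fromℕ 3  ≡⟨ solve 0 (:ℕ 3 := :1 :+ :2 :* :1) refl ⟩
        1ℚ + 2ℚ * 1ℚ  ≤⟨ ℚ.+-monoʳ-≤ 1ℚ (*-monoˡ-≤ 0≤2 1≤8νp) ⟩
        1ℚ + 2ℚ * (fromℕ 8 * ν * rejection)  ≡⟨ solve 2 (λ n p → :1 :+ :2 :* (:ℕ 8 :* n :* p) := :1 :+ :ℕ 16 :* n :* p) refl ν rejection ⟩
        1ℚ + fromℕ 16 * ν * rejection  ≡⟨ cong (λ x → 1ℚ + x * rejection) (trans (cong fromℕ (guard≡ (16 ℕ.* n[_] I))) (fromℕ-* 16 (n[_] I))) ⟨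
        1ℚ + fromℕ (repetitions I) * rejection  ∎
      3acc≤1 : acc * fromℕ 3 ≤ 1ℚ
      3acc≤1 = ℚ.≤-trans (*-monoˡ-≤ (proj₁ (acceptance-decay (repetitions I))) 3≤) (proj₂ (acceptance-decay (repetitions I)))

theorem10 : Σ[ repetitions ∈ (Input → ℕ) ] Σ[ #walks ∈ (Input → ℕ) ] Σ[ ℓ ∈ (Input → ℕ) ]
    repetitions ∈O Input.1/ε ×
    Õ[√N/poly[ε]] #walks ×
    Õ[1/poly[ε]] ℓ ×
    IsOneSidedTester Clusterable (randomWalkTester repetitions #walks ℓ) ×
    (∃[ q ] QueryComplexity≤ (randomWalkTester repetitions #walks ℓ) q × Õ[√N/poly[ε]] q)
theorem10 = repetitions , #walks , walkLengths , repetitions-O , #walks-Õ√ , guarded-Õ length′-polynomial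
  , ((λ I G access → (λ clusterable → ℚ.≤-trans 2/3≤1 (ℚ.≤-reflexive (sym (accepts-clusterable I G access clusterable)))) , rejects-far I G access)
    , accepts-clusterable)
  , queryBound , queryComplexity , queryBound-Õ√
  where
  2/3≤1 : (ℤ.+ 2) ℚ./ 3 ≤ 1ℚ
  2/3≤1 = ℚ.*≤* (ℤ.+≤+ (ℕ.≤ᵇ⇒≤ 2 3 _))
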